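{- For the problem of maximizing a non-negative submodular function $f:2^E\to\mathbb{R}_+$ under the $b$-matching constraint on a multigraph, there are one-pass streaming algorithms using $O((1+\log W)\cdot |M_{max}|)$ variables in memory and outputting a $b$-matching $M$ such that: (a) if $f$ is monotone, $(3+2\sqrt2)\,f(M)\ge f(M^{opt})$; (b) for general (possibly non-monotone) $f$, the algorithm is randomized and $(4+2\sqrt3)\,\mathbb{E}[f(M)]\ge f(M^{opt})$. Here $M^{opt}$ is a $b$-matching maximizing $f$, $M_{max}$ is a $b$-matching of maximum cardinality, and $W$ is the maximum quotient $\frac{f(e\,|\,Y)}{f(e'\,|\,X)}$ over $X\subseteq Y\subseteq E$ and $e,e'\in E$ with $f(e'\,|\,X)>0$.
   Context: Problem: $G=(V,E)$ is a finite multigraph without self-loops; each vertex $v$ has a capacity $b_v\in\mathbb{Z}_{+}$ (positive integer). A $b$-matching is a set $M\subseteq E$ such that each vertex $v$ has at most $b_v$ incident edges in $M$. A function $f:2^E\to\mathbb{R}_+$ is submodular if $f(X\cup\{e\})-f(X)\ge f(Y\cup\{e\})-f(Y)$ for all $X\subseteq Y\subsetneq E$, $e\in E\setminus Y$; it is monotone if $f(X)\le f(Y)$ whenever $X\subseteq Y$. Notation: $f(e\,|\,X)=f(X\cup\{e\})-f(X)$. (If no marginal value is positive, set $W=1$.) Streaming model: the edges of $E$ are revealed one at a time in arbitrary order, in a single pass. The algorithm has access to the vertex set and the capacities, and to a value oracle for $f$ on sets of edges it currently holds (this access is not counted as memory). Memory is the maximum number of variables stored simultaneously (each variable being an edge,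 a real number, an index or a pointer). After the pass, the algorithm computes its output from what it has stored. The constants hidden in $O(\cdot)$ are absolute. -}

module Defs where

open import Algebra.Bundles using (CommutativeRing; Semiring)
open import Algebra.Structures using (IsCommutativeRing)
open import Data.Bool.Base using (Bool; true; false; _∨_)
open import Data.Fin.Base using (Fin)
open import Data.Fin.Properties using (_≟_)
open import Data.Fin.Subset using (Subset; _∉_; _⊆_; _∩_; _∪_; ⁅_⁆; ⋃; ∣_∣)
open import Data.List.Base using (List; []; _∷_; length; map; tabulate; allFin)
open import Data.List.Membership.Propositional using () renaming (_∈_ to _∈ˡ_)
open import Data.List.Relation.Binary.Permutation.Propositional using (_↭_)
open import Data.List.Relation.Binary.Sublist.Propositional using () renaming (_⊆_ to _⊆ˡ_)
open import Data.List.Relation.Binary.Sublist.Propositional.Properties using (All-resp-⊆)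
open import Data.List.Relation.Unary.All using (All; []; _∷_; lookup)
open import Data.Nat.Base as ℕ using (ℕ; suc)
open import Data.Nat.ListAction using (sum)
open import Data.Product.Base using (_×_; _,_; proj₁; proj₂; ∃-syntax)
open import Data.Sum.Base using (_⊎_)
open import Data.Unit.Base using (⊤)
import Data.Vec.Base as Vec
open import Level using (0ℓ)
open import Relation.Binary.PropositionalEquality using (_≡_; _≢_)
open import Relation.Binary.Structures using (IsDecTotalOrder)
import Relation.Binary.Construct.NonStrictToStrict as ToStrict
open import Relation.Nullary using (¬_)
open import Relation.Nullary.Decidable using (⌊_⌋)

-- The real numbers, as a complete ordered field.  Classically this
-- determines them up to unique isomorphism.  The order is decidable,
-- since the algorithms below compare real numbers.  Inversion is total,
-- with an unspecified value at 0#.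

record RealNumbers : Set₁ where
  infix  4 _≤_
  infixl 6 _+_
  infixl 7 _*_
  infix  8 -_
  infix  9 _⁻¹
  field
    ℝ                 : Set
    _+_ _*_           : ℝ → ℝ → ℝ
    -_ _⁻¹            : ℝ → ℝ
    0# 1#             : ℝ
    _≤_               : ℝ → ℝ → Set
    isCommutativeRing : IsCommutativeRing _≡_ _+_ _*_ -_ 0# 1#
    0≢1               : 0# ≢ 1#
    ⁻¹-inverseʳ       : ∀ x → x ≢ 0# → x * x ⁻¹ ≡ 1#
    isDecTotalOrder   : IsDecTotalOrder _≡_ _≤_
    +-monoˡ-≤         : ∀ z {x y} → x ≤ y → x + z ≤ y + z
    *-nonNegative     : ∀ {x y} → 0# ≤ x → 0# ≤ y → 0# ≤ x * y

  IsUpperBound : (ℝ → Set) → ℝ → Set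
  IsUpperBound P u = ∀ x → P x → x ≤ u

  IsSupremum : (ℝ → Set) → ℝ → Set
  IsSupremum P s = IsUpperBound P s × (∀ u → IsUpperBound P u → s ≤ u)

  field
    complete : (P : ℝ → Set) → ∃[ x ] P x → ∃[ u ] IsUpperBound P u →
               ∃[ s ] IsSupremum P s

  commutativeRing : CommutativeRing 0ℓ 0ℓ
  commutativeRing = record { isCommutativeRing = isCommutativeRing }

  open CommutativeRing commutativeRing public using (_-_; semiring)
  open import Algebra.Definitions.RawSemiring (Semiring.rawSemiring semiring) public
    using (_^_) renaming (_×_ to _·_)
  open IsDecTotalOrder isDecTotalOrder public using (_≤?_)
  open ToStrict _≡_ _≤_ public using (_<_)

  infixl 7 _/_
  _/_ : ℝ → ℝ → ℝ
  x / y = x * y ⁻¹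

  fromℕ : ℕ → ℝ
  fromℕ k = k · 1#

  IsSqrt : ℝ → ℝ → Set
  IsSqrt x s = 0# ≤ s × s * s ≡ x

  -- For x ≥ 1, the binary logarithm of x is the supremum of the rationals
  -- p / q ≥ 0 with 2 ^ (p / q) ≤ x.
  IsLog₂ : ℝ → ℝ → Set
  IsLog₂ x = IsSupremum λ y →
    ∃[ p ] ∃[ q ] (y ≡ fromℕ p / fromℕ (suc q)) × (fromℕ 2 ^ p ≤ x ^ suc q)

-- The order in which the two ends of an edge are listed is irrelevant.

record Multigraph : Set where
  field
    #V #E    : ℕ
    ends     : Fin #E → Fin #V × Fin #V
    loopless : ∀ e → proj₁ (ends e) ≢ proj₂ (ends e)

  incident : Fin #V → Subset #E
  incident v = Vec.tabulate λ e →
    ⌊ v ≟ proj₁ (ends e) ⌋ ∨ ⌊ v ≟ proj₂ (ends e) ⌋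

  IsBMatching : (Fin #V → ℕ) → Subset #E → Set
  IsBMatching b M = ∀ v → ∣ M ∩ incident v ∣ ℕ.≤ b v

  IsMaximumBMatching : (Fin #V → ℕ) → Subset #E → Set
  IsMaximumBMatching b M =
    IsBMatching b M × (∀ N → IsBMatching b N → ∣ N ∣ ℕ.≤ ∣ M ∣)

  IsStream : List (Fin #E) → Set
  IsStream es = es ↭ allFin #E

module SetFunctions (𝓡 : RealNumbers) {m : ℕ} (f : Subset m → RealNumbers.ℝ 𝓡) where
  open RealNumbers 𝓡

  marginal : Fin m → Subset m → ℝ
  marginal e X = f (X ∪ ⁅ e ⁆) - f X

  NonNegative : Set
  NonNegative = ∀ X → 0# ≤ f X

  Submodular : Set
  Submodular = ∀ X Y e → X ⊆ Y → e ∉ Y → marginal e Y ≤ marginal e X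

  Monotone : Set
  Monotone = ∀ X Y → X ⊆ Y → f X ≤ f Y

  IsMarginalQuotient : ℝ → Set
  IsMarginalQuotient q =
    ∃[ X ] ∃[ Y ] ∃[ e ] ∃[ e′ ]
      X ⊆ Y × 0# < marginal e′ X × q ≡ marginal e Y / marginal e′ X

  IsMaxMarginalQuotient : ℝ → Set
  IsMaxMarginalQuotient W =
      (IsMarginalQuotient W × IsUpperBound IsMarginalQuotient W)
    ⊎ ((∀ X e → ¬ (0# < marginal e X)) × W ≡ 1#)

  IsMaximizerAmong : (Subset m → Set) → Subset m → Set
  IsMaximizerAmong P M = P M × (∀ N → P N → f N ≤ f M)

module Streaming (𝓡 : RealNumbers) where
  open RealNumbers 𝓡

  data Mode : Set where
    deterministic randomized : Mode

  -- Finite trees of coin tosses; a toss yields true with probability p.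

  data Rand (μ : Mode) (A : Set) : Set where
    pure : A → Rand μ A
    toss : μ ≡ randomized → (p : ℝ) → 0# ≤ p → p ≤ 1# → (Bool → Rand μ A) → Rand μ A

  infixl 1 _>>=_
  _>>=_ : ∀ {μ A B} → Rand μ A → (A → Rand μ B) → Rand μ B
  pure a             >>= h = h a
  toss r p 0≤p p≤1 k >>= h = toss r p 0≤p p≤1 λ c → k c >>= h

  outcome : ∀ {A} → Rand deterministic A → A
  outcome (pure a) = a

  𝔼 : ∀ {μ A} → (A → ℝ) → Rand μ A → ℝ
  𝔼 g (pure a)         = g a
  𝔼 g (toss _ p _ _ k) = p * 𝔼 g (k true) + (1# - p) * 𝔼 g (k false)

  Surely : ∀ {μ A} → (A → Set) → Rand μ A → Set
  Surely P (pure a)         = P a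
  Surely P (toss _ _ _ _ k) = ∀ c → Surely P (k c)

  data Kind : Set where
    edge real index : Kind

  data Operation : Set where
    add sub mul div : Operation

  apply : Operation → ℝ → ℝ → ℝ
  apply add = _+_
  apply sub = _-_
  apply mul = _*_
  apply div = _/_

  -- Programs for n vertices with capacities b.  The list Γ gives the kinds
  -- of the variables currently stored, so that its length is the memory in
  -- use.  A program has no direct access to edges and real numbers: it
  -- handles the stored ones by reference and branches only on discrete
  -- information (ends of edges, comparisons, indices, tosses).  In
  -- particular an edge that is no longer stored cannot be recovered by
  -- encoding it in a number, and the value oracle applies to stored edges
  -- only.  An index ranges over vertices, over the slots of a vertex, or
  -- over the positions in memory (a pointer), whence its bound.

  module _ (n : ℕ) (b : Fin n → ℕ) (μ : Mode) (Result : List Kind → Set) where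

    data Program (Γ : List Kind) : Set where
      return   : Result Γ → Program Γ
      keep     : ∀ {Δ} → Δ ⊆ˡ Γ → Program Δ → Program Γ
      copy     : ∀ {k} → k ∈ˡ Γ → Program (k ∷ Γ) → Program Γ
      constant : ℝ → Program (real ∷ Γ) → Program Γ
      operate  : Operation → real ∈ˡ Γ → real ∈ˡ Γ → Program (real ∷ Γ) → Program Γ
      compare  : real ∈ˡ Γ → real ∈ˡ Γ → (Bool → Program Γ) → Program Γ
      endsOf   : edge ∈ˡ Γ → (Fin n × Fin n → Program Γ) → Program Γ
      evaluate : List (edge ∈ˡ Γ) → Program (real ∷ Γ) → Program Γ
      write    : (i : ℕ) → i ℕ.≤ n ℕ.+ sum (tabulate b) ℕ.+ length Γ →
                 Program (index ∷ Γ) → Program Γ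
      read     : index ∈ˡ Γ → (ℕ → Program Γ) → Program Γ
      flip     : μ ≡ randomized → (p : ℝ) → 0# ≤ p → p ≤ 1# →
                 (Bool → Program Γ) → Program Γ

  -- Memory is initially empty, and `step` starts with the arriving edge
  -- added to it.  Nothing but the memory persists between steps.

  record Algorithm (μ : Mode) : Set where
    field
      step   : ∀ n (b : Fin n → ℕ) Γ → Program n b μ (λ _ → ⊤) (edge ∷ Γ)
      finish : ∀ n (b : Fin n → ℕ) Γ → Program n b μ (λ Δ → List (edge ∈ˡ Δ)) Γ

  module Execution (G : Multigraph) (b : Fin (Multigraph.#V G) → ℕ)
                   (f : Subset (Multigraph.#E G) → ℝ) where
    open Multigraph G

    Value : Kind → Set
    Value edge  = Fin #E
    Value real  = ℝ
    Value index = ℕ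

    Memory : List Kind → Set
    Memory = All Value

    edgeSet : ∀ {Γ} → Memory Γ → List (edge ∈ˡ Γ) → Subset #E
    edgeSet mem xs = ⋃ (map (λ x → ⁅ lookup mem x ⁆) xs)

    record Final (Result : List Kind → Set) : Set where
      constructor final
      field
        {kinds} : List Kind
        memory  : Memory kinds
        result  : Result kinds
        peak    : ℕ

    -- The last argument is the largest number of variables stored so far.

    exec : ∀ {μ Result Γ} → Program #V b μ Result Γ → Memory Γ → ℕ →
           Rand μ (Final Result)
    exec′ : ∀ {μ Result Γ} → Program #V b μ Result Γ → Memory Γ → ℕ →
            Rand μ (Final Result)
    exec {Γ = Γ} P mem k = exec′ P mem (k ℕ.⊔ length Γ)
    exec′ (return r)        mem k = pure (final mem r k)
    exec′ (keep Δ⊆Γ P)      mem k = exec P (All-resp-⊆ Δ⊆Γ mem) k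
    exec′ (copy x P)        mem k = exec P (lookup mem x ∷ mem) k
    exec′ (constant c P)    mem k = exec P (c ∷ mem) k
    exec′ (operate ∙ x y P) mem k = exec P (apply ∙ (lookup mem x) (lookup mem y) ∷ mem) k
    exec′ (compare x y P)   mem k = exec (P ⌊ lookup mem x ≤? lookup mem y ⌋) mem k
    exec′ (endsOf x P)      mem k = exec (P (ends (lookup mem x))) mem k
    exec′ (evaluate xs P)   mem k = exec P (f (edgeSet mem xs) ∷ mem) k
    exec′ (write i _ P)     mem k = exec P (i ∷ mem) k
    exec′ (read x P)        mem k = exec (P (lookup mem x)) mem k
    exec′ (flip r p 0≤p p≤1 P) mem k = toss r p 0≤p p≤1 λ c → exec (P c) mem k

    module _ {μ : Mode} (A : Algorithm μ) where
      open Algorithm A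

      Output : Set
      Output = Final λ Γ → List (edge ∈ˡ Γ)

      runFrom : ∀ {Γ} → Memory Γ → ℕ → List (Fin #E) → Rand μ Output
      runFrom {Γ} mem k []       = exec (finish #V b Γ) mem k
      runFrom {Γ} mem k (e ∷ es) =
        exec (step #V b Γ) (e ∷ mem) k >>= λ s →
        runFrom (Final.memory s) (Final.peak s) es

      run : List (Fin #E) → Rand μ Output
      run = runFrom [] 0

    selected : Final (λ Γ → List (edge ∈ˡ Γ)) → Subset #E
    selected s = edgeSet (Final.memory s) (Final.result s)

    -- At most C · (1 + log₂ W) · |M| variables are stored, for W the maximum
    -- marginal quotient of f and M a b-matching of maximum cardinality.

    UsesMemory : ℕ → ℕ → Set
    UsesMemory C k = ∀ W L M →
      SetFunctions.IsMaxMarginalQuotient 𝓡 f W → IsLog₂ W L → IsMaximumBMatching b M →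
      fromℕ k ≤ fromℕ C * (1# + L) * fromℕ ∣ M ∣

open Multigraph public using (#V; #E; IsBMatching; IsStream)

-- Every vertex v has b v slots.  An edge taken by the algorithm goes to the
-- lowest slot of each of its ends and raises the level of both by its gain, that
-- is, its marginal value minus the sum (price) of the two levels; it is taken
-- only if its marginal value exceeds α = 1 + a times the price (and, for general
-- f, if a coin falls on heads).
--
-- Value.  Taking the stored edges in reverse, while their slots are free, yields
-- a b-matching worth at least f ∅ plus the total gain.  Conversely an optimal
-- edge lost to the price test costs at most α times its price, and the coin is
-- biased so that one lost to the coin is in expectation also paid for by α times
-- the increase of the levels, charging each optimal edge at v to a slot of its
-- own; so f (S ∪ O) is in expectation at most f (S) plus 2 α times the total gain.
-- Finally f (S ∪ O) ≥ f (O) if f is monotone, and E f (S ∪ O) ≥ (1 - p) f (O) if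
-- every edge is taken with conditional probability at most p.
--
-- Memory.  Along a slot the levels grow geometrically, and they lie between
-- multiples of two marginal values, so that a slot is used O(1 + log W) times.
-- Each stored edge is in the maximum b-matching or uses a slot of a vertex
-- saturated by it.

module Submission where

open import Defs
open import Algebra.Bundles using (CommutativeMonoid; CommutativeRing)
import Algebra.Properties.CommutativeMonoid.Sum as CommutativeMonoidSum
import Algebra.Properties.Ring as RingProperties
import Algebra.Properties.Semiring.Mult as Mult
import Algebra.Solver.Ring as RingSolver
open import Algebra.Solver.Ring.AlmostCommutativeRing using (fromCommutativeRing; _-Raw-AlmostCommutative⟶_)
open import Data.Bool.Base using (Bool; true; false; if_then_else_; _∨_; _∧_; T)
open import Data.Empty using (⊥-elim)
open import Data.Fin.Base using (Fin; zero; suc; toℕ; fromℕ<)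
open import Data.Fin.Properties using (_≟_; toℕ-injective; toℕ-fromℕ<; toℕ<n)
open import Data.Fin.Subset using (Subset; _∈_; _∉_; _⊆_; _∩_; _∪_; ⁅_⁆; ⋃; ∣_∣; ⊥)
open import Data.Fin.Subset.Properties
open import Data.Integer.Base as ℤ using (ℤ)
import Data.Integer.Properties as ℤ
open import Data.List.Base using (List; []; _∷_; map; allFin; length; tabulate)
import Data.List.Membership.DecPropositional as DecMembership
open import Data.List.Membership.Propositional using () renaming (_∈_ to _∈ˡ_; _∉_ to _∉ˡ_)
open import Data.List.Membership.Propositional.Properties using (∈-allFin)
open import Data.List.Relation.Binary.Permutation.Propositional using (↭-sym; ↭⇒↭ₛ)
open import Data.List.Relation.Binary.Permutation.Propositional.Properties using (∈-resp-↭)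
import Data.List.Relation.Binary.Permutation.Setoid.Properties as SetoidPermutation
open import Data.List.Relation.Binary.Sublist.Propositional using (_∷ʳ_; _∷_)
  renaming (_⊆_ to _⊆ˡ_; ⊆-refl to ⊆ˡ-refl)
open import Data.List.Relation.Binary.Sublist.Propositional.Properties using (All-resp-⊆; All-resp-⊆-refl)
open import Data.List.Relation.Unary.All as All using (All; []; _∷_)
open import Data.List.Relation.Unary.All.Properties using (¬Any⇒All¬; All¬⇒¬Any)
open import Data.List.Relation.Unary.AllPairs using ([]; _∷_)
open import Data.List.Relation.Unary.Any using (here; there)
open import Data.List.Relation.Unary.Unique.Propositional using (Unique)
open import Data.List.Relation.Unary.Unique.Propositional.Properties using (allFin⁺)
open import Data.Maybe.Base as Maybe using (Maybe; just; nothing)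
open import Data.Nat.Base as ℕ using (ℕ; zero; suc)
open import Data.Nat.ListAction using () renaming (sum to sumˡ)
import Data.Nat.Properties as ℕ
open import Data.Nat.Tactic.RingSolver using (solve-∀)
open import Data.Product.Base using (_×_; _,_; proj₁; proj₂; ∃-syntax; Σ-syntax)
open import Data.Product.Properties using (≡-dec)
open import Data.Sum.Base using (_⊎_; inj₁; inj₂; [_,_]′)
open import Data.Unit.Base using (⊤; tt)
open import Data.Vec.Base as Vec using ([]; _∷_; lookup)
open import Data.Vec.Properties using (lookup∘tabulate; []=⇒lookup)
open import Function.Base using (_∘_; _$_)
open import Level using (0ℓ)
open import Relation.Binary.PropositionalEquality
open import Relation.Binary.Structures using (IsDecTotalOrder)
open import Relation.Nullary using (¬_; yes; no; Dec; contradiction)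
open import Relation.Nullary.Decidable using (⌊_⌋)

-- The memory bound does not involve the sum of the capacities, so a level per slot cannot be kept:
-- each entry carries the two levels that it creates, and the level of a slot is read off the newest
-- entry using it.
--
-- The delicate point of the charging is that the optimal edges at a vertex need distinct slots,
-- while the algorithm raises the lowest slot without knowing them and may raise one slot many
-- times. No assignment is maintained; the invariant `Dominated` says only that the charges at a
-- vertex are at most its largest levels, one for each optimal edge seen there.
--
-- Constants: with `ρ` = 1 / `a`, f (S) is at most f ∅ plus 1 + `ρ` times the total gain, so that f
-- (S ∪ O) is in expectation at most `κ` = 1 + `ρ` + 2 `α` times the expected value of the output.
-- For monotone f, `κ` = 3 + 2 a + 1 / a is least at a = √2 / 2. For general f the coin must satisfy
-- 1 - p ≤ 2 α p; equality makes 1 - p largest, and then `κ` / (1 - p) = 4 + 2 a + 3 / (2 a) is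
-- least at a = √3 / 2.

module OrderedField (𝓡 : RealNumbers) where
  open RealNumbers 𝓡
  open CommutativeRing commutativeRing using (ring; +-identityˡ; +-identityʳ; -‿inverseʳ;
    +-comm; +-assoc; *-comm; *-identityˡ) public
  open RingProperties ring using (-‿distribˡ-*; -‿distribʳ-*; -‿+-comm; -‿involutive; -0#≈0#)
  open Mult semiring using (×1-homo-*; ×-homo-+)
  open IsDecTotalOrder isDecTotalOrder public using ()
    renaming (refl to ≤-refl; trans to ≤-trans; antisym to ≤-antisym; total to ≤-total; reflexive
        to ≤-reflexive)

  private
    -- The ring solver takes its coefficients from the integers, whose equality computes; equality
    -- of the abstract reals is decidable but does not reduce.
    fromℤ : ℤ → ℝ
    fromℤ (ℤ.+ n)    = fromℕ n
    fromℤ ℤ.-[1+ n ] = - fromℕ (suc n)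

    fromℤ-neg : ∀ i → fromℤ (ℤ.- i) ≡ - fromℤ i
    fromℤ-neg (ℤ.+ zero)  = sym -0#≈0#
    fromℤ-neg (ℤ.+ suc n) = refl
    fromℤ-neg ℤ.-[1+ n ]  = sym (-‿involutive _)

    cancel : ∀ x y z → (x + y) - (x + z) ≡ y - z
    cancel x y z = begin
      (x + y) - (x + z)         ≡⟨ cong ((x + y) +_) (sym (-‿+-comm x z)) ⟩
      (x + y) + (- x + - z)     ≡⟨ cong (_+ (- x + - z)) (+-comm x y) ⟩
      (y + x) + (- x + - z)     ≡⟨ +-assoc y x _ ⟩
      y + (x + (- x + - z))     ≡⟨ cong (y +_) (sym (+-assoc x _ _)) ⟩
      y + ((x + - x) + - z)     ≡⟨ cong (λ w → y + (w + - z)) (-‿inverseʳ x) ⟩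
      y + (0# + - z)            ≡⟨ cong (y +_) (+-identityˡ _) ⟩
      y - z                     ∎
      where open ≡-Reasoning

    fromℤ-⊖ : ∀ m n → fromℤ (m ℤ.⊖ n) ≡ fromℕ m - fromℕ n
    fromℤ-⊖ m zero = sym (trans (cong (fromℕ m +_) -0#≈0#) (+-identityʳ _))
    fromℤ-⊖ zero (suc n) = sym (+-identityˡ _)
    fromℤ-⊖ (suc m) (suc n) = trans (cong fromℤ (ℤ.[1+m]⊖[1+n]≡m⊖n m n))
      (trans (fromℤ-⊖ m n) (sym (cancel 1# _ _)))

    fromℤ-+ : ∀ i j → fromℤ (i ℤ.+ j) ≡ fromℤ i + fromℤ j
    fromℤ-+ (ℤ.+ m) (ℤ.+ n) = ×-homo-+ 1# m n
    fromℤ-+ (ℤ.+ m) ℤ.-[1+ n ] = fromℤ-⊖ m (suc n)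
    fromℤ-+ ℤ.-[1+ m ] (ℤ.+ n) = trans (fromℤ-⊖ n (suc m)) (+-comm _ _)
    fromℤ-+ ℤ.-[1+ m ] ℤ.-[1+ n ] = trans
      (cong (λ k → - (1# + fromℕ k)) (sym (ℕ.+-suc m n)))
      (trans (cong -_ (×-homo-+ 1# (suc m) (suc n))) (sym (-‿+-comm _ _)))

    fromℤ-neg-* : ∀ m n → fromℤ (ℤ.- (ℤ.+ (m ℕ.* n))) ≡ - (fromℕ m * fromℕ n)
    fromℤ-neg-* m n = trans (fromℤ-neg (ℤ.+ (m ℕ.* n))) (cong -_ (×1-homo-* m n))

    fromℤ-* : ∀ i j → fromℤ (i ℤ.* j) ≡ fromℤ i * fromℤ j
    fromℤ-* (ℤ.+ m) (ℤ.+ n) = trans (cong fromℤ (sym (ℤ.pos-* m n))) (×1-homo-* m n)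
    fromℤ-* (ℤ.+ m) ℤ.-[1+ n ] = trans
      (cong fromℤ (trans (sym (ℤ.neg-distribʳ-* (ℤ.+ m) (ℤ.+ suc n)))
          (cong ℤ.-_ (sym (ℤ.pos-* m (suc n))))))
      (trans (fromℤ-neg-* m (suc n)) (-‿distribʳ-* _ _))
    fromℤ-* ℤ.-[1+ m ] (ℤ.+ n) = trans
      (cong fromℤ (trans (sym (ℤ.neg-distribˡ-* (ℤ.+ suc m) (ℤ.+ n)))
          (cong ℤ.-_ (sym (ℤ.pos-* (suc m) n)))))
      (trans (fromℤ-neg-* (suc m) n) (-‿distribˡ-* _ _))
    fromℤ-* ℤ.-[1+ m ] ℤ.-[1+ n ] = trans (×1-homo-* (suc m) (suc n))
      (trans (sym (-‿involutive _)) (trans (cong -_ (-‿distribˡ-* _ _)) (-‿distribʳ-* _ _)))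

    -- fromℤ with 1 sent to 1# itself instead of 1# + 0#, so that the
    -- constant 1 of a polynomial denotes 1#.
    ⟦_⟧ᶻ : ℤ → ℝ
    ⟦ ℤ.+ 1 ⟧ᶻ = 1#
    ⟦ i     ⟧ᶻ = fromℤ i

    ⟦⟧ᶻ≡fromℤ : ∀ i → ⟦ i ⟧ᶻ ≡ fromℤ i
    ⟦⟧ᶻ≡fromℤ (ℤ.+ 0)           = refl
    ⟦⟧ᶻ≡fromℤ (ℤ.+ 1)           = sym (+-identityʳ 1#)
    ⟦⟧ᶻ≡fromℤ (ℤ.+ suc (suc n)) = refl
    ⟦⟧ᶻ≡fromℤ ℤ.-[1+ n ]        = refl

    morphism : ℤ.+-*-rawRing -Raw-AlmostCommutative⟶ fromCommutativeRing commutativeRing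
    morphism = record
      { ⟦_⟧    = ⟦_⟧ᶻ
      ; +-homo = λ i j → trans (⟦⟧ᶻ≡fromℤ (i ℤ.+ j)) (trans (fromℤ-+ i j)
                   (sym (cong₂ _+_ (⟦⟧ᶻ≡fromℤ i) (⟦⟧ᶻ≡fromℤ j))))
      ; *-homo = λ i j → trans (⟦⟧ᶻ≡fromℤ (i ℤ.* j)) (trans (fromℤ-* i j)
                   (sym (cong₂ _*_ (⟦⟧ᶻ≡fromℤ i) (⟦⟧ᶻ≡fromℤ j))))
      ; -‿homo = λ i → trans (⟦⟧ᶻ≡fromℤ (ℤ.- i)) (trans (fromℤ-neg i)
                   (cong -_ (sym (⟦⟧ᶻ≡fromℤ i))))
      ; 0-homo = refl
      ; 1-homo = refl
      }

    fromℤ-≟ : ∀ i j → Maybe (⟦ i ⟧ᶻ ≡ ⟦ j ⟧ᶻ)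
    fromℤ-≟ i j with i ℤ.≟ j
    ... | yes i≡j = just (cong ⟦_⟧ᶻ i≡j)
    ... | no  _   = nothing

  open RingSolver ℤ.+-*-rawRing (fromCommutativeRing commutativeRing) morphism fromℤ-≟ public
    using (solve; _:=_; _:+_; _:*_; _:-_; Polynomial)
  open RingSolver ℤ.+-*-rawRing (fromCommutativeRing commutativeRing) morphism fromℤ-≟ using (con)

  -- Spelt as a sum of ones ending in zero, a numeral denotes `fromℕ n` definitionally.
  num : ∀ {m} → ℕ → Polynomial m
  num zero    = con ℤ.0ℤ
  num (suc n) = con ℤ.1ℤ :+ num n

  :1 : ∀ {m} → Polynomial m
  :1 = con ℤ.1ℤ

  *-nonneg : ∀ {x y} → 0# ≤ x → 0# ≤ y → 0# ≤ x * y
  *-nonneg = *-nonNegative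

  x≤y⇒0≤y-x : ∀ {x y} → x ≤ y → 0# ≤ y - x
  x≤y⇒0≤y-x {x} {y} x≤y = subst (_≤ y - x) (-‿inverseʳ x) (+-monoˡ-≤ (- x) x≤y)

  infixl 6 _+⁺_
  _+⁺_ : ∀ {x y} → 0# ≤ x → 0# ≤ y → 0# ≤ x + y
  _+⁺_ {x} {y} 0≤x 0≤y = ≤-trans 0≤y (subst (_≤ x + y) (+-identityˡ y) (+-monoˡ-≤ y 0≤x))

  -- Linear inequalities are proved by exhibiting the difference of the two
  -- sides as a nonnegative combination of the hypotheses.
  ≤-by : ∀ {x y r} → 0# ≤ r → y ≡ x + r → x ≤ y
  ≤-by {x} {y} {r} 0≤r refl = subst₂ _≤_ (+-identityˡ x) (+-comm r x) (+-monoˡ-≤ x 0≤r)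

  ≰⇒≥ : ∀ {x y} → ¬ x ≤ y → y ≤ x
  ≰⇒≥ {x} {y} x≰y with ≤-total x y
  ... | inj₁ x≤y = ⊥-elim (x≰y x≤y)
  ... | inj₂ y≤x = y≤x

  +-mono : ∀ {x y u v} → x ≤ y → u ≤ v → x + u ≤ y + v
  +-mono {x} {y} {u} {v} x≤y u≤v = ≤-by (x≤y⇒0≤y-x x≤y +⁺ x≤y⇒0≤y-x u≤v)
    (solve 4 (λ x y u v → y :+ v := x :+ u :+ ((y :- x) :+ (v :- u))) refl x y u v)

  *-monoʳ : ∀ {c x y} → 0# ≤ c → x ≤ y → c * x ≤ c * y
  *-monoʳ {c} {x} {y} 0≤c x≤y = ≤-by (*-nonneg 0≤c (x≤y⇒0≤y-x x≤y))
    (solve 3 (λ c x y → c :* y := c :* x :+ c :* (y :- x)) refl c x y)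

  *-monoˡ : ∀ {c x y} → 0# ≤ c → x ≤ y → x * c ≤ y * c
  *-monoˡ {c} {x} {y} 0≤c x≤y = subst₂ _≤_ (*-comm c x) (*-comm c y) (*-monoʳ 0≤c x≤y)

  *-mono : ∀ {x y u v} → 0# ≤ y → 0# ≤ u → x ≤ y → u ≤ v → x * u ≤ y * v
  *-mono 0≤y 0≤u x≤y u≤v = ≤-trans (*-monoˡ 0≤u x≤y) (*-monoʳ 0≤y u≤v)

  square-nonneg : ∀ x → 0# ≤ x * x
  square-nonneg x with ≤-total 0# x
  ... | inj₁ 0≤x = *-nonneg 0≤x 0≤x
  ... | inj₂ x≤0 = subst (0# ≤_) (solve 1 (λ x → (num 0 :- x) :* (num 0 :- x) := x :* x) refl x)
                     (*-nonneg (x≤y⇒0≤y-x x≤0) (x≤y⇒0≤y-x x≤0))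

  0≤1 : 0# ≤ 1#
  0≤1 = subst (0# ≤_) (*-identityˡ 1#) (square-nonneg 1#)

  1≰0 : ¬ 1# ≤ 0#
  1≰0 1≤0 = 0≢1 (≤-antisym 0≤1 1≤0)

  -- The sign of `c ⁻¹` is still unknown here. If `x ≰ y`, antisymmetry makes the two products
  -- equal, and division gives `x ≡ y`.
  *-cancelˡ : ∀ {c x y} → ¬ c ≤ 0# → c * x ≤ c * y → x ≤ y
  *-cancelˡ {c} {x} {y} c≰0 cx≤cy with x ≤? y
  ... | yes x≤y = x≤y
  ... | no  x≰y = ≤-reflexive (begin
    x              ≡⟨ sym (*-identityˡ x) ⟩
    1# * x         ≡⟨ cong (_* x) (sym c*c⁻¹≡1) ⟩
    c * c ⁻¹ * x   ≡⟨ rearrange x ⟩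
    c ⁻¹ * (c * x) ≡⟨ cong (c ⁻¹ *_) (≤-antisym cx≤cy (*-monoʳ (≰⇒≥ c≰0) (≰⇒≥ x≰y))) ⟩
    c ⁻¹ * (c * y) ≡⟨ sym (rearrange y) ⟩
    c * c ⁻¹ * y   ≡⟨ cong (_* y) c*c⁻¹≡1 ⟩
    1# * y         ≡⟨ *-identityˡ y ⟩
    y              ∎)
    where
    open ≡-Reasoning
    c*c⁻¹≡1 : c * c ⁻¹ ≡ 1#
    c*c⁻¹≡1 = ⁻¹-inverseʳ c λ c≡0 → c≰0 (≤-reflexive c≡0)
    rearrange : ∀ z → c * c ⁻¹ * z ≡ c ⁻¹ * (c * z)
    rearrange z = solve 3 (λ c d z → c :* d :* z := d :* (c :* z)) refl c (c ⁻¹) z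

  0≤fromℕ : ∀ n → 0# ≤ fromℕ n
  0≤fromℕ zero    = ≤-refl
  0≤fromℕ (suc n) = 0≤1 +⁺ 0≤fromℕ n

  fromℕ-mono : ∀ {m n} → m ℕ.≤ n → fromℕ m ≤ fromℕ n
  fromℕ-mono {n = n} ℕ.z≤n       = 0≤fromℕ n
  fromℕ-mono         (ℕ.s≤s m≤n) = +-mono ≤-refl (fromℕ-mono m≤n)

  fromℕ-+ : ∀ m n → fromℕ (m ℕ.+ n) ≡ fromℕ m + fromℕ n
  fromℕ-+ = ×-homo-+ 1#

  fromℕ-* : ∀ m n → fromℕ (m ℕ.* n) ≡ fromℕ m * fromℕ n
  fromℕ-* = ×1-homo-*

  1≰0′ : ∀ {x} → 1# ≤ x → ¬ x ≤ 0#
  1≰0′ 1≤x x≤0 = 1≰0 (≤-trans 1≤x x≤0)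

  positive-⁻¹ : ∀ {x} → 1# ≤ x → 0# ≤ x ⁻¹ × x * x ⁻¹ ≡ 1#
  positive-⁻¹ {x} 1≤x = *-cancelˡ (1≰0′ 1≤x)
      (subst₂ _≤_ (sym (solve 1 (λ x → x :* num 0 := num 0) refl x)) (sym inverse) 0≤1)
    , inverse
    where
    inverse : x * x ⁻¹ ≡ 1#
    inverse = ⁻¹-inverseʳ x λ x≡0 → 1≰0′ 1≤x (≤-reflexive x≡0)

  ^-nonneg : ∀ {x} n → 0# ≤ x → 0# ≤ x ^ n
  ^-nonneg zero    0≤x = 0≤1
  ^-nonneg (suc n) 0≤x = *-nonneg 0≤x (^-nonneg n 0≤x)

-- Finite sums, and domination by the largest values

module Spikes (M : CommutativeMonoid 0ℓ 0ℓ) where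
  open CommutativeMonoid M renaming (refl to ≈-refl; trans to ≈-trans)
  open CommutativeMonoidSum M public using (sum; ∑-distrib-+; sum-cong-≗)

  spike : ∀ {n} → Fin n → Carrier → Fin n → Carrier
  spike zero    a zero    = a
  spike zero    a (suc j) = ε
  spike (suc i) a zero    = ε
  spike (suc i) a (suc j) = spike i a j

  spike-at : ∀ {n} (i : Fin n) a → spike i a i ≡ a
  spike-at zero    a = refl
  spike-at (suc i) a = spike-at i a

  spike-off : ∀ {n} {i j : Fin n} → j ≢ i → ∀ a → spike i a j ≡ ε
  spike-off {i = zero}  {zero}  j≢i a = ⊥-elim (j≢i refl)
  spike-off {i = zero}  {suc j} j≢i a = refl
  spike-off {i = suc i} {zero}  j≢i a = refl
  spike-off {i = suc i} {suc j} j≢i a = spike-off (λ j≡i → j≢i (cong suc j≡i)) a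

  sum-ε : ∀ n → sum {n} (λ _ → ε) ≈ ε
  sum-ε zero    = ≈-refl
  sum-ε (suc n) = ≈-trans (identityˡ _) (sum-ε n)

  sum-spike : ∀ {n} (i : Fin n) a → sum (spike i a) ≈ a
  sum-spike {suc n} zero    a = ≈-trans (∙-cong ≈-refl (sum-ε n)) (identityʳ a)
  sum-spike {suc n} (suc i) a = ≈-trans (identityˡ _) (sum-spike i a)

module RealSums (𝓡 : RealNumbers) where
  open RealNumbers 𝓡
  open OrderedField 𝓡
  open Spikes (CommutativeRing.+-commutativeMonoid commutativeRing) public

  sum-mono : ∀ {n} {φ ψ : Fin n → ℝ} → (∀ i → φ i ≤ ψ i) → sum φ ≤ sum ψ
  sum-mono {zero}  φ≤ψ = ≤-refl
  sum-mono {suc n} φ≤ψ = +-mono (φ≤ψ zero) (sum-mono (λ i → φ≤ψ (suc i)))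

  sum-nonneg : ∀ {n} {φ : Fin n → ℝ} → (∀ i → 0# ≤ φ i) → 0# ≤ sum φ
  sum-nonneg {zero}  0≤φ = ≤-refl
  sum-nonneg {suc n} 0≤φ = 0≤φ zero +⁺ sum-nonneg (λ i → 0≤φ (suc i))

  sum-shift : ∀ {n} (φ : Fin n → ℝ) c → sum (λ i → φ i - c) ≡ sum φ - fromℕ n * c
  sum-shift {zero}  φ c = solve 1 (λ c → num 0 := num 0 :- num 0 :* c) refl c
  sum-shift {suc n} φ c = trans (cong (φ zero - c +_) (sum-shift (λ i → φ (suc i)) c))
    (solve 4 (λ x s k c → x :- c :+ (s :- k :* c) := x :+ s :- (:1 :+ k) :* c) refl
       (φ zero) (sum (λ i → φ (suc i))) (fromℕ n) c)

  sum-+spike : ∀ {n} {φ ψ : Fin n → ℝ} {i g} → (∀ j → ψ j ≡ φ j + spike i g j) →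
               sum ψ ≡ sum φ + g
  sum-+spike {φ = φ} {ψ} {i} {g} eq = trans (sum-cong-≗ eq)
    (trans (∑-distrib-+ φ (spike i g)) (cong (sum φ +_) (sum-spike i g)))

  infix 9 _⁺
  _⁺ : ℝ → ℝ
  y ⁺ = if ⌊ 0# ≤? y ⌋ then y else 0#

  0≤y⁺ : ∀ y → 0# ≤ y ⁺
  0≤y⁺ y with 0# ≤? y
  ... | yes 0≤y = 0≤y
  ... | no  _   = ≤-refl

  y≤y⁺ : ∀ y → y ≤ y ⁺
  y≤y⁺ y with 0# ≤? y
  ... | yes _   = ≤-refl
  ... | no  0≰y = ≰⇒≥ 0≰y

  ⁺-least : ∀ {y z} → y ≤ z → 0# ≤ z → y ⁺ ≤ z
  ⁺-least {y} y≤z 0≤z with 0# ≤? y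
  ... | yes _ = y≤z
  ... | no  _ = 0≤z

  ⁺-mono : ∀ {y z} → y ≤ z → y ⁺ ≤ z ⁺
  ⁺-mono {y} {z} y≤z = ⁺-least (≤-trans y≤z (y≤y⁺ z)) (0≤y⁺ z)

  -- For t ≤ k, this says that β is at most the sum of the t largest values of φ.
  Dominated : ∀ {k} → ℝ → ℕ → (Fin k → ℝ) → Set
  Dominated β t φ = ∀ x → β ≤ fromℕ t * x + sum (λ q → (φ q - x) ⁺)

  dominated-zero : ∀ {k} {φ : Fin k → ℝ} → Dominated 0# 0 φ
  dominated-zero {φ = φ} x = ≤-by (sum-nonneg (λ q → 0≤y⁺ (φ q - x)))
    (solve 2 (λ x s → num 0 :* x :+ s := num 0 :+ s) refl x (sum (λ q → (φ q - x) ⁺)))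

  dominated-mono : ∀ {k β t} {φ ψ : Fin k → ℝ} → (∀ q → φ q ≤ ψ q) →
                   Dominated β t φ → Dominated β t ψ
  dominated-mono φ≤ψ dom x = ≤-trans (dom x)
    (+-mono ≤-refl (sum-mono λ q → ⁺-mono (+-monoˡ-≤ (- x) (φ≤ψ q))))

  dominated-sum : ∀ {k β t} {φ : Fin k → ℝ} → (∀ q → 0# ≤ φ q) → Dominated β t φ → β ≤ sum φ
  dominated-sum {β = β} {t} {φ} 0≤φ dom = ≤-trans (dom 0#) (≤-trans
    (≤-reflexive (solve 2 (λ t s → t :* num 0 :+ s := s) refl (fromℕ t) (sum (λ q → (φ q - 0#) ⁺))))
    (sum-mono λ q → ⁺-least (≤-reflexive (solve 1 (λ y → y :- num 0 := y) refl (φ q))) (0≤φ q)))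

  -- The raised slot can bear the new charge even if it was charged before: its old charge then
  -- moves to an uncharged slot, which exists since `t < k` and is at least as high. The threshold
  -- form of `Dominated` expresses this exchange without naming slots.
  dominated-raise : ∀ {k β t g i} {φ ψ : Fin k → ℝ} → suc t ℕ.≤ k → 0# ≤ g →
                    (∀ q → φ i ≤ φ q) → (∀ q → ψ q ≡ φ q + spike i g q) →
                    Dominated β t φ → Dominated (β + (φ i + g)) (suc t) ψ
  dominated-raise {k} {β} {t} {g} {i} {φ} {ψ} t<k 0≤g least raise dom x with ≤-total (φ i) x
  -- The slot `i` contributed nothing above `x`, so its new excess over `x` is a pure increase of
  -- the sum.
  ... | inj₁ m≤x = ≤-by
        (x≤y⇒0≤y-x (dom x) +⁺ x≤y⇒0≤y-x (y≤y⁺ (φ i + g - x)) +⁺ x≤y⇒0≤y-x sums)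
        (solve 8 (λ t x old new β m g p →
            (:1 :+ t) :* x :+ new :=
            β :+ (m :+ g) :+ ((t :* x :+ old :- β) :+ (p :- (m :+ g :- x)) :+ (new :- (old :+ p))))
          refl (fromℕ t) x (sum (λ q → (φ q - x) ⁺)) (sum (λ q → (ψ q - x) ⁺)) β (φ i) g
          ((φ i + g - x) ⁺))
    where
    termwise : ∀ q → (φ q - x) ⁺ + spike i ((φ i + g - x) ⁺) q ≤ (ψ q - x) ⁺
    termwise q with q ≟ i
    ... | no q≢i = ≤-reflexive (begin
        (φ q - x) ⁺ + spike i ((φ i + g - x) ⁺) q ≡⟨ cong ((φ q - x) ⁺ +_) (spike-off q≢i _) ⟩
        (φ q - x) ⁺ + 0#                          ≡⟨ +-identityʳ _ ⟩
        (φ q - x) ⁺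
            ≡⟨ cong (λ y → (y - x) ⁺) (sym (+-identityʳ (φ q))) ⟩
        (φ q + 0# - x) ⁺
            ≡⟨ cong (λ y → (φ q + y - x) ⁺) (sym (spike-off q≢i g)) ⟩
        (φ q + spike i g q - x) ⁺                 ≡⟨ cong (λ y → (y - x) ⁺) (sym (raise q)) ⟩
        (ψ q - x) ⁺ ∎)
      where open ≡-Reasoning
    ... | yes refl = ≤-trans
        (+-mono (⁺-least {z = 0#}
                  (≤-by (x≤y⇒0≤y-x m≤x) (solve 2 (λ m x → num 0 := m :- x :+ (x :- m)) refl (φ q)
                      x)) ≤-refl)
                (≤-reflexive (spike-at q _)))
        (≤-reflexive (trans (+-identityˡ _)
          (cong (λ y → (y - x) ⁺) (sym (trans (raise q) (cong (φ q +_) (spike-at q g)))))))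
    sums : sum (λ q → (φ q - x) ⁺) + (φ i + g - x) ⁺ ≤ sum (λ q → (ψ q - x) ⁺)
    sums = ≤-trans (≤-reflexive (sym (sum-+spike {i = i} (λ _ → refl)))) (sum-mono termwise)
  -- Up to the minimum all positive parts are linear. The hypothesis is used at the threshold `φ i`;
  -- going down from there to `x` gains `k - (1 + t)` times the distance.
  ... | inj₂ x≤m = ≤-by
        (x≤y⇒0≤y-x dom-m +⁺ x≤y⇒0≤y-x sums
          +⁺ *-nonneg (x≤y⇒0≤y-x (fromℕ-mono t<k)) (x≤y⇒0≤y-x x≤m))
        (solve 8 (λ t k x m β g s new →
            (:1 :+ t) :* x :+ new :=
            β :+ (m :+ g) :+ ((t :* m :+ (s :- k :* m) :- β) :+ (new :- (s :+ g :- k :* x))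
               :+ (k :- (:1 :+ t)) :* (m :- x)))
          refl (fromℕ t) (fromℕ k) x (φ i) β g (sum φ) (sum (λ q → (ψ q - x) ⁺)))
    where
    sums : sum φ + g - fromℕ k * x ≤ sum (λ q → (ψ q - x) ⁺)
    sums = ≤-trans
      (≤-reflexive (sym (trans (sum-shift ψ x) (cong (_- fromℕ k * x) (sum-+spike {i = i} raise)))))
      (sum-mono λ q → y≤y⁺ (ψ q - x))
    dom-m : β ≤ fromℕ t * φ i + (sum φ - fromℕ k * φ i)
    dom-m = ≤-trans (dom (φ i)) (+-mono ≤-refl (≤-trans
      (sum-mono λ q → ⁺-least ≤-refl (x≤y⇒0≤y-x (least q)))
      (≤-reflexive (sum-shift φ (φ i)))))

  -- Written as the loop of comparisons that `leastRef` runs, so that program and analysis agree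
  -- also on ties.
  least : ∀ {A : Set} → (A → ℝ) → List A → A → A
  least φ []       c = c
  least φ (q ∷ qs) c = least φ qs (if ⌊ φ q ≤? φ c ⌋ then q else c)

  least-≤-start : ∀ {A : Set} (φ : A → ℝ) qs c → φ (least φ qs c) ≤ φ c
  least-≤-start φ []       c = ≤-refl
  least-≤-start φ (q ∷ qs) c with φ q ≤? φ c
  ... | yes q≤c = ≤-trans (least-≤-start φ qs q) q≤c
  ... | no  _   = least-≤-start φ qs c

  least-≤ : ∀ {A : Set} (φ : A → ℝ) {qs} c {q} → q ∈ˡ qs → φ (least φ qs c) ≤ φ q
  least-≤ φ {r ∷ qs} c (here refl) with φ r ≤? φ c
  ... | yes _   = least-≤-start φ qs r
  ... | no  r≰c = ≤-trans (least-≤-start φ qs c) (≰⇒≥ r≰c)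
  least-≤ φ {r ∷ qs} c (there q∈qs) with φ r ≤? φ c
  ... | yes _ = least-≤ φ r q∈qs
  ... | no  _ = least-≤ φ c q∈qs

-- Cardinalities of edge sets and degrees

module FiniteSets where
  open import Data.Nat.Base using (_+_; _*_; _≤_)

  module ℕSums where
    open Spikes ℕ.+-0-commutativeMonoid public

    sum-mono : ∀ {n} {φ ψ : Fin n → ℕ} → (∀ i → φ i ≤ ψ i) → sum φ ≤ sum ψ
    sum-mono {zero}  φ≤ψ = ℕ.z≤n
    sum-mono {suc n} φ≤ψ = ℕ.+-mono-≤ (φ≤ψ zero) (sum-mono (φ≤ψ ∘ suc))

    sum-*ʳ : ∀ {n} (φ : Fin n → ℕ) K → sum (λ i → φ i * K) ≡ sum φ * K
    sum-*ʳ {zero}  φ K = refl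
    sum-*ʳ {suc n} φ K = trans (cong (φ zero * K +_) (sum-*ʳ (φ ∘ suc) K))
      (sym (ℕ.*-distribʳ-+ K (φ zero) (sum (φ ∘ suc))))

    sum-const : ∀ n K → sum {n} (λ _ → K) ≡ n * K
    sum-const zero    K = refl
    sum-const (suc n) K = cong (K +_) (sum-const n K)

    sum-mono-< : ∀ {n} {φ ψ : Fin n → ℕ} → (∀ i → φ i ≤ ψ i) → ∀ {i} → φ i ℕ.< ψ i → sum φ ℕ.< sum ψ
    sum-mono-< φ≤ψ {zero}  φi<ψi = ℕ.+-mono-≤ φi<ψi (sum-mono (φ≤ψ ∘ suc))
    sum-mono-< φ≤ψ {suc i} φi<ψi =
      ℕ.≤-trans (ℕ.≤-reflexive (sym (ℕ.+-suc _ _)))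
          (ℕ.+-mono-≤ (φ≤ψ zero) (sum-mono-< (φ≤ψ ∘ suc) φi<ψi))

  open ℕSums

  𝟙 : Bool → ℕ
  𝟙 c = if c then 1 else 0

  edgesOf : ∀ {m} → List (Fin m) → Subset m
  edgesOf es = ⋃ (map ⁅_⁆ es)

  insert-absorb : ∀ {m} {X : Subset m} {e} → e ∈ X → ⁅ e ⁆ ∪ X ≡ X
  insert-absorb {X = X} {e} e∈X = ⊆-antisym
    (λ x∈ → case (x∈p∪q⁻ ⁅ e ⁆ X x∈)) (q⊆p∪q ⁅ e ⁆ X)
    where
    case : ∀ {x} → x ∈ ⁅ e ⁆ ⊎ x ∈ X → x ∈ X
    case (inj₁ x∈e) = subst (_∈ X) (sym (x∈⁅y⁆⇒x≡y e x∈e)) e∈X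
    case (inj₂ x∈X) = x∈X

  insert-⊆ : ∀ {m} {X Y : Subset m} {e} → e ∈ Y → X ⊆ Y → ⁅ e ⁆ ∪ X ⊆ Y
  insert-⊆ {X = X} {Y} {e} e∈Y X⊆Y x∈ with x∈p∪q⁻ ⁅ e ⁆ X x∈
  ... | inj₁ x∈e = subst (_∈ Y) (sym (x∈⁅y⁆⇒x≡y e x∈e)) e∈Y
  ... | inj₂ x∈X = X⊆Y x∈X

  ∪-monoʳ : ∀ {m} (X : Subset m) {Y Z : Subset m} → Y ⊆ Z → X ∪ Y ⊆ X ∪ Z
  ∪-monoʳ X {Y} {Z} Y⊆Z x∈ with x∈p∪q⁻ X Y x∈
  ... | inj₁ x∈X = p⊆p∪q Z x∈X
  ... | inj₂ x∈Y = q⊆p∪q X Z (Y⊆Z x∈Y)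

  ∪-monoˡ : ∀ {m} (X : Subset m) {Y Z : Subset m} → Y ⊆ Z → Y ∪ X ⊆ Z ∪ X
  ∪-monoˡ X {Y} {Z} Y⊆Z = subst₂ _⊆_ (∪-comm X Y) (∪-comm X Z) (∪-monoʳ X Y⊆Z)

  ∉-insert : ∀ {m} {X : Subset m} {e x} → x ≢ e → x ∉ X → x ∉ ⁅ e ⁆ ∪ X
  ∉-insert {X = X} {e} x≢e x∉X x∈ with x∈p∪q⁻ ⁅ e ⁆ X x∈
  ... | inj₁ x∈e = x≢e (x∈⁅y⁆⇒x≡y e x∈e)
  ... | inj₂ x∈X = x∉X x∈X

  ∈-insert : ∀ {m} (X : Subset m) e → e ∈ ⁅ e ⁆ ∪ X
  ∈-insert X e = p⊆p∪q X (x∈⁅x⁆ e)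

  private
    ∣∷∣ : ∀ {m} c (X : Subset m) → ∣ c ∷ X ∣ ≡ 𝟙 c + ∣ X ∣
    ∣∷∣ true  X = refl
    ∣∷∣ false X = refl

  card-insert : ∀ {m} (X I : Subset m) {e} → e ∉ X →
                ∣ (⁅ e ⁆ ∪ X) ∩ I ∣ ≡ 𝟙 (lookup I e) + ∣ X ∩ I ∣
  card-insert (true  ∷ X) (i ∷ I) {zero} e∉X = ⊥-elim (e∉X Vec.here)
  card-insert (false ∷ X) (i ∷ I) {zero} e∉X =
    trans (∣∷∣ i ((⊥ ∪ X) ∩ I)) (cong (λ Z → 𝟙 i + ∣ Z ∩ I ∣) (∪-identityˡ X))
  card-insert (c ∷ X) (i ∷ I) {suc e} e∉X = begin
    ∣ (c ∧ i) ∷ ((⁅ e ⁆ ∪ X) ∩ I) ∣                ≡⟨ ∣∷∣ (c ∧ i) ((⁅ e ⁆ ∪ X) ∩ I) ⟩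
    𝟙 (c ∧ i) + ∣ (⁅ e ⁆ ∪ X) ∩ I ∣
        ≡⟨ cong (𝟙 (c ∧ i) +_) (card-insert X I (e∉X ∘ Vec.there)) ⟩
    𝟙 (c ∧ i) + (𝟙 (lookup I e) + ∣ X ∩ I ∣)       ≡⟨ ℕ.+-comm (𝟙 (c ∧ i)) _ ⟩
    𝟙 (lookup I e) + ∣ X ∩ I ∣ + 𝟙 (c ∧ i)         ≡⟨ ℕ.+-assoc (𝟙 (lookup I e)) _ _ ⟩
    𝟙 (lookup I e) + (∣ X ∩ I ∣ + 𝟙 (c ∧ i))
        ≡⟨ cong (𝟙 (lookup I e) +_) (trans (ℕ.+-comm ∣ X ∩ I ∣ _) (sym (∣∷∣ (c ∧ i) (X ∩ I)))) ⟩
    𝟙 (lookup I e) + ∣ (c ∧ i) ∷ (X ∩ I) ∣         ∎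
    where open ≡-Reasoning

  card-∪ : ∀ {m} (X : Subset m) {e} → e ∉ X → ∣ ⁅ e ⁆ ∪ X ∣ ≡ suc ∣ X ∣
  card-∪ (true  ∷ X) {zero} e∉X = ⊥-elim (e∉X Vec.here)
  card-∪ (false ∷ X) {zero} e∉X = cong (suc ∘ ∣_∣) (∪-identityˡ X)
  card-∪ (c ∷ X) {suc e} e∉X = trans (∣∷∣ c (⁅ e ⁆ ∪ X))
    (trans (cong (𝟙 c +_) (card-∪ X (e∉X ∘ Vec.there)))
      (trans (ℕ.+-suc (𝟙 c) ∣ X ∣) (cong suc (sym (∣∷∣ c X)))))

  card-⊥∩ : ∀ {m} (I : Subset m) → ∣ ⊥ ∩ I ∣ ≡ 0
  card-⊥∩ []      = refl
  card-⊥∩ (i ∷ I) = card-⊥∩ I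

  private
    ∣∷∩∣ : ∀ {m} c (X : Subset m) I → ∣ (c ∷ X) ∩ I ∣ ≡ 𝟙 (c ∧ Vec.head I) + ∣ X ∩ Vec.tail I ∣
    ∣∷∩∣ c X (i ∷ I) = ∣∷∣ (c ∧ i) (X ∩ I)

    lookup-tail : ∀ {m} (I : Subset (suc m)) e → lookup (Vec.tail I) e ≡ lookup I (suc e)
    lookup-tail (i ∷ I) e = refl

    lookup-head : ∀ {m} (I : Subset (suc m)) → Vec.head I ≡ lookup I zero
    lookup-head (i ∷ I) = refl

  -- The incidence matrix is peeled off one element of the ground set at a time; each element of `X`
  -- contributes its column sum.
  double-count : ∀ {n m d} (X : Subset m) (I : Fin n → Subset m) →
                 (∀ e → sum (λ v → 𝟙 (lookup (I v) e)) ≡ d) → sum (λ v → ∣ X ∩ I v ∣) ≡ ∣ X ∣ * d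
  double-count {n} [] I column = trans (sum-cong-≗ λ v → card-[] (I v)) (sum-ε n)
    where
    card-[] : ∀ (J : Subset 0) → ∣ [] ∩ J ∣ ≡ 0
    card-[] [] = refl
  double-count {n} {suc m} {d} (c ∷ X) I column = begin
    sum (λ v → ∣ (c ∷ X) ∩ I v ∣)
        ≡⟨ sum-cong-≗ (λ v → ∣∷∩∣ c X (I v)) ⟩
    sum (λ v → 𝟙 (c ∧ Vec.head (I v)) + ∣ X ∩ Vec.tail (I v) ∣)      ≡⟨ ∑-distrib-+ {n} _ _ ⟩
    sum (λ v → 𝟙 (c ∧ Vec.head (I v))) + sum (λ v → ∣ X ∩ Vec.tail (I v) ∣)
      ≡⟨ cong₂ _+_ (first c) (double-count X (Vec.tail ∘ I)
           λ e → trans (sum-cong-≗ λ v → cong 𝟙 (lookup-tail (I v) e)) (column (suc e))) ⟩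
    𝟙 c * d + ∣ X ∣ * d
        ≡⟨ sym (ℕ.*-distribʳ-+ d (𝟙 c) ∣ X ∣) ⟩
    (𝟙 c + ∣ X ∣) * d
        ≡⟨ cong (_* d) (sym (∣∷∣ c X)) ⟩
    ∣ c ∷ X ∣ * d                                                    ∎
    where
    open ≡-Reasoning
    first : ∀ c → sum (λ v → 𝟙 (c ∧ Vec.head (I v))) ≡ 𝟙 c * d
    first true  = trans (sum-cong-≗ λ v → cong 𝟙 (lookup-head (I v)))
        (trans (column zero) (sym (ℕ.+-identityʳ d)))
    first false = sum-ε n

  module Degrees (G : Multigraph) where
    open Multigraph G hiding (#V; #E; IsBMatching; IsStream)

    tail head : Fin (#E G) → Fin (#V G)
    tail e = proj₁ (ends e)
    head e = proj₂ (ends e)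

    -- The ends of an edge are distinct, so the disjunction of the two tests is a sum.
    𝟙-incident : ∀ v e → 𝟙 (lookup (incident v) e) ≡ spike (tail e) 1 v + spike (head e) 1 v
    𝟙-incident v e = trans (cong 𝟙 (lookup∘tabulate _ e)) disjoint
      where
      disjoint : 𝟙 (⌊ v ≟ tail e ⌋ ∨ ⌊ v ≟ head e ⌋) ≡ spike (tail e) 1 v + spike (head e) 1 v
      disjoint with v ≟ tail e | v ≟ head e
      ... | yes refl | yes v≡h = ⊥-elim (loopless e v≡h)
      ... | yes refl | no  v≢h = sym (cong₂ _+_ (spike-at v 1) (spike-off v≢h 1))
      ... | no  v≢t  | yes refl = sym (cong₂ _+_ (spike-off v≢t 1) (spike-at v 1))
      ... | no  v≢t  | no  v≢h = sym (cong₂ _+_ (spike-off v≢t 1) (spike-off v≢h 1))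

    degree : Subset (#E G) → Fin (#V G) → ℕ
    degree X v = ∣ X ∩ incident v ∣

    degree-insert : ∀ {X e} v → e ∉ X →
      ∣ (⁅ e ⁆ ∪ X) ∩ incident v ∣ ≡ spike (tail e) 1 v + spike (head e) 1 v + ∣ X ∩ incident v ∣
    degree-insert {X} {e} v e∉X = trans (card-insert X (incident v) e∉X)
        (cong (_+ ∣ X ∩ incident v ∣) (𝟙-incident v e))

    handshake : ∀ X → sum (λ v → ∣ X ∩ incident v ∣) ≡ ∣ X ∣ * 2
    handshake X = double-count X incident λ e → begin
      sum (λ v → 𝟙 (lookup (incident v) e))
          ≡⟨ sum-cong-≗ (λ v → 𝟙-incident v e) ⟩
      sum (λ v → spike (tail e) 1 v + spike (head e) 1 v)              ≡⟨ ∑-distrib-+ {#V G} _ _ ⟩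
      sum (spike (tail e) 1) + sum (spike (head e) 1)
          ≡⟨ cong₂ _+_ (sum-spike (tail e) 1) (sum-spike (head e) 1) ⟩
      2                                                                ∎
      where open ≡-Reasoning

    vertexCases : ∀ v e → v ≡ tail e ⊎ v ≡ head e ⊎ (v ≢ tail e × v ≢ head e)
    vertexCases v e with v ≟ tail e | v ≟ head e
    ... | yes eq | _      = inj₁ eq
    ... | no  _  | yes eq = inj₂ (inj₁ eq)
    ... | no v≢t | no v≢h = inj₂ (inj₂ (v≢t , v≢h))

    tail≢head : ∀ e → tail e ≢ head e
    tail≢head = loopless

open FiniteSets

-- Slots, stored entries and states

Slot : ℕ → Set
Slot n = Fin n × ℕ

-- E and R are edges and real numbers in the analysis, references to them
-- in the programs.
record Cell (n : ℕ) (E R : Set) : Set where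
  constructor cell
  field
    handle              : E
    tailSlot headSlot   : Slot n
    tailLevel headLevel : R

module _ {n : ℕ} where

  infix 4 _≟ˢ_ _∈ˢ?_
  _≟ˢ_ : (s t : Slot n) → Dec (s ≡ t)
  _≟ˢ_ = ≡-dec _≟_ ℕ._≟_

  _∈ˢ?_ : (s : Slot n) (B : List (Slot n)) → Dec (s ∈ˡ B)
  _∈ˢ?_ = DecMembership._∈?_ _≟ˢ_

  topLevel : ∀ {E R : Set} → List (Cell n E R) → R → Slot n → R
  topLevel []       z s = z
  topLevel (c ∷ cs) z s =
    if ⌊ s ≟ˢ Cell.tailSlot c ⌋ then Cell.tailLevel c else
    if ⌊ s ≟ˢ Cell.headSlot c ⌋ then Cell.headLevel c else topLevel cs z s

  -- `B` holds the slots occupied by the edges chosen so far, which are newer than all of the list.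
  greedy : ∀ {E R : Set} → List (Cell n E R) → List (Slot n) → List E
  greedy []       B = []
  greedy (c ∷ cs) B =
    if ⌊ Cell.tailSlot c ∈ˢ? B ⌋ ∨ ⌊ Cell.headSlot c ∈ˢ? B ⌋ then greedy cs B else
    Cell.handle c ∷ greedy cs (Cell.tailSlot c ∷ Cell.headSlot c ∷ B)

module States (𝓡 : RealNumbers) (G : Multigraph) where
  open RealNumbers 𝓡
  open Degrees G

  record Entry : Set where
    constructor entry
    field
      edgeOf                : Fin (#E G)
      tailIndex headIndex : ℕ
      tailLevel headLevel : ℝ

    tailSlot headSlot : Slot (#V G)
    tailSlot = tail edgeOf , tailIndex
    headSlot = head edgeOf , headIndex

    toCell : Cell (#V G) (Fin (#E G)) ℝ
    toCell = cell edgeOf tailSlot headSlot tailLevel headLevel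

  open Entry public

  -- The newest entry comes first.
  State : Set
  State = List Entry

  edges : State → Subset (#E G)
  edges S = edgesOf (map edgeOf S)

  level : State → Slot (#V G) → ℝ
  level S = topLevel (map toCell S) 0#

  load : State → Entry → ℝ
  load S x = level S (tailSlot x) + level S (headSlot x)

  -- The gain is no field of an entry, since the raise of the tail slot reveals it; `headLevel≡`
  -- demands the same raise at the head.
  gain : State → Entry → ℝ
  gain S x = tailLevel x - level S (tailSlot x)

  totalGain : State → ℝ
  totalGain []      = 0#
  totalGain (x ∷ S) = gain S x + totalGain S

  matching : State → List (Slot (#V G)) → List (Fin (#E G))
  matching S = greedy (map toCell S)

-- Value and feasibility of the matching extracted from a state

module ValidStates (𝓡 : RealNumbers) (G : Multigraph) (b : Fin (#V G) → ℕ)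
                   (f : Subset (#E G) → RealNumbers.ℝ 𝓡)
                   (submodular : SetFunctions.Submodular 𝓡 f)
                   (a : RealNumbers.ℝ 𝓡) (0≤a : RealNumbers._≤_ 𝓡 (RealNumbers.0# 𝓡) a) where
  open RealNumbers 𝓡
  open OrderedField 𝓡
  open RealSums 𝓡
  open SetFunctions 𝓡 f
  open Degrees G
  open States 𝓡 G

  α : ℝ
  α = 1# + a

  InRange : Slot (#V G) → Set
  InRange (v , q) = q ℕ.< b v

  -- That the slots are the lowest ones enters only in the charging of optimal edges, through
  -- `bestIndex-least`.
  record Admissible (S : State) (x : Entry) : Set where
    field
      fresh      : edgeOf x ∉ edges S
      tailRange  : InRange (tailSlot x)
      headRange  : InRange (headSlot x)
      headLevel≡ : headLevel x ≡ level S (headSlot x) + gain S x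
      weight≡    : marginal (edgeOf x) (edges S) ≡ gain S x + load S x
      heavy      : ¬ marginal (edgeOf x) (edges S) ≤ α * load S x

  open Admissible public

  data Valid : State → Set where
    []  : Valid []
    _∷_ : ∀ {x S} → Admissible S x → Valid S → Valid (x ∷ S)

  tailSlot≢headSlot : ∀ x → tailSlot x ≢ headSlot x
  tailSlot≢headSlot x eq = Multigraph.loopless G (edgeOf x) (cong proj₁ eq)

  level-tail : ∀ S x → level (x ∷ S) (tailSlot x) ≡ level S (tailSlot x) + gain S x
  level-tail S x with tailSlot x ≟ˢ tailSlot x
  ... | yes _ = solve 2 (λ l s → l := s :+ (l :- s)) refl (tailLevel x) (level S (tailSlot x))
  ... | no ≢  = ⊥-elim (≢ refl)

  level-head : ∀ {S x} → Admissible S x →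
      level (x ∷ S) (headSlot x) ≡ level S (headSlot x) + gain S x
  level-head {S} {x} adm with headSlot x ≟ˢ tailSlot x | headSlot x ≟ˢ headSlot x
  ... | yes eq | _     = ⊥-elim (tailSlot≢headSlot x (sym eq))
  ... | no  _  | yes _ = headLevel≡ adm
  ... | no  _  | no ≢  = ⊥-elim (≢ refl)

  level-off : ∀ {S x s} → s ≢ tailSlot x → s ≢ headSlot x → level (x ∷ S) s ≡ level S s
  level-off {S} {x} {s} s≢t s≢h with s ≟ˢ tailSlot x | s ≟ˢ headSlot x
  ... | yes eq | _      = ⊥-elim (s≢t eq)
  ... | no  _  | yes eq = ⊥-elim (s≢h eq)
  ... | no  _  | no _   = refl

  mutual
    level-nonneg : ∀ {S} → Valid S → ∀ s → 0# ≤ level S s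
    level-nonneg [] s = ≤-refl
    level-nonneg {x ∷ S} (adm ∷ valid) s = ≤-trans (level-nonneg valid s) (level-mono adm valid s)

    load-nonneg : ∀ {S} → Valid S → ∀ x → 0# ≤ load S x
    load-nonneg valid x = level-nonneg valid (tailSlot x) +⁺ level-nonneg valid (headSlot x)

    -- The marginal value is gain plus load and exceeds `1 + a` times the load. This inequality
    -- makes levels grow geometrically and bounds the value of all stored edges by the gains.
    load≤gain : ∀ {S x} → Admissible S x → Valid S → a * load S x ≤ gain S x
    load≤gain {S} {x} adm valid = ≤-by
      (x≤y⇒0≤y-x (subst (α * load S x ≤_) (weight≡ adm) (≰⇒≥ (heavy adm))))
      (solve 3 (λ a l g → g := a :* l :+ (g :+ l :- (:1 :+ a) :* l)) refl a (load S x) (gain S x))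

    gain-nonneg : ∀ {S x} → Admissible S x → Valid S → 0# ≤ gain S x
    gain-nonneg {S} {x} adm valid =
        ≤-trans (*-nonneg 0≤a (load-nonneg valid x)) (load≤gain adm valid)

    level-mono : ∀ {S x} → Admissible S x → Valid S → ∀ s → level S s ≤ level (x ∷ S) s
    level-mono {S} {x} adm valid s = [ (λ { refl → ≤-by 0≤g (level-tail S x) }) , [ (λ { refl → ≤-by 0≤g (level-head adm) })
      , (λ (s≢t , s≢h) → ≤-reflexive (sym (level-off {S} {x} s≢t s≢h))) ]′ ]′ (slotCases s x)
      where 0≤g = gain-nonneg adm valid

    slotCases : ∀ s x → s ≡ tailSlot x ⊎ s ≡ headSlot x ⊎ (s ≢ tailSlot x × s ≢ headSlot x)
    slotCases s x with s ≟ˢ tailSlot x | s ≟ˢ headSlot x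
    ... | yes eq | _      = inj₁ eq
    ... | no  _  | yes eq = inj₂ (inj₁ eq)
    ... | no s≢t | no s≢h = inj₂ (inj₂ (s≢t , s≢h))

  f-insert : ∀ X e → f (⁅ e ⁆ ∪ X) ≡ f X + marginal e X
  f-insert X e = trans (cong f (∪-comm ⁅ e ⁆ X))
    (solve 2 (λ y x → y := x :+ (y :- x)) refl (f (X ∪ ⁅ e ⁆)) (f X))

  -- The level of a slot is the sum of the gains of the entries on it, so this bounds all gains that
  -- can be lost because slots of `B` are occupied.
  listLoad : State → List (Slot (#V G)) → ℝ
  listLoad S []      = 0#
  listLoad S (s ∷ B) = level S s + listLoad S B

  listLoad-mono : ∀ {S x} → Admissible S x → Valid S → ∀ B → listLoad S B ≤ listLoad (x ∷ S) B
  listLoad-mono adm valid []      = ≤-refl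
  listLoad-mono adm valid (s ∷ B) = +-mono (level-mono adm valid s) (listLoad-mono adm valid B)

  listLoad-hit : ∀ {S x s} → Admissible S x → Valid S → level (x ∷ S) s ≡ level S s + gain S x →
                 ∀ {B} → s ∈ˡ B → gain S x + listLoad S B ≤ listLoad (x ∷ S) B
  listLoad-hit {S} {x} {s} adm valid raised {_ ∷ B} (here refl) = ≤-trans
    (≤-reflexive (solve 3 (λ g l r → g :+ (l :+ r) := l :+ g :+ r) refl (gain S x) (level S s)
        (listLoad S B)))
    (+-mono (≤-reflexive (sym raised)) (listLoad-mono adm valid B))
  listLoad-hit {S} {x} adm valid raised {t ∷ B} (there s∈B) = ≤-trans
    (≤-reflexive (solve 3 (λ g l r → g :+ (l :+ r) := l :+ (g :+ r)) refl (gain S x) (level S t)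
        (listLoad S B)))
    (+-mono (level-mono adm valid t) (listLoad-hit adm valid raised s∈B))

  listLoad-miss : ∀ {S x} B → tailSlot x ∉ˡ B → headSlot x ∉ˡ B → listLoad (x ∷ S) B ≡ listLoad S B
  listLoad-miss []      t∉ h∉ = refl
  listLoad-miss {S} {x} (s ∷ B) t∉ h∉ = cong₂ _+_
    (level-off {S} {x} (λ s≡t → t∉ (here (sym s≡t))) (λ s≡h → h∉ (here (sym s≡h))))
    (listLoad-miss {S} {x} B (t∉ ∘ there) (h∉ ∘ there))

  matching-⊆ : ∀ S B → edgesOf (matching S B) ⊆ edges S
  matching-⊆ []      B x∈ = x∈
  matching-⊆ (x ∷ S) B with tailSlot x ∈ˢ? B | headSlot x ∈ˢ? B
  ... | yes _ | _     = q⊆p∪q ⁅ edgeOf x ⁆ (edges S) ∘ matching-⊆ S B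
  ... | no  _ | yes _ = q⊆p∪q ⁅ edgeOf x ⁆ (edges S) ∘ matching-⊆ S B
  ... | no  _ | no  _ = ∪-monoʳ ⁅ edgeOf x ⁆ (matching-⊆ S (tailSlot x ∷ headSlot x ∷ B))

  private
    charge : ∀ {y t g m l l′} → y + t ≤ m + l → g + l ≤ l′ → y + (g + t) ≤ m + l′
    charge {y} {t} {g} {m} {l} {l′} p q = ≤-by (x≤y⇒0≤y-x p +⁺ x≤y⇒0≤y-x q)
      (solve 6 (λ y t g m l l′ → m :+ l′ := y :+ (g :+ t) :+
          ((m :+ l :- (y :+ t)) :+ (l′ :- (g :+ l))))
        refl y t g m l l′)

  -- Each entry left out of the matching is charged to a newer matching edge
  -- with which it shares a slot.
  matching-value : ∀ {S} → Valid S → ∀ B →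
                   f ⊥ + totalGain S ≤ f (edgesOf (matching S B)) + listLoad S B
  matching-value [] B = ≤-by (empty-load B)
    (solve 2 (λ y l → y :+ l := y :+ num 0 :+ l) refl (f ⊥) (listLoad [] B))
    where
    empty-load : ∀ B → 0# ≤ listLoad [] B
    empty-load []      = ≤-refl
    empty-load (s ∷ B) = ≤-refl +⁺ empty-load B
  matching-value {x ∷ S} (adm ∷ valid) B with tailSlot x ∈ˢ? B | headSlot x ∈ˢ? B
  ... | yes t∈B | _ = charge (matching-value valid B) (listLoad-hit adm valid (level-tail S x) t∈B)
  ... | no _ | yes h∈B = charge (matching-value valid B)
      (listLoad-hit adm valid (level-head adm) h∈B)
  ... | no t∉B | no h∉B = ≤-by
    (x≤y⇒0≤y-x (matching-value valid B′) +⁺ x≤y⇒0≤y-x bound)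
    (trans (cong₂ _+_ (f-insert M (edgeOf x)) (listLoad-miss {S} {x} B t∉B h∉B))
      (solve 8 (λ y t g m l lt lh w → m :+ w :+ l := y :+ (g :+ t) :+
          ((m :+ (lt :+ (lh :+ l)) :- (y :+ t)) :+ (w :- (g :+ (lt :+ lh)))))
        refl (f ⊥) (totalGain S) (gain S x) (f M) (listLoad S B)
        (level S (tailSlot x)) (level S (headSlot x)) (marginal (edgeOf x) M)))
    where
    B′ = tailSlot x ∷ headSlot x ∷ B
    M = edgesOf (matching S B′)
    -- The marginal value only grows when passing from `S` to the chosen edges `M`. Its load part
    -- pays for blocking the two slots of `x`.
    bound : gain S x + load S x ≤ marginal (edgeOf x) M
    bound = subst (_≤ marginal (edgeOf x) M) (weight≡ adm)
      (submodular M (edges S) (edgeOf x) (matching-⊆ S B′) (fresh adm))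

  open ℕSums using () renaming (spike to spikeℕ; spike-at to spikeℕ-at; spike-off to spikeℕ-off)

  count : Fin (#V G) → List (Slot (#V G)) → ℕ
  count v []            = 0
  count v ((u , _) ∷ B) = spikeℕ u 1 v ℕ.+ count v B

  -- As a subset of `Fin (b v)`, so that the pigeonhole principle becomes the bound on the size of a
  -- subset.
  used : (v : Fin (#V G)) → List (Slot (#V G)) → Subset (b v)
  used v [] = ⊥
  used v ((u , q) ∷ B) with v ≟ u | q ℕ.<? b v
  ... | yes _ | yes q<b = ⁅ fromℕ< q<b ⁆ ∪ used v B
  ... | yes _ | no  _   = used v B
  ... | no  _ | _       = used v B

  used-sound : ∀ {v} B {i} → i ∈ used v B → (v , toℕ i) ∈ˡ B
  used-sound [] i∈ = ⊥-elim (∉⊥ i∈)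
  used-sound {v} ((u , q) ∷ B) {i} i∈ with v ≟ u | q ℕ.<? b v
  ... | yes refl | yes q<b = [ (λ i∈q →
      here (cong (v ,_) (trans (cong toℕ (x∈⁅y⁆⇒x≡y _ i∈q)) (toℕ-fromℕ< q<b))))
                             , there ∘ used-sound B ]′ (x∈p∪q⁻ ⁅ fromℕ< q<b ⁆ (used v B) i∈)
  ... | yes _    | no  _   = there (used-sound B i∈)
  ... | no  _    | _       = there (used-sound B i∈)

  count≤used : ∀ {v B} → Unique B → All InRange B → count v B ℕ.≤ ∣ used v B ∣
  count≤used [] [] = ℕ.z≤n
  count≤used {v} {(u , q) ∷ B} (s∉ ∷ unique) (inRange ∷ ranges) with v ≟ u | q ℕ.<? b v
  ... | yes refl | yes q<b = subst₂ ℕ._≤_ (cong (ℕ._+ count v B) (sym (spikeℕ-at v 1)))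
          (sym (card-∪ (used v B) (λ i∈ →
              All¬⇒¬Any s∉ (subst (λ k → (v , k) ∈ˡ B) (toℕ-fromℕ< q<b) (used-sound B i∈)))))
          (ℕ.s≤s (count≤used unique ranges))
  ... | yes refl | no  q≮b = contradiction inRange q≮b
  ... | no  v≢u  | _       = ℕ.≤-trans (ℕ.≤-reflexive (cong (ℕ._+ count v B) (spikeℕ-off v≢u 1)))
                               (count≤used unique ranges)

  -- Choosing an edge moves one unit at each of its ends from the degree to the count of occupied
  -- slots; at the bottom of the stack only distinct slots in range are left.
  matching-degree : ∀ {S} → Valid S → ∀ {B} → Unique B → All InRange B → ∀ v →
    ∣ edgesOf (matching S B) ∩ Multigraph.incident G v ∣ ℕ.+ count v B ℕ.≤ b v
  matching-degree [] {B} unique ranges v = ℕ.≤-trans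
    (ℕ.≤-reflexive (cong (ℕ._+ count v B) (card-⊥∩ (Multigraph.incident G v))))
    (ℕ.≤-trans (count≤used unique ranges) (∣p∣≤n (used v B)))
  matching-degree {x ∷ S} (adm ∷ valid) {B} unique ranges v with tailSlot x ∈ˢ? B | headSlot x ∈ˢ? B
  ... | yes _  | _      = matching-degree valid unique ranges v
  ... | no  _  | yes _  = matching-degree valid unique ranges v
  ... | no t∉B | no h∉B = ℕ.≤-trans
    (ℕ.≤-reflexive (trans (cong (ℕ._+ count v B) (degree-insert v e∉M))
        (rearrange (spikeℕ (tail (edgeOf x)) 1 v) (spikeℕ (head (edgeOf x)) 1 v) ∣ edgesOf M ∩
        Multigraph.incident G v ∣ (count v B))))
    (matching-degree valid {tailSlot x ∷ headSlot x ∷ B}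
      ((tailSlot≢headSlot x ∷ ¬Any⇒All¬ B t∉B) ∷ (¬Any⇒All¬ B h∉B ∷ unique))
      (tailRange adm ∷ headRange adm ∷ ranges) v)
    where
    M = matching S (tailSlot x ∷ headSlot x ∷ B)
    e∉M : edgeOf x ∉ edgesOf M
    e∉M = fresh adm ∘ matching-⊆ S (tailSlot x ∷ headSlot x ∷ B)
    rearrange : ∀ t h m c → t ℕ.+ h ℕ.+ m ℕ.+ c ≡ m ℕ.+ (t ℕ.+ (h ℕ.+ c))
    rearrange t h m c = trans (cong (ℕ._+ c) (ℕ.+-comm (t ℕ.+ h) m))
      (trans (ℕ.+-assoc m (t ℕ.+ h) c) (cong (m ℕ.+_) (ℕ.+-assoc t h c)))

  -- The value telescopes into marginal values, each being gain plus load, and the load is at most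
  -- `ρ` times the gain.
  f-edges : ∀ {ρ S} → 0# ≤ ρ → a * ρ ≡ 1# → Valid S → f (edges S) ≤ f ⊥ + (1# + ρ) * totalGain S
  f-edges {ρ} 0≤ρ aρ≡1 [] = ≤-reflexive
    (solve 2 (λ y r → y := y :+ (:1 :+ r) :* num 0) refl (f ⊥) ρ)
  f-edges {ρ} {x ∷ S} 0≤ρ aρ≡1 (adm ∷ valid) = ≤-trans (≤-reflexive step) (≤-by
    (x≤y⇒0≤y-x (f-edges 0≤ρ aρ≡1 valid) +⁺ *-nonneg 0≤ρ (x≤y⇒0≤y-x (load≤gain adm valid)))
    (solve 7 (λ y t r g l m a → y :+ (:1 :+ r) :* (g :+ t) :=
          (m :+ (g :+ a :* r :* l)) :+ ((y :+ (:1 :+ r) :* t :- m) :+ r :* (g :- a :* l)))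
        refl (f ⊥) (totalGain S) ρ (gain S x) (load S x) (f (edges S)) a))
    where
    step : f (edges (x ∷ S)) ≡ f (edges S) + (gain S x + a * ρ * load S x)
    step = begin
      f (edges (x ∷ S))                              ≡⟨ f-insert (edges S) (edgeOf x) ⟩
      f (edges S) + marginal (edgeOf x) (edges S)      ≡⟨ cong (f (edges S) +_) (weight≡ adm) ⟩
      f (edges S) + (gain S x + load S x)
          ≡⟨ cong (λ l → f (edges S) + (gain S x + l)) (sym (*-identityˡ _)) ⟩
      f (edges S) + (gain S x + 1# * load S x)
          ≡⟨ cong (λ c → f (edges S) + (gain S x + c * load S x)) (sym aρ≡1) ⟩
      f (edges S) + (gain S x + a * ρ * load S x)    ∎
      where open ≡-Reasoning

-- Random choices and the algorithm on abstract states

module Coins (𝓡 : RealNumbers) where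
  open RealNumbers 𝓡
  open OrderedField 𝓡
  open Streaming 𝓡

  -- Both algorithms are instances of one: without randomness the coin is absent and counts as
  -- `p ≡ 1#`, so that every formula in `p` still applies.
  Coin : Mode → ℝ → Set
  Coin μ p = (μ ≡ deterministic × p ≡ 1#) ⊎ (μ ≡ randomized × 0# ≤ p × p ≤ 1#)

  branch : ∀ {μ p A} → Coin μ p → Rand μ A → Rand μ A → Rand μ A
  branch (inj₁ _)               accept reject = accept
  branch (inj₂ (r , 0≤p , p≤1)) accept reject = toss r _ 0≤p p≤1 λ c → if c then accept else reject

  coin-nonneg : ∀ {μ p} → Coin μ p → 0# ≤ p
  coin-nonneg (inj₁ (_ , refl))    = 0≤1
  coin-nonneg (inj₂ (_ , 0≤p , _)) = 0≤p

  coin-≤1 : ∀ {μ p} → Coin μ p → p ≤ 1#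
  coin-≤1 (inj₁ (_ , refl))    = ≤-refl
  coin-≤1 (inj₂ (_ , _ , p≤1)) = p≤1

  𝔼-branch : ∀ {μ p A} (coin : Coin μ p) (g : A → ℝ) accept reject →
             𝔼 g (branch coin accept reject) ≡ p * 𝔼 g accept + (1# - p) * 𝔼 g reject
  𝔼-branch (inj₁ (_ , refl)) g accept reject =
    solve 2 (λ y n → y := :1 :* y :+ (:1 :- :1) :* n) refl (𝔼 g accept) (𝔼 g reject)
  𝔼-branch (inj₂ _) g accept reject = refl

  Surely-branch : ∀ {μ p A} (coin : Coin μ p) {P : A → Set} {accept reject} →
                  Surely P accept → Surely P reject → Surely P (branch coin accept reject)
  Surely-branch (inj₁ _) py pn = py
  Surely-branch (inj₂ _) py pn true  = py
  Surely-branch (inj₂ _) py pn false = pn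

  mix : ∀ {p x y u v} → 0# ≤ p → p ≤ 1# → x ≤ y → u ≤ v →
        p * x + (1# - p) * u ≤ p * y + (1# - p) * v
  mix 0≤p p≤1 x≤y u≤v = +-mono (*-monoʳ 0≤p x≤y) (*-monoʳ (x≤y⇒0≤y-x p≤1) u≤v)

  𝔼-mono : ∀ {μ A} {P : A → Set} {g h : A → ℝ} (r : Rand μ A) → Surely P r →
           (∀ x → P x → g x ≤ h x) → 𝔼 g r ≤ 𝔼 h r
  𝔼-mono (pure x)              px g≤h = g≤h x px
  𝔼-mono (toss _ p 0≤p p≤1 k) pk g≤h =
    mix 0≤p p≤1 (𝔼-mono (k true) (pk true) g≤h) (𝔼-mono (k false) (pk false) g≤h)

  𝔼-affine : ∀ {μ A} (g : A → ℝ) c d (r : Rand μ A) → 𝔼 (λ x → c * g x + d) r ≡ c * 𝔼 g r + d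
  𝔼-affine g c d (pure x)          = refl
  𝔼-affine g c d (toss _ p _ _ k) = trans
    (cong₂ (λ x y → p * x + (1# - p) * y) (𝔼-affine g c d (k true)) (𝔼-affine g c d (k false)))
    (solve 5 (λ p x y c d → p :* (c :* x :+ d) :+ (:1 :- p) :* (c :* y :+ d) :=
                c :* (p :* x :+ (:1 :- p) :* y) :+ d) refl p (𝔼 g (k true)) (𝔼 g (k false)) c d)

  𝔼-const : ∀ {μ A} c (r : Rand μ A) → 𝔼 (λ _ → c) r ≡ c
  𝔼-const c (pure _)          = refl
  𝔼-const c (toss _ p _ _ k) = trans
    (cong₂ (λ x y → p * x + (1# - p) * y) (𝔼-const c (k true)) (𝔼-const c (k false)))
    (solve 2 (λ p c → p :* c :+ (:1 :- p) :* c := c) refl p c)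

-- An edge is considered if its marginal value exceeds 1 + a times its price, and
-- then accepted with probability p.
record Parameters (𝓡 : RealNumbers) (μ : Streaming.Mode 𝓡) : Set where
  open RealNumbers 𝓡
  field
    a ρ p  : ℝ
    0≤a    : 0# ≤ a
    0≤ρ    : 0# ≤ ρ
    aρ≡1   : a * ρ ≡ 1#
    -- This gives `α * α ≥ 2` and bounds a marginal value by `α * α` times the gain, the two
    -- estimates behind the memory bound.
    growth : 1# ≤ (1# + a) * a
    coin   : Coins.Coin 𝓡 μ p
    -- Per unit of surplus, a rejection loses 1 with probability `1 - p`, and an acceptance raises
    -- two levels by 1 with probability `p`, worth `α` each.
    pays   : 1# - p ≤ (1# + a) * (p + p)

first : ∀ {m} → 1 ℕ.≤ m → Fin m
first {suc m} _ = zero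

module Process (𝓡 : RealNumbers) {μ : Streaming.Mode 𝓡} (params : Parameters 𝓡 μ)
               (G : Multigraph) (b : Fin (#V G) → ℕ) (1≤b : ∀ v → 1 ℕ.≤ b v)
               (f : Subset (#E G) → RealNumbers.ℝ 𝓡) where
  open RealNumbers 𝓡
  open RealSums 𝓡
  open Streaming 𝓡
  open Parameters params
  open Coins 𝓡
  open Degrees G
  open States 𝓡 G

  bestIndex : State → (v : Fin (#V G)) → Fin (b v)
  bestIndex S v = least (λ q → level S (v , toℕ q)) (allFin (b v)) (first (1≤b v))

  price₁ price₂ price weight surplus : State → Fin (#E G) → ℝ
  price₁ S e = level S (tail e , toℕ (bestIndex S (tail e)))
  price₂ S e = level S (head e , toℕ (bestIndex S (head e)))
  price S e = price₁ S e + price₂ S e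
  weight S e = f (⁅ e ⁆ ∪ edges S) - f (edges S)
  surplus S e = weight S e - price S e

  newEntry : State → Fin (#E G) → Entry
  newEntry S e = entry e (toℕ (bestIndex S (tail e))) (toℕ (bestIndex S (head e)))
                   (price₁ S e + surplus S e) (price₂ S e + surplus S e)

  process : List (Fin (#E G)) → State → Rand μ State
  process []       S = pure S
  process (e ∷ es) S = if ⌊ weight S e ≤? (1# + a) * price S e ⌋ then process es S else
    branch coin (process es (newEntry S e ∷ S)) (process es S)

-- Lower bound for the expected value of f (S ∪ O), and the sum of all levels

module Expectation (𝓡 : RealNumbers) {μ : Streaming.Mode 𝓡} (params : Parameters 𝓡 μ)
                   (G : Multigraph) (b : Fin (#V G) → ℕ) (1≤b : ∀ v → 1 ℕ.≤ b v)
                   (f : Subset (#E G) → RealNumbers.ℝ 𝓡)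
                   (submodular : SetFunctions.Submodular 𝓡 f) where
  open RealNumbers 𝓡
  open OrderedField 𝓡
  open RealSums 𝓡
  open SetFunctions 𝓡 f
  open Streaming 𝓡
  open Parameters params
  open Coins 𝓡
  open Degrees G
  open States 𝓡 G
  open ValidStates 𝓡 G b f submodular a 0≤a
  open Process 𝓡 params G b 1≤b f
  open Multigraph G using (incident)

  weight≡marginal : ∀ S e → weight S e ≡ marginal e (edges S)
  weight≡marginal S e = cong (λ X → f X - f (edges S)) (∪-comm ⁅ e ⁆ (edges S))

  gain≡surplus : ∀ S e → gain S (newEntry S e) ≡ surplus S e
  gain≡surplus S e = solve 2 (λ s g → s :+ g :- s := g) refl (price₁ S e) (surplus S e)

  admissible : ∀ {S e} → e ∉ edges S → ¬ weight S e ≤ α * price S e → Admissible S (newEntry S e)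
  admissible {S} {e} e∉S heavy = record
    { fresh = e∉S
    ; tailRange = toℕ<n (bestIndex S (tail e))
    ; headRange = toℕ<n (bestIndex S (head e))
    ; headLevel≡ = cong (price₂ S e +_) (sym (gain≡surplus S e))
    ; weight≡ = trans (sym (weight≡marginal S e)) (trans
        (solve 2 (λ w l → w := w :- l :+ l) refl (weight S e) (price S e))
        (cong (_+ price S e) (sym (gain≡surplus S e))))
    ; heavy = heavy ∘ subst (_≤ α * price S e) (sym (weight≡marginal S e))
    }

  Avoids : Subset (#E G) → List (Fin (#E G)) → Set
  Avoids X es = All (_∉ X) es

  avoids-insert : ∀ {X e es} → All (e ≢_) es → Avoids X es → Avoids (⁅ e ⁆ ∪ X) es
  avoids-insert []             []           = []
  avoids-insert (e≢x ∷ distinct) (x∉X ∷ avoids) = ∉-insert (e≢x ∘ sym) x∉X ∷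
      avoids-insert distinct avoids

  process-valid : ∀ {es S} → Unique es → Avoids (edges S) es → Valid S → Surely Valid (process es S)
  process-valid {[]} [] [] valid = valid
  process-valid {e ∷ es} {S} (distinct ∷ unique) (e∉S ∷ avoids) valid with weight S e ≤? α * price
      S e
  ... | yes _    = process-valid unique avoids valid
  ... | no heavy = Surely-branch coin
    (process-valid unique (avoids-insert distinct avoids) (admissible e∉S heavy ∷ valid))
    (process-valid unique avoids valid)

  -- D collects the edges for which the coin was tossed.  As long as S ⊆ D, the
  -- expected change of f (S ∪ O) is by submodularity at least p times the
  -- change of f (D ∪ O).
  𝔼-lower : NonNegative → ∀ O {es S} D → Unique es → Avoids D es → edges S ⊆ D →
            f (edges S ∪ O) - p * f (D ∪ O) ≤ 𝔼 (λ S → f (edges S ∪ O)) (process es S)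
  𝔼-lower nonneg O {[]} {S} D [] [] S⊆D = ≤-by (*-nonneg (coin-nonneg coin) (nonneg (D ∪ O)))
    (solve 2 (λ x y → x := x :- y :+ y) refl (f (edges S ∪ O)) (p * f (D ∪ O)))
  𝔼-lower nonneg O {e ∷ es} {S} D (distinct ∷ unique) (e∉D ∷ avoids) S⊆D with weight S e ≤? α *
      price S e
  ... | yes _ = 𝔼-lower nonneg O D unique avoids S⊆D
  ... | no _  = subst (f (edges S ∪ O) - p * f (D ∪ O) ≤_)
      (sym (𝔼-branch coin _ (process es S⁺) (process es S)))
    (≤-trans
      (≤-by (*-nonneg (coin-nonneg coin) (x≤y⇒0≤y-x slope))
        (solve 5 (λ p s s⁺ d d⁺ →
            p :* (s⁺ :- p :* d⁺) :+ (:1 :- p) :* (s :- p :* d⁺) :=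
            s :- p :* d :+ p :* (s⁺ :- s :- (d⁺ :- d)))
          refl p (f (edges S ∪ O)) (f (edges S⁺ ∪ O)) (f (D ∪ O)) (f (D⁺ ∪ O))))
      (mix (coin-nonneg coin) (coin-≤1 coin)
        (𝔼-lower nonneg O D⁺ unique (avoids-insert distinct avoids)
            (insert-⊆ (∈-insert D e) (q⊆p∪q ⁅ e ⁆ D ∘ S⊆D)))
        (𝔼-lower nonneg O D⁺ unique (avoids-insert distinct avoids) (q⊆p∪q ⁅ e ⁆ D ∘ S⊆D))))
    where
    S⁺ = newEntry S e ∷ S
    D⁺ = ⁅ e ⁆ ∪ D
    expand : ∀ X → f ((⁅ e ⁆ ∪ X) ∪ O) - f (X ∪ O) ≡ marginal e (X ∪ O)
    expand X = cong (λ Y → f Y - f (X ∪ O)) (trans (∪-assoc ⁅ e ⁆ X O) (∪-comm ⁅ e ⁆ (X ∪ O)))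
    stays : ∀ X → e ∈ O → f ((⁅ e ⁆ ∪ X) ∪ O) - f (X ∪ O) ≡ 0#
    stays X e∈O = trans (cong (λ Y → f Y - f (X ∪ O))
      (trans (∪-assoc ⁅ e ⁆ X O) (insert-absorb (q⊆p∪q X O e∈O)))) (-‿inverseʳ _)
    slope : f (D⁺ ∪ O) - f (D ∪ O) ≤ f (edges S⁺ ∪ O) - f (edges S ∪ O)
    slope with e ∈? O
    ... | yes e∈O = ≤-reflexive (trans (stays D e∈O) (sym (stays (edges S) e∈O)))
    ... | no  e∉O = subst₂ _≤_ (sym (expand D)) (sym (expand (edges S)))
      (submodular (edges S ∪ O) (D ∪ O) e (∪-monoˡ O S⊆D)
        ([ e∉D , e∉O ]′ ∘ x∈p∪q⁻ D O))

  levels : State → ∀ v → Fin (b v) → ℝ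
  levels S v q = level S (v , toℕ q)

  levels-tail : ∀ S x (i : Fin (b (tail (edgeOf x)))) → tailIndex x ≡ toℕ i → ∀ q →
                levels (x ∷ S) (tail (edgeOf x)) q
                    ≡ levels S (tail (edgeOf x)) q + spike i (gain S x) q
  levels-tail S x i idx q with q ≟ i
  ... | yes refl = trans (subst (λ k →
      level (x ∷ S) (tail (edgeOf x) , k) ≡ level S (tail (edgeOf x) , k) + gain S x)
                            idx (level-tail S x))
                     (cong (levels S (tail (edgeOf x)) q +_) (sym (spike-at q _)))
  ... | no  q≢i = trans
    (level-off {S} {x} (λ eq → q≢i (toℕ-injective (trans (cong proj₂ eq) idx)))
                       (λ eq → Multigraph.loopless G (edgeOf x) (cong proj₁ eq)))
    (trans (sym (+-identityʳ _)) (cong (levels S (tail (edgeOf x)) q +_) (sym (spike-off q≢i _))))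

  levels-head : ∀ {S x} → Admissible S x → (i : Fin (b (head (edgeOf x)))) → headIndex x ≡ toℕ i →
      ∀ q →
                levels (x ∷ S) (head (edgeOf x)) q
                    ≡ levels S (head (edgeOf x)) q + spike i (gain S x) q
  levels-head {S} {x} adm i idx q with q ≟ i
  ... | yes refl = trans (subst (λ k →
      level (x ∷ S) (head (edgeOf x) , k) ≡ level S (head (edgeOf x) , k) + gain S x)
                            idx (level-head adm))
                     (cong (levels S (head (edgeOf x)) q +_) (sym (spike-at q _)))
  ... | no  q≢i = trans
    (level-off {S} {x} (λ eq → Multigraph.loopless G (edgeOf x) (sym (cong proj₁ eq)))
                       (λ eq → q≢i (toℕ-injective (trans (cong proj₂ eq) idx))))
    (trans (sym (+-identityʳ _)) (cong (levels S (head (edgeOf x)) q +_) (sym (spike-off q≢i _))))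

  levels-off : ∀ S x {v} → v ≢ tail (edgeOf x) → v ≢ head (edgeOf x) → ∀ q →
               levels (x ∷ S) v q ≡ levels S v q
  levels-off S x v≢t v≢h q = level-off {S} {x} (v≢t ∘ cong proj₁) (v≢h ∘ cong proj₁)

  collapse : ∀ {x y z : ℝ} → y ≡ 0# → z ≡ 0# → x ≡ x + (y + z)
  collapse {x} refl refl = solve 1 (λ x → x := x :+ (num 0 :+ num 0)) refl x

  -- Each entry raises one slot at each of two distinct vertices by its gain.
  sum-levels : ∀ {S} → Valid S → sum (λ v → sum (levels S v)) ≡ totalGain S + totalGain S
  sum-levels [] = trans (trans (sum-cong-≗ λ v → sum-ε (b v)) (sum-ε (#V G))) (sym (+-identityʳ 0#))
  sum-levels {x ∷ S} (adm ∷ valid) = begin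
    sum (λ v → sum (levels (x ∷ S) v))
      ≡⟨ sum-cong-≗ pointwise ⟩
    sum (λ v → sum (levels S v) + (spike u g v + spike u′ g v))
      ≡⟨ ∑-distrib-+ (λ v → sum (levels S v)) _ ⟩
    sum (λ v → sum (levels S v)) + sum (λ v → spike u g v + spike u′ g v)
      ≡⟨ cong₂ _+_ (sum-levels valid)
          (trans (∑-distrib-+ (spike u g) (spike u′ g))
          (cong₂ _+_ (sum-spike u g) (sum-spike u′ g))) ⟩
    totalGain S + totalGain S + (g + g)
      ≡⟨ solve 2 (λ t g → t :+ t :+ (g :+ g) := g :+ t :+ (g :+ t)) refl (totalGain S) g ⟩
    g + totalGain S + (g + totalGain S) ∎
    where
    open ≡-Reasoning
    g = gain S x
    u = tail (edgeOf x)
    u′ = head (edgeOf x)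
    pointwise : ∀ v → sum (levels (x ∷ S) v) ≡ sum (levels S v) + (spike u g v + spike u′ g v)
    pointwise v with vertexCases v (edgeOf x)
    ... | inj₁ refl = trans
      (sum-+spike {i = fromℕ< (tailRange adm)}
          (levels-tail S x (fromℕ< (tailRange adm)) (sym (toℕ-fromℕ< (tailRange adm)))))
      (cong (sum (levels S u) +_) (trans (sym (+-identityʳ g))
        (sym (cong₂ _+_ (spike-at u g) (spike-off (tail≢head (edgeOf x)) g)))))
    ... | inj₂ (inj₁ refl) = trans
      (sum-+spike {i = fromℕ< (headRange adm)}
          (levels-head adm (fromℕ< (headRange adm)) (sym (toℕ-fromℕ< (headRange adm)))))
      (cong (sum (levels S u′) +_) (trans (sym (+-identityˡ g))
        (sym (cong₂ _+_ (spike-off (tail≢head (edgeOf x) ∘ sym) g) (spike-at u′ g)))))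
    ... | inj₂ (inj₂ (v≢t , v≢h)) = trans (sum-cong-≗ (levels-off S x v≢t v≢h))
      (collapse (spike-off v≢t g) (spike-off v≢h g))

-- Upper bound for the expected value of f (S ∪ O) by charging optimal edges

module UpperBound (𝓡 : RealNumbers) {μ : Streaming.Mode 𝓡} (params : Parameters 𝓡 μ)
                  (G : Multigraph) (b : Fin (#V G) → ℕ) (1≤b : ∀ v → 1 ℕ.≤ b v)
                  (f : Subset (#E G) → RealNumbers.ℝ 𝓡)
                  (submodular : SetFunctions.Submodular 𝓡 f) where
  open RealNumbers 𝓡
  open OrderedField 𝓡
  open RealSums 𝓡
  open SetFunctions 𝓡 f
  open Streaming 𝓡
  open Parameters params
  open Coins 𝓡
  open Degrees G
  open States 𝓡 G
  open ValidStates 𝓡 G b f submodular a 0≤a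
  open Process 𝓡 params G b 1≤b f
  open Expectation 𝓡 params G b 1≤b f submodular
  open Multigraph G using (incident)
  open ℕSums using () renaming (spike to spikeℕ; spike-at to spikeℕ-at; spike-off to spikeℕ-off)

  bestIndex-least : ∀ S v q → levels S v (bestIndex S v) ≤ levels S v q
  bestIndex-least S v q = least-≤ (levels S v) (first (1≤b v)) (∈-allFin q)

  -- T is the set of optimal edges seen so far.  The share β v of the vertex v
  -- in the charges for T is bounded by the largest levels at v, one for each
  -- edge of T at v, and r bounds the loss caused by the rejected edges of T.
  record Charged (S : State) (T : Subset (#E G)) (β : Fin (#V G) → ℝ) (r : ℝ) : Set where
    field
      valid     : Valid S
      dominated : ∀ v → Dominated (β v) (degree T v) (levels S v)
      covered   : ∀ Z → edges S ⊆ Z → f (Z ∪ T) ≤ f Z + r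

  open Charged

  -- An optimal edge adds to the share of each end the lowest level there plus `g`, where `g` is the
  -- surplus on acceptance and zero on rejection.
  raised : (Fin (#V G) → ℝ) → State → Fin (#E G) → ℝ → Fin (#V G) → ℝ
  raised β S e g v = β v + (spike (tail e) (price₁ S e + g) v + spike (head e) (price₂ S e + g) v)

  sum-raised : ∀ β S e g → sum (raised β S e g) ≡ sum β + (price S e + (g + g))
  sum-raised β S e g = trans (∑-distrib-+ β _) (cong (sum β +_)
    (trans (∑-distrib-+ (spike (tail e) (price₁ S e + g)) (spike (head e) (price₂ S e + g)))
      (trans (cong₂ _+_ (sum-spike (tail e) _) (sum-spike (head e) _))
        (solve 3 (λ s t g → s :+ g :+ (t :+ g) := s :+ t :+ (g :+ g)) refl (price₁ S e)
            (price₂ S e) g))))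

  -- Acceptance and rejection are treated at once: `ψ` gives the levels after the decision.
  dominated-charge : ∀ {S e T β g} (ψ : ∀ v → Fin (b v) → ℝ) → 0# ≤ g → e ∉ T →
    (∀ v → degree (⁅ e ⁆ ∪ T) v ℕ.≤ b v) →
    (∀ q → ψ (tail e) q ≡ levels S (tail e) q + spike (bestIndex S (tail e)) g q) →
    (∀ q → ψ (head e) q ≡ levels S (head e) q + spike (bestIndex S (head e)) g q) →
    (∀ {v} → v ≢ tail e → v ≢ head e → ∀ q → ψ v q ≡ levels S v q) →
    (∀ v → Dominated (β v) (degree T v) (levels S v)) →
    ∀ v → Dominated (raised β S e g v) (degree (⁅ e ⁆ ∪ T) v) (ψ v)
  dominated-charge {S} {e} {T} {β} {g} ψ 0≤g e∉T bounded ψ-tail ψ-head ψ-off dom v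
    with vertexCases v e
  ... | inj₁ refl = subst₂ (λ y t → Dominated y t (ψ v))
      (cong (β v +_) (trans (sym (+-identityʳ _))
          (sym (cong₂ _+_ (spike-at v _) (spike-off (tail≢head e) _)))))
      (sym one-more)
      (dominated-raise {i = bestIndex S v} (subst (ℕ._≤ b v) one-more (bounded v)) 0≤g
          (bestIndex-least S v) ψ-tail (dom v))
    where
    one-more : degree (⁅ e ⁆ ∪ T) v ≡ suc (degree T v)
    one-more = trans (degree-insert v e∉T)
        (cong₂ (λ x y → x ℕ.+ y ℕ.+ degree T v) (spikeℕ-at v 1) (spikeℕ-off (tail≢head e) 1))
  ... | inj₂ (inj₁ refl) = subst₂ (λ y t → Dominated y t (ψ v))
      (cong (β v +_) (trans (sym (+-identityˡ _))
          (sym (cong₂ _+_ (spike-off (tail≢head e ∘ sym) _) (spike-at v _)))))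
      (sym one-more)
      (dominated-raise {i = bestIndex S v} (subst (ℕ._≤ b v) one-more (bounded v)) 0≤g
          (bestIndex-least S v) ψ-head (dom v))
    where
    one-more : degree (⁅ e ⁆ ∪ T) v ≡ suc (degree T v)
    one-more = trans (degree-insert v e∉T)
        (cong₂ (λ x y → x ℕ.+ y ℕ.+ degree T v) (spikeℕ-off (tail≢head e ∘ sym) 1) (spikeℕ-at v 1))
  ... | inj₂ (inj₂ (v≢t , v≢h)) = subst₂ (λ y t → Dominated y t (ψ v))
      (collapse (spike-off v≢t _) (spike-off v≢h _)) (sym none-more)
      (dominated-mono {t = degree T v} {levels S v} {ψ v}
          (λ q → ≤-reflexive (sym (ψ-off v≢t v≢h q))) (dom v))
    where
    none-more : degree (⁅ e ⁆ ∪ T) v ≡ degree T v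
    none-more = trans (degree-insert v e∉T)
        (cong₂ (λ x y → x ℕ.+ y ℕ.+ degree T v) (spikeℕ-off v≢t 1) (spikeℕ-off v≢h 1))

  price-nonneg : ∀ {S} → Valid S → ∀ e → 0# ≤ price S e
  price-nonneg valid e = level-nonneg valid _ +⁺ level-nonneg valid _

  module _ {S : State} {T : Subset (#E G)} {β : Fin (#V G) → ℝ} {r : ℝ} (charged : Charged S T β r) where

    charged-push-other : ∀ {x} → Admissible S x → Charged (x ∷ S) T β r
    charged-push-other {x} adm = record
      { valid = adm ∷ valid charged
      ; dominated = λ v → dominated-mono {t = degree T v} {levels S v} {levels (x ∷ S) v}
          (λ q → level-mono adm (valid charged) (v , toℕ q)) (dominated charged v)
      ; covered = λ Z S⁺⊆Z → covered charged Z (S⁺⊆Z ∘ q⊆p∪q ⁅ edgeOf x ⁆ (edges S))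
      }

    module _ {e : Fin (#E G)} (e∉S : e ∉ edges S) (e∉T : e ∉ T)
             (bounded : ∀ v → degree (⁅ e ⁆ ∪ T) v ℕ.≤ b v) where

      -- `covered` ranges over all supersets of the current edges because the edges still to be
      -- accepted are unknown; by submodularity `e` adds to any of them at most its present weight,
      -- unless it already belongs to the union.
      charged-reject : ∀ {c} → 0# ≤ c → weight S e ≤ c →
          Charged S (⁅ e ⁆ ∪ T) (raised β S e 0#) (r + c)
      charged-reject {c} 0≤c w≤c = record
        { valid = valid charged
        ; dominated = dominated-charge {S} (levels S) ≤-refl e∉T bounded
            (λ q → unraised (tail e) q) (λ q → unraised (head e) q) (λ _ _ _ → refl)
                (dominated charged)
        ; covered = cover
        }
        where
        unraised : ∀ v q → levels S v q ≡ levels S v q + spike (bestIndex S v) 0# q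
        unraised v q = trans (sym (+-identityʳ _))
            (cong (levels S v q +_) (sym (spike-zero (bestIndex S v) q)))
          where
          spike-zero : ∀ {n} (i j : Fin n) → spike i 0# j ≡ 0#
          spike-zero i j with j ≟ i
          ... | yes refl = spike-at i 0#
          ... | no  j≢i  = spike-off j≢i 0#
        swap : ∀ Z → Z ∪ (⁅ e ⁆ ∪ T) ≡ ⁅ e ⁆ ∪ (Z ∪ T)
        swap Z = trans (sym (∪-assoc Z ⁅ e ⁆ T))
            (trans (cong (_∪ T) (∪-comm Z ⁅ e ⁆)) (∪-assoc ⁅ e ⁆ Z T))
        cover : ∀ Z → edges S ⊆ Z → f (Z ∪ (⁅ e ⁆ ∪ T)) ≤ f Z + (r + c)
        cover Z S⊆Z with e ∈? (Z ∪ T)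
        ... | yes e∈ = ≤-trans (≤-reflexive (cong f (trans (swap Z) (insert-absorb e∈))))
          (≤-by (x≤y⇒0≤y-x (covered charged Z S⊆Z) +⁺ 0≤c)
            (solve 4 (λ y z r c → z :+ (r :+ c) := y :+ (z :+ r :- y :+ c)) refl (f (Z ∪ T)) (f Z)
                r c))
        ... | no e∉ = ≤-trans (≤-reflexive (trans (cong f (swap Z)) (f-insert (Z ∪ T) e)))
          (≤-by (x≤y⇒0≤y-x (covered charged Z S⊆Z) +⁺ x≤y⇒0≤y-x marginal≤c)
            (solve 5 (λ y z r c m → z :+ (r :+ c) := y :+ m :+ ((z :+ r :- y) :+ (c :- m)))
              refl (f (Z ∪ T)) (f Z) r c (marginal e (Z ∪ T))))
          where
          marginal≤c : marginal e (Z ∪ T) ≤ c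
          marginal≤c = ≤-trans (submodular (edges S) (Z ∪ T) e (p⊆p∪q T ∘ S⊆Z) e∉)
            (subst (_≤ c) (weight≡marginal S e) w≤c)

      -- An accepted optimal edge lies in every later `Z`, so `r` stays as it is, while the shares
      -- grow by the new levels of its two slots.
      charged-push : ¬ weight S e ≤ α * price S e →
                     Charged (newEntry S e ∷ S) (⁅ e ⁆ ∪ T) (raised β S e (surplus S e)) r
      charged-push heavy = record
        { valid = adm ∷ valid charged
        ; dominated = dominated-charge {S} (levels (newEntry S e ∷ S))
            (subst (0# ≤_) (gain≡surplus S e) (gain-nonneg adm (valid charged))) e∉T bounded
            (subst (λ g → ∀ q → levels (newEntry S e ∷ S) (tail e) q
                ≡ levels S (tail e) q + spike (bestIndex S (tail e)) g q)
              (gain≡surplus S e) (levels-tail S (newEntry S e) (bestIndex S (tail e)) refl))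
            (subst (λ g → ∀ q → levels (newEntry S e ∷ S) (head e) q
                ≡ levels S (head e) q + spike (bestIndex S (head e)) g q)
              (gain≡surplus S e) (levels-head adm (bestIndex S (head e)) refl))
            (levels-off S (newEntry S e)) (dominated charged)
        ; covered = λ Z S⁺⊆Z → ≤-trans
            (≤-reflexive (cong f (trans (sym (∪-assoc Z ⁅ e ⁆ T))
              (cong (_∪ T) (trans (∪-comm Z ⁅ e ⁆)
                  (insert-absorb (S⁺⊆Z (∈-insert (edges S) e))))))))
            (covered charged Z (S⁺⊆Z ∘ q⊆p∪q ⁅ e ⁆ (edges S)))
        }
        where
        adm : Admissible S (newEntry S e)
        adm = admissible e∉S heavy

  -- The potential of the induction over the stream: losses minus the payments, `α` per unit of
  -- share. It starts at zero, and in the end all shares together are at most twice the total gain.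
  balance : ℝ → (Fin (#V G) → ℝ) → ℝ
  balance r β = r - α * sum β

  objective : State → ℝ
  objective S = f (edges S) + (α + α) * totalGain S

  0≤α : 0# ≤ α
  0≤α = 0≤1 +⁺ 0≤a

  𝔼-branch-≤ : ∀ {A : Set} {g h : A → ℝ} {k k₁ k₂} (accept reject : Rand μ A) →
    𝔼 g accept ≤ 𝔼 h accept + k₁ → 𝔼 g reject ≤ 𝔼 h reject + k₂ →
    p * k₁ + (1# - p) * k₂ ≤ k → 𝔼 g (branch coin accept reject)
        ≤ 𝔼 h (branch coin accept reject) + k
  𝔼-branch-≤ {g = g} {h} {k} {k₁} {k₂} accept reject accept-≤ reject-≤ k-≤ =
    subst₂ (λ x y → x ≤ y + k) (sym (𝔼-branch coin g accept reject))
        (sym (𝔼-branch coin h accept reject))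
      (≤-trans (mix (coin-nonneg coin) (coin-≤1 coin) accept-≤ reject-≤)
        (≤-by (x≤y⇒0≤y-x k-≤)
          (solve 6 (λ p x y k k₁ k₂ → p :* x :+ (:1 :- p) :* y :+ k :=
              p :* (x :+ k₁) :+ (:1 :- p) :* (y :+ k₂) :+ (k :- (p :* k₁ :+ (:1 :- p) :* k₂)))
            refl p (𝔼 h accept) (𝔼 h reject) k k₁ k₂)))

  bounded : ∀ {O T e} → IsBMatching G b O → e ∈ O → T ⊆ O → ∀ v → degree (⁅ e ⁆ ∪ T) v ℕ.≤ b v
  bounded {O} {T} {e} isB e∈O T⊆O v = ℕ.≤-trans (p⊆q⇒∣p∣≤∣q∣ restrict) (isB v)
    where
    restrict : (⁅ e ⁆ ∪ T) ∩ incident v ⊆ O ∩ incident v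
    restrict x∈ with x∈p∩q⁻ (⁅ e ⁆ ∪ T) (incident v) x∈
    ... | x∈T⁺ , x∈v = x∈p∩q⁺ (insert-⊆ e∈O T⊆O x∈T⁺ , x∈v)

  later : ∀ {O T : Subset (#E G)} {e es} → e ∉ O → (∀ {x} → x ∈ O → x ∈ T ⊎ x ∈ˡ e ∷ es) →
          ∀ {x} → x ∈ O → x ∈ T ⊎ x ∈ˡ es
  later e∉O O⊆ x∈O with O⊆ x∈O
  ... | inj₁ x∈T          = inj₁ x∈T
  ... | inj₂ (here refl)  = contradiction x∈O e∉O
  ... | inj₂ (there x∈es) = inj₂ x∈es

  seen : ∀ {O T : Subset (#E G)} {e es} → (∀ {x} → x ∈ O → x ∈ T ⊎ x ∈ˡ e ∷ es) →
         ∀ {x} → x ∈ O → x ∈ ⁅ e ⁆ ∪ T ⊎ x ∈ˡ es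
  seen {T = T} {e} O⊆ x∈O with O⊆ x∈O
  ... | inj₁ x∈T          = inj₁ (q⊆p∪q ⁅ e ⁆ T x∈T)
  ... | inj₂ (here refl)  = inj₁ (∈-insert T e)
  ... | inj₂ (there x∈es) = inj₂ x∈es

  -- The balance never increases in expectation, whatever the arriving edge.
  𝔼-upper : ∀ {O} → IsBMatching G b O → ∀ {es S T β r} → Unique es → Avoids (edges S) es →
    Avoids T es → T ⊆ O → (∀ {e} → e ∈ O → e ∈ T ⊎ e ∈ˡ es) → Charged S T β r →
    𝔼 (λ S → f (edges S ∪ O)) (process es S) ≤ 𝔼 objective (process es S) + balance r β
  𝔼-upper {O} isB {[]} {S} {T} {β} {r} [] [] [] T⊆O O⊆ charged = ≤-trans
    (≤-reflexive (cong (λ X → f (edges S ∪ X))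
        (⊆-antisym (λ e∈O → [ (λ e∈T → e∈T) , (λ ()) ]′ (O⊆ e∈O)) T⊆O)))
    (≤-by
      (x≤y⇒0≤y-x (covered charged (edges S) (λ x∈ → x∈)) +⁺ *-nonneg 0≤α (x≤y⇒0≤y-x β≤gain))
      (solve 6 (λ u y a t r s → y :+ (a :+ a) :* t :+ (r :- a :* s) :=
          u :+ ((y :+ r :- u) :+ a :* (t :+ t :- s)))
        refl (f (edges S ∪ T)) (f (edges S)) α (totalGain S) r (sum β)))
    where
    β≤gain : sum β ≤ totalGain S + totalGain S
    β≤gain = ≤-trans (sum-mono λ v →
        dominated-sum {t = degree T v} {levels S v}
        (λ q → level-nonneg (valid charged) (v , toℕ q)) (dominated charged v))
      (≤-reflexive (sum-levels (valid charged)))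
  𝔼-upper {O} isB {e ∷ es} {S} {T} {β} {r} (distinct ∷ unique) (e∉S ∷ avoidsS) (e∉T ∷ avoidsT) T⊆O
      O⊆ charged
    with weight S e ≤? α * price S e | e ∈? O
  ... | yes light | no e∉O = 𝔼-upper isB unique avoidsS avoidsT T⊆O (later e∉O O⊆) charged
  -- A loss of at most `α` times the price is offset exactly by charging the price to the two ends.
  ... | yes light | yes e∈O = ≤-trans
    (𝔼-upper isB unique avoidsS (avoids-insert distinct avoidsT) (insert-⊆ e∈O T⊆O) (seen O⊆)
      (charged-reject charged e∉S e∉T (bounded isB e∈O T⊆O)
          (*-nonneg 0≤α (price-nonneg (valid charged) e)) light))
    (≤-reflexive (cong (𝔼 objective (process es S) +_)
      (trans (cong (λ s → r + α * price S e - α * s) (sum-raised β S e 0#))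
        (solve 4 (λ r a l s → r :+ a :* l :- a :* (s :+ (l :+ (num 0 :+ num 0))) := r :- a :* s)
          refl r α (price S e) (sum β)))))
  ... | no heavy | no e∉O = 𝔼-branch-≤ (process es (newEntry S e ∷ S)) (process es S)
    (𝔼-upper isB unique (avoids-insert distinct avoidsS) avoidsT T⊆O (later e∉O O⊆)
      (charged-push-other charged (admissible e∉S heavy)))
    (𝔼-upper isB unique avoidsS avoidsT T⊆O (later e∉O O⊆) charged)
    (≤-reflexive (solve 2 (λ p k → p :* k :+ (:1 :- p) :* k := k) refl p (balance r β)))
  -- The expected balance drops by `(a + p)` times the price plus `α * (p + p) - (1 - p)` times the
  -- surplus; the latter factor is nonnegative by `pays`.
  ... | no heavy | yes e∈O = 𝔼-branch-≤ (process es (newEntry S e ∷ S)) (process es S)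
    (𝔼-upper isB unique (avoids-insert distinct avoidsS) (avoids-insert distinct avoidsT)
        (insert-⊆ e∈O T⊆O) (seen O⊆)
      (charged-push charged e∉S e∉T (bounded isB e∈O T⊆O) heavy))
    (𝔼-upper isB unique avoidsS (avoids-insert distinct avoidsT) (insert-⊆ e∈O T⊆O) (seen O⊆)
      (charged-reject charged e∉S e∉T (bounded isB e∈O T⊆O) 0≤w ≤-refl))
    (≤-trans (≤-reflexive (cong₂ (λ s s′ → p * (r - α * s) + (1# - p) * (r + weight S e - α * s′))
                (sum-raised β S e (surplus S e)) (sum-raised β S e 0#)))
      (≤-by
        (*-nonneg 0≤a 0≤P +⁺ *-nonneg (coin-nonneg coin) 0≤P +⁺ *-nonneg (x≤y⇒0≤y-x pays) 0≤surplus)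
        (solve 6 (λ p r a s l w →
            r :- (:1 :+ a) :* s :=
            p :* (r :- (:1 :+ a) :* (s :+ (l :+ (w :- l :+ (w :- l)))))
            :+ (:1 :- p) :* (r :+ w :- (:1 :+ a) :* (s :+ (l :+ (num 0 :+ num 0))))
            :+ (a :* l :+ p :* l :+ ((:1 :+ a) :* (p :+ p) :- (:1 :- p)) :* (w :- l)))
          refl p r a (sum β) (price S e) (weight S e))))
    where
    0≤P : 0# ≤ price S e
    0≤P = price-nonneg (valid charged) e
    0≤surplus : 0# ≤ surplus S e
    0≤surplus = subst (0# ≤_) (gain≡surplus S e)
        (gain-nonneg (admissible e∉S heavy) (valid charged))
    0≤w : 0# ≤ weight S e
    0≤w = ≤-trans (*-nonneg 0≤α 0≤P) (≰⇒≥ heavy)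

-- The approximation ratio on abstract states

module Value (𝓡 : RealNumbers) {μ : Streaming.Mode 𝓡} (params : Parameters 𝓡 μ)
             (G : Multigraph) (b : Fin (#V G) → ℕ) (1≤b : ∀ v → 1 ℕ.≤ b v)
             (f : Subset (#E G) → RealNumbers.ℝ 𝓡)
             (submodular : SetFunctions.Submodular 𝓡 f) (nonneg : SetFunctions.NonNegative 𝓡 f) where
  open RealNumbers 𝓡
  open OrderedField 𝓡
  open RealSums 𝓡
  open SetFunctions 𝓡 f
  open Streaming 𝓡
  open Parameters params
  open Coins 𝓡
  open Degrees G
  open States 𝓡 G
  open ValidStates 𝓡 G b f submodular a 0≤a
  open Process 𝓡 params G b 1≤b f
  open Expectation 𝓡 params G b 1≤b f submodular
  open UpperBound 𝓡 params G b 1≤b f submodular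
  open Multigraph G using (incident)

  κ : ℝ
  κ = 1# + ρ + (α + α)

  output : State → Subset (#E G)
  output S = edgesOf (matching S [])

  output-isBMatching : ∀ {S} → Valid S → IsBMatching G b (output S)
  output-isBMatching valid v = ℕ.≤-trans (ℕ.m≤m+n _ 0) (matching-degree valid {[]} [] [] v)

  -- As `κ` is at least 1 and `f ⊥` is nonnegative, `f ⊥` may be multiplied by `κ` along with the
  -- total gain. The summand `0#` fits `𝔼-affine`.
  objective≤ : ∀ S → Valid S → objective S ≤ κ * f (output S) + 0#
  objective≤ S valid = ≤-by
    (x≤y⇒0≤y-x (f-edges 0≤ρ aρ≡1 valid) +⁺ *-nonneg (0≤ρ +⁺ (0≤α +⁺ 0≤α)) (nonneg ⊥)
      +⁺ *-nonneg (0≤1 +⁺ 0≤ρ +⁺ (0≤α +⁺ 0≤α)) (x≤y⇒0≤y-x (matching-value valid [])))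
    (solve 6 (λ r a t y fs m →
        (:1 :+ r :+ (a :+ a)) :* m :+ num 0 :=
        fs :+ (a :+ a) :* t :+ ((y :+ (:1 :+ r) :* t :- fs) :+ (r :+ (a :+ a)) :* y
          :+ (:1 :+ r :+ (a :+ a)) :* (m :+ num 0 :- (y :+ t))))
      refl ρ α (totalGain S) (f ⊥) (f (edges S)) (f (output S)))

  avoids-⊥ : ∀ es → Avoids ⊥ es
  avoids-⊥ es = All.tabulate (λ _ → ∉⊥)

  value-bound : ∀ {O es} → IsBMatching G b O → Unique es → (∀ e → e ∈ˡ es) →
                𝔼 (λ S → f (edges S ∪ O)) (process es []) ≤ κ * 𝔼 (f ∘ output) (process es [])
  value-bound {O} {es} isB unique total = ≤-trans
    (𝔼-upper isB unique (avoids-⊥ es) (avoids-⊥ es) (λ x∈ → ⊥-elim (∉⊥ x∈)) (λ {e} _ → inj₂ (total e)) charged)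
    (≤-trans
      (+-mono (𝔼-mono (process es []) (process-valid unique (avoids-⊥ es) []) objective≤)
        (≤-reflexive (trans (cong (λ s → 0# - α * s) (sum-ε (#V G)))
          (solve 1 (λ a → num 0 :- a :* num 0 := num 0) refl α))))
      (≤-reflexive (trans (+-identityʳ _)
          (trans (𝔼-affine (f ∘ output) κ 0# (process es [])) (+-identityʳ _)))))
    where
    charged : Charged [] ⊥ (λ _ → 0#) 0#
    charged = record
      { valid = []
      ; dominated = λ v → subst (λ t → Dominated 0# t (levels [] v)) (sym (card-⊥∩ (incident v)))
                            (dominated-zero {φ = levels [] v})
      ; covered = λ Z _ → ≤-reflexive (trans (cong f (∪-identityʳ Z)) (sym (+-identityʳ (f Z))))
      }

  monotone-bound : Monotone → ∀ {O es} → IsBMatching G b O → Unique es → (∀ e → e ∈ˡ es) →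
                   f O ≤ κ * 𝔼 (f ∘ output) (process es [])
  monotone-bound monotone {O} {es} isB unique total = ≤-trans
    (≤-trans (≤-reflexive (sym (𝔼-const (f O) (process es []))))
      (𝔼-mono (process es []) (process-valid unique (avoids-⊥ es) []) λ S _ →
          monotone O (edges S ∪ O) (q⊆p∪q (edges S) O)))
    (value-bound isB unique total)

  general-bound : ∀ {O es} → IsBMatching G b O → Unique es → (∀ e → e ∈ˡ es) →
                  (1# - p) * f O ≤ κ * 𝔼 (f ∘ output) (process es [])
  general-bound {O} {es} isB unique total = ≤-trans
    (≤-trans
      (≤-reflexive (trans (solve 2 (λ p x → (:1 :- p) :* x := x :- p :* x) refl p (f O))
        (cong (λ X → f X - p * f X) (sym (∪-identityˡ O)))))
      (𝔼-lower nonneg O ⊥ unique (avoids-⊥ es) (λ x∈ → x∈)))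
    (value-bound isB unique total)

-- How often a slot is used

module Occupancy (𝓡 : RealNumbers) (G : Multigraph) where
  open Degrees G
  open States 𝓡 G

  hits : Slot (#V G) → Entry → ℕ
  hits s x = 𝟙 (⌊ s ≟ˢ tailSlot x ⌋ ∨ ⌊ s ≟ˢ headSlot x ⌋)

  occupancy : Slot (#V G) → State → ℕ
  occupancy s []      = 0
  occupancy s (x ∷ S) = hits s x ℕ.+ occupancy s S

  hits-tail : ∀ x → hits (tailSlot x) x ≡ 1
  hits-tail x with tailSlot x ≟ˢ tailSlot x
  ... | yes _ = refl
  ... | no ≢  = ⊥-elim (≢ refl)

  hits-head : ∀ x → hits (headSlot x) x ≡ 1
  hits-head x with headSlot x ≟ˢ tailSlot x | headSlot x ≟ˢ headSlot x
  ... | yes _ | _     = refl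
  ... | no _  | yes _ = refl
  ... | no _  | no ≢  = ⊥-elim (≢ refl)

  hits-cases : ∀ s x → ((s ≡ tailSlot x ⊎ s ≡ headSlot x) × hits s x ≡ 1) ⊎ hits s x ≡ 0
  hits-cases s x with s ≟ˢ tailSlot x | s ≟ˢ headSlot x
  ... | yes eq | _      = inj₁ (inj₁ eq , refl)
  ... | no  _  | yes eq = inj₁ (inj₂ eq , refl)
  ... | no  _  | no _   = inj₂ refl

  occupancy≤length : ∀ s S → occupancy s S ℕ.≤ length S
  occupancy≤length s []      = ℕ.z≤n
  occupancy≤length s (x ∷ S) = ℕ.+-mono-≤ (hits≤1 (hits-cases s x)) (occupancy≤length s S)
    where
    hits≤1 : ∀ {h} {P : Set} → (P × h ≡ 1) ⊎ h ≡ 0 → h ℕ.≤ 1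
    hits≤1 (inj₁ (_ , refl)) = ℕ.≤-refl
    hits≤1 (inj₂ refl)       = ℕ.z≤n

module Memory (𝓡 : RealNumbers) (G : Multigraph) (b : Fin (#V G) → ℕ)
              (f : Subset (#E G) → RealNumbers.ℝ 𝓡)
              (submodular : SetFunctions.Submodular 𝓡 f)
              (a : RealNumbers.ℝ 𝓡) (0≤a : RealNumbers._≤_ 𝓡 (RealNumbers.0# 𝓡) a)
              (growth : RealNumbers._≤_ 𝓡 (RealNumbers.1# 𝓡)
                 (RealNumbers._*_ 𝓡 (RealNumbers._+_ 𝓡 (RealNumbers.1# 𝓡) a) a))
              (W : RealNumbers.ℝ 𝓡) (maxW : SetFunctions.IsMaxMarginalQuotient 𝓡 f W) where
  open RealNumbers 𝓡
  open OrderedField 𝓡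
  open SetFunctions 𝓡 f
  open Degrees G
  open States 𝓡 G
  open ValidStates 𝓡 G b f submodular a 0≤a
  open Occupancy 𝓡 G
  open Multigraph G using (incident)

  private
    cancel-⁻¹ : ∀ {m y} → ¬ m ≤ 0# → m * (y / m) ≡ y
    cancel-⁻¹ {m} {y} m≰0 = begin
      m * (y * m ⁻¹)  ≡⟨ solve 3 (λ m y i → m :* (y :* i) := m :* i :* y) refl m y (m ⁻¹) ⟩
      m * m ⁻¹ * y    ≡⟨ cong (_* y) (⁻¹-inverseʳ m λ m≡0 → m≰0 (≤-reflexive m≡0)) ⟩
      1# * y          ≡⟨ *-identityˡ y ⟩
      y               ∎
      where open ≡-Reasoning

    ≰0⇒0< : ∀ {m} → ¬ m ≤ 0# → 0# < m
    ≰0⇒0< m≰0 = ≰⇒≥ m≰0 , λ 0≡m → m≰0 (≤-reflexive (sym 0≡m))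

  -- The quotient bound multiplied out. Where `W` is 1 by convention there is no positive marginal
  -- value, against the premise.
  quotient-bound : ∀ {X Y e e′} → X ⊆ Y → ¬ marginal e′ X ≤ 0# → marginal e Y ≤ marginal e′ X * W
  quotient-bound {X} {Y} {e} {e′} X⊆Y m≰0 = [ (λ (_ , upper) →
      subst (_≤ marginal e′ X * W) (cancel-⁻¹ m≰0)
        (*-monoʳ (≰⇒≥ m≰0) (upper _ (X , Y , e , e′ , X⊆Y , ≰0⇒0< m≰0 , refl))))
    , (λ (none , _) → ⊥-elim (none X e′ (≰0⇒0< m≰0))) ]′ maxW

  1≤W : 1# ≤ W
  1≤W = [ (λ ((X , _ , _ , e′ , _ , 0<m , _) , upper) →
      upper 1# (X , X , e′ , e′ , (λ x∈ → x∈) , 0<m , sym (⁻¹-inverseʳ _ (proj₂ 0<m ∘ sym))))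
    , (λ (_ , W≡1) → ≤-reflexive (sym W≡1)) ]′ maxW

  0≤W : 0# ≤ W
  0≤W = ≤-trans 0≤1 1≤W

  0≤α : 0# ≤ α
  0≤α = 0≤1 +⁺ 0≤a

  1≤α : 1# ≤ α
  1≤α = ≤-by 0≤a refl

  2≤α² : fromℕ 2 ≤ α * α
  2≤α² = ≤-by (x≤y⇒0≤y-x growth +⁺ 0≤a)
    (solve 1 (λ a → (:1 :+ a) :* (:1 :+ a) := num 2 :+ ((:1 :+ a) :* a :- :1 :+ a)) refl a)

  1≤α² : 1# ≤ α * α
  1≤α² = ≤-trans (≤-by 0≤1 (solve 0 (num 2 := :1 :+ :1) refl)) 2≤α²

  marginal-positive : ∀ {S x} → Admissible S x → Valid S → ¬ marginal (edgeOf x) (edges S) ≤ 0#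
  marginal-positive {S} {x} adm valid m≤0 =
      heavy adm (≤-trans m≤0 (*-nonneg 0≤α (load-nonneg valid x)))

  α*level≤marginal : ∀ {S x s} → Admissible S x → Valid S → level S s ≤ load S x →
                     α * level S s ≤ marginal (edgeOf x) (edges S)
  α*level≤marginal adm valid l≤ = ≤-trans (*-monoʳ 0≤α l≤) (≰⇒≥ (heavy adm))

  -- Gain plus load is at most `1 + 1 / a` times the gain, and `1 + 1 / a = α / a` is at most
  -- `α * α` by `growth`.
  marginal≤gain : ∀ {S x} → Admissible S x → Valid S →
      marginal (edgeOf x) (edges S) ≤ α * α * gain S x
  marginal≤gain {S} {x} adm valid = ≤-trans (≤-reflexive (weight≡ adm)) (≤-by
    (*-nonneg 0≤α (x≤y⇒0≤y-x (load≤gain adm valid))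
      +⁺ *-nonneg (x≤y⇒0≤y-x growth) (load-nonneg valid x +⁺ gain-nonneg adm valid))
    (solve 3 (λ a l g → (:1 :+ a) :* (:1 :+ a) :* g :=
        g :+ l :+ ((:1 :+ a) :* (g :- a :* l) :+ ((:1 :+ a) :* a :- :1) :* (l :+ g)))
      refl a (load S x) (gain S x)))

  level≤load : ∀ {S x s} → Valid S → s ≡ tailSlot x ⊎ s ≡ headSlot x → level S s ≤ load S x
  level≤load {S} {x} valid (inj₁ refl) = ≤-by (level-nonneg valid (headSlot x)) refl
  level≤load {S} {x} valid (inj₂ refl) =
      ≤-by (level-nonneg valid (tailSlot x)) (+-comm (level S (tailSlot x)) (level S (headSlot x)))

  level-raised : ∀ {S x s} → Admissible S x → s ≡ tailSlot x ⊎ s ≡ headSlot x →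
      level (x ∷ S) s ≡ level S s + gain S x
  level-raised {S} {x} adm (inj₁ refl) = level-tail S x
  level-raised         adm (inj₂ refl) = level-head adm

  -- The first use lifts the slot to at least the fraction `1 / (α * α * W)` of every later marginal
  -- value, and each further use multiplies its level by at least `α`, since the gain is at least
  -- `a` times the level.
  level-growth : ∀ {S s k} → Valid S → occupancy s S ≡ suc k → ∀ {Y e} → edges S ⊆ Y →
                 α ^ k * marginal e Y ≤ α * α * W * level S s
  level-growth {x ∷ S} {s} {k} (adm ∷ valid) occ {Y} {e} S⁺⊆Y with hits-cases s x | occupancy s S
      in eq
  ... | inj₂ h≡0 | o = ≤-trans
    (level-growth valid (trans (trans eq (cong (ℕ._+ o) (sym h≡0))) occ)
        (S⁺⊆Y ∘ q⊆p∪q ⁅ edgeOf x ⁆ (edges S)))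
    (*-monoʳ (*-nonneg (*-nonneg 0≤α 0≤α) 0≤W) (level-mono adm valid s))
  ... | inj₁ (touch , h≡1) | o with trans (cong (ℕ._+ o) (sym h≡1)) occ
  level-growth {x ∷ S} {s} (adm ∷ valid) occ {Y} {e} S⁺⊆Y | inj₁ (touch , h≡1) | zero | refl =
      ≤-trans
    (≤-reflexive (*-identityˡ (marginal e Y)))
    (≤-trans (quotient-bound {edges S} {Y} {e} {edgeOf x} (S⁺⊆Y ∘ q⊆p∪q ⁅ edgeOf x ⁆ (edges S))
        (marginal-positive adm valid))
    (≤-trans (*-monoˡ 0≤W (marginal≤gain adm valid))
    (≤-trans (≤-by (*-nonneg (*-nonneg (*-nonneg 0≤α 0≤α) 0≤W) (level-nonneg valid s))
        (solve 4 (λ α W l g → α :* α :* W :* (l :+ g) := α :* α :* g :* W :+ α :* α :* W :* l)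
          refl α W (level S s) (gain S x)))
      (≤-reflexive (cong (α * α * W *_) (sym (level-raised adm touch)))))))
  level-growth {x ∷ S} {s} (adm ∷ valid) occ {Y} {e} S⁺⊆Y | inj₁ (touch , h≡1) | suc k | refl =
      ≤-trans
    (≤-reflexive (solve 3 (λ α p m → α :* p :* m := α :* (p :* m)) refl α (α ^ k) (marginal e Y)))
    (≤-trans (*-monoʳ 0≤α (level-growth valid eq (S⁺⊆Y ∘ q⊆p∪q ⁅ edgeOf x ⁆ (edges S))))
    (≤-trans (≤-by
        (*-nonneg (*-nonneg (*-nonneg 0≤α 0≤α) 0≤W)
          (x≤y⇒0≤y-x (≤-trans (*-monoʳ 0≤a (level≤load {S} {x} valid touch))
              (load≤gain adm valid))))
        (solve 4 (λ a W l g → (:1 :+ a) :* (:1 :+ a) :* W :* (l :+ g) :=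
            (:1 :+ a) :* ((:1 :+ a) :* (:1 :+ a) :* W :* l) :+ (:1 :+ a) :* (:1 :+ a) :* W :*
                (g :- a :* l))
          refl a W (level S s) (gain S x)))
      (≤-reflexive (cong (α * α * W *_) (sym (level-raised adm touch))))))

  -- At its last use, the level found in the slot is at most `1 / α` of the marginal value of the
  -- accepted edge. Applied to this same edge, `level-growth` lets that marginal value cancel.
  occupancy-growth : ∀ {S s k} → Valid S → occupancy s S ≡ suc k → α ^ k ≤ α * α * W
  occupancy-growth {x ∷ S} {s} {k} (adm ∷ valid) occ with hits-cases s x | occupancy s S in eq
  ... | inj₂ h≡0 | o = occupancy-growth valid (trans (trans eq (cong (ℕ._+ o) (sym h≡0))) occ)
  ... | inj₁ (touch , h≡1) | o with trans (cong (ℕ._+ o) (sym h≡1)) occ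
  occupancy-growth {x ∷ S} {s} (adm ∷ valid) occ | inj₁ (touch , h≡1) | zero | refl =
    ≤-trans (≤-reflexive (sym (*-identityˡ 1#))) (*-mono (*-nonneg 0≤α 0≤α) 0≤1 1≤α² 1≤W)
  occupancy-growth {x ∷ S} {s} (adm ∷ valid) occ | inj₁ (touch , h≡1) | suc k | refl =
    *-cancelˡ (marginal-positive adm valid)
      (≤-trans (≤-reflexive (solve 3 (λ α p m → m :* (α :* p) := α :* (p :* m)) refl α (α ^ k) m))
      (≤-trans (*-monoʳ 0≤α (level-growth valid eq (λ x∈ → x∈)))
      (≤-trans (≤-reflexive (solve 3 (λ α W l → α :* (α :* α :* W :* l) := α :* α :* W :* (α :* l))
          refl α W (level S s)))
      (≤-trans (*-monoʳ (*-nonneg (*-nonneg 0≤α 0≤α) 0≤W)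
          (α*level≤marginal adm valid (level≤load {S} {x} valid touch)))
        (≤-reflexive (solve 3 (λ α W m → α :* α :* W :* m := m :* (α :* α :* W)) refl α W m))))))
    where
    m = marginal (edgeOf x) (edges S)

  half : ℕ → ℕ
  half (suc (suc n)) = suc (half n)
  half _             = 0

  2^half≤α^ : ∀ n → fromℕ 2 ^ half n ≤ α ^ n
  2^half≤α^ zero          = ≤-refl
  2^half≤α^ (suc zero)    = ≤-trans 1≤α (≤-reflexive (solve 1 (λ x → x := x :* :1) refl α))
  2^half≤α^ (suc (suc n)) = ≤-trans
    (*-mono (*-nonneg 0≤α 0≤α) (^-nonneg (half n) (0≤fromℕ 2)) 2≤α² (2^half≤α^ n))
    (≤-reflexive (solve 2 (λ x y → x :* x :* y := x :* (x :* y)) refl α (α ^ n)))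

  ≤1+2half : ∀ n → fromℕ n ≤ 1# + (fromℕ (half n) + fromℕ (half n))
  ≤1+2half zero          = 0≤1 +⁺ (≤-refl +⁺ ≤-refl)
  ≤1+2half (suc zero)    = ≤-reflexive (cong (1# +_) (sym (+-identityʳ 0#)))
  ≤1+2half (suc (suc n)) = ≤-trans (+-mono ≤-refl (+-mono ≤-refl (≤1+2half n)))
    (≤-reflexive (solve 1 (λ h → :1 :+ (:1 :+ (:1 :+ (h :+ h))) := :1 :+ (:1 :+ h :+ (:1 :+ h)))
        refl (fromℕ (half n))))

  module _ (L : ℝ) (isLog : IsLog₂ W L) where

    ≤log : ∀ j → fromℕ 2 ^ j ≤ W → fromℕ j ≤ L
    ≤log j 2^j≤W = ≤-trans (≤-reflexive (sym over-1))
      -- The exponent is the fraction `j / 1`, whose denominator is encoded as `suc 0`.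
      (proj₁ isLog _ (j , 0 , refl , ≤-trans 2^j≤W
          (≤-reflexive (solve 1 (λ w → w := w :* :1) refl W))))
      where
      one : fromℕ 1 * fromℕ 1 ⁻¹ ≡ 1#
      one = ⁻¹-inverseʳ (fromℕ 1) λ 1+0≡0 → 0≢1 (sym (trans (sym (+-identityʳ 1#)) 1+0≡0))
      over-1 : fromℕ j / fromℕ 1 ≡ fromℕ j
      over-1 = trans (solve 2 (λ j i → j :* i := j :* ((:1 :+ num 0) :* i)) refl (fromℕ j)
          (fromℕ 1 ⁻¹))
        (trans (cong (fromℕ j *_) one) (solve 1 (λ j → j :* :1 := j) refl (fromℕ j)))

    0≤L : 0# ≤ L
    0≤L = ≤log 0 1≤W

    capacity : ℝ
    capacity = L + L + fromℕ 4

    occupancy≤capacity : ∀ {S} → Valid S → ∀ s → fromℕ (occupancy s S) ≤ capacity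
    occupancy≤capacity {S} valid s with occupancy s S in eq
    ... | zero        = 0≤L +⁺ 0≤L +⁺ 0≤fromℕ 4
    ... | suc zero    = ≤-by (0≤L +⁺ 0≤L +⁺ 0≤fromℕ 3)
        (solve 1 (λ l → l :+ l :+ num 4 := :1 :+ num 0 :+ (l :+ l :+ num 3)) refl L)
    ... | suc (suc zero) = ≤-by (0≤L +⁺ 0≤L +⁺ 0≤fromℕ 2)
        (solve 1 (λ l → l :+ l :+ num 4 := num 2 :+ (l :+ l :+ num 2)) refl L)
    -- One use does not count in the exponent and two more cancel against `α * α`, leaving
    -- `α ^ k ≤ W`. As two factors `α` make at least 2, `k` is at most `1 + 2 L`, the 1 being lost
    -- to parity; hence the 4 in `capacity`.
    ... | suc (suc (suc k)) = ≤-by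
      (x≤y⇒0≤y-x (≤1+2half k) +⁺ x≤y⇒0≤y-x h≤L +⁺ x≤y⇒0≤y-x h≤L)
      (solve 3 (λ l h k → l :+ l :+ num 4 := :1 :+ (:1 :+ (:1 :+ k)) :+
          (:1 :+ (h :+ h) :- k :+ (l :- h) :+ (l :- h))) refl L (fromℕ (half k)) (fromℕ k))
      where
      α²≰0 : ¬ α * α ≤ 0#
      α²≰0 α²≤0 = 1≰0 (≤-trans 1≤α² α²≤0)
      h≤L : fromℕ (half k) ≤ L
      h≤L = ≤log (half k) (≤-trans (2^half≤α^ k) (*-cancelˡ α²≰0
        (≤-trans (≤-reflexive (solve 2 (λ x y → x :* x :* y := x :* (x :* y)) refl α (α ^ k)))
          (occupancy-growth valid eq))))

-- The number of stored entries against a maximum b-matching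

module Extension (G : Multigraph) (b : Fin (#V G) → ℕ) where
  open Degrees G
  open Multigraph G using (incident; IsMaximumBMatching)
  open ℕSums

  extend : ∀ {M e} → IsBMatching G b M → e ∉ M → degree M (tail e) ℕ.< b (tail e) →
           degree M (head e) ℕ.< b (head e) → IsBMatching G b (⁅ e ⁆ ∪ M)
  extend {M} {e} isB e∉M t< h< v =
      ℕ.≤-trans (ℕ.≤-reflexive (degree-insert v e∉M)) (bound (vertexCases v e))
    where
    bound : v ≡ tail e ⊎ v ≡ head e ⊎ (v ≢ tail e × v ≢ head e) →
            spike (tail e) 1 v ℕ.+ spike (head e) 1 v ℕ.+ degree M v ℕ.≤ b v
    bound (inj₁ refl) rewrite spike-at v 1 | spike-off (tail≢head e) 1 = t<
    bound (inj₂ (inj₁ refl)) rewrite spike-off (tail≢head e ∘ sym) 1 | spike-at v 1 = h<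
    bound (inj₂ (inj₂ (v≢t , v≢h))) rewrite spike-off v≢t 1 | spike-off v≢h 1 = isB v

  maximum-saturates : ∀ {M e} → IsMaximumBMatching b M → e ∉ M →
                      b (tail e) ℕ.≤ degree M (tail e) ⊎ b (head e) ℕ.≤ degree M (head e)
  maximum-saturates {M} {e} (isB , maximum) e∉M
    with b (tail e) ℕ.≤? degree M (tail e) | b (head e) ℕ.≤? degree M (head e)
  ... | yes b≤ | _      = inj₁ b≤
  ... | no  _  | yes b≤ = inj₂ b≤
  ... | no b≰t | no b≰h = contradiction
    (subst (ℕ._≤ ∣ M ∣) (card-∪ M e∉M)
        (maximum (⁅ e ⁆ ∪ M) (extend {M} {e} isB e∉M (ℕ.≰⇒> b≰t) (ℕ.≰⇒> b≰h)))) ℕ.1+n≰n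

  maximum-nonempty : (∀ v → 1 ℕ.≤ b v) → ∀ {M} → IsMaximumBMatching b M → Fin (#E G) → 1 ℕ.≤ ∣ M ∣
  maximum-nonempty 1≤b {M} (_ , maximum) e =
      subst (ℕ._≤ ∣ M ∣) (trans (card-∪ ⊥ {e} ∉⊥) (cong suc (∣⊥∣≡0 (#E G))))
    (maximum (⁅ e ⁆ ∪ ⊥) (extend {⊥} {e}
        (λ v → ℕ.≤-trans (ℕ.≤-reflexive (card-⊥∩ (incident v))) ℕ.z≤n) ∉⊥ (free (tail e))
        (free (head e))))
    where
    free : ∀ v → degree ⊥ v ℕ.< b v
    free v = subst (ℕ._< b v) (sym (card-⊥∩ (incident v))) (1≤b v)

module Size (𝓡 : RealNumbers) (G : Multigraph) (b : Fin (#V G) → ℕ)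
            (f : Subset (#E G) → RealNumbers.ℝ 𝓡)
            (submodular : SetFunctions.Submodular 𝓡 f)
            (a : RealNumbers.ℝ 𝓡) (0≤a : RealNumbers._≤_ 𝓡 (RealNumbers.0# 𝓡) a) where
  open Degrees G
  open States 𝓡 G
  open ValidStates 𝓡 G b f submodular a 0≤a
  open Occupancy 𝓡 G
  open Extension G b
  open Multigraph G using (incident; IsMaximumBMatching)
  open ℕSums

  module _ {M : Subset (#E G)} (isMax : IsMaximumBMatching b M) where

    slotsUsed : State → Fin (#V G) → ℕ
    slotsUsed S v = sum {b v} (λ q → occupancy (v , toℕ q) S)

    -- Only at vertices saturated by `M` is the number of slots bounded by a degree in `M`, and
    -- these degrees add up to twice the size of `M`.
    saturatedUsed : State → Fin (#V G) → ℕ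
    saturatedUsed S v = if ⌊ b v ℕ.≤? degree M v ⌋ then slotsUsed S v else 0

    saturatedUsed-mono : ∀ x S v → saturatedUsed S v ℕ.≤ saturatedUsed (x ∷ S) v
    saturatedUsed-mono x S v with b v ℕ.≤? degree M v
    ... | yes _ = sum-mono {b v} (λ q → ℕ.m≤n+m (occupancy (v , toℕ q) S) (hits (v , toℕ q) x))
    ... | no  _ = ℕ.z≤n

    saturatedUsed-< : ∀ x S v k → k ℕ.< b v → hits (v , k) x ≡ 1 → b v ℕ.≤ degree M v →
                      saturatedUsed S v ℕ.< saturatedUsed (x ∷ S) v
    saturatedUsed-< x S v k k<b hit b≤ with b v ℕ.≤? degree M v
    ... | yes _  = sum-mono-< {b v} (λ q → ℕ.m≤n+m (occupancy (v , toℕ q) S) (hits (v , toℕ q) x))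
        {fromℕ< k<b}
      (ℕ.≤-reflexive (cong (ℕ._+ occupancy (v , toℕ (fromℕ< k<b)) S)
        (sym (trans (cong (λ j → hits (v , j) x) (toℕ-fromℕ< k<b)) hit))))
    ... | no b≰ = contradiction b≤ b≰

    -- Every edge outside M has a saturated end, and hence takes a slot there.
    length≤ : ∀ {S} → Valid S → length S ℕ.≤ ∣ edges S ∩ M ∣ ℕ.+ sum (saturatedUsed S)
    length≤ [] = ℕ.z≤n
    length≤ {x ∷ S} (adm ∷ valid) with edgeOf x ∈? M
    ... | yes e∈M = ℕ.≤-trans (ℕ.s≤s (length≤ valid)) (ℕ.+-mono-≤
      (ℕ.≤-reflexive (sym (trans (card-insert (edges S) M (fresh adm))
        (cong (λ c → 𝟙 c ℕ.+ ∣ edges S ∩ M ∣) ([]=⇒lookup e∈M)))))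
      (sum-mono (saturatedUsed-mono x S)))
    ... | no e∉M = ℕ.≤-trans (ℕ.s≤s (length≤ valid)) (ℕ.≤-trans (ℕ.≤-reflexive (sym (ℕ.+-suc _ _)))
      (ℕ.+-mono-≤ (p⊆q⇒∣p∣≤∣q∣ widen) ([ at-tail , at-head ]′ (maximum-saturates isMax e∉M))))
      where
      widen : edges S ∩ M ⊆ edges (x ∷ S) ∩ M
      widen y∈ with x∈p∩q⁻ (edges S) M y∈
      ... | y∈S , y∈M = x∈p∩q⁺ (q⊆p∪q ⁅ edgeOf x ⁆ (edges S) y∈S , y∈M)
      at-tail : b (tail (edgeOf x)) ℕ.≤ degree M (tail (edgeOf x)) →
          sum (saturatedUsed S) ℕ.< sum (saturatedUsed (x ∷ S))
      at-tail b≤ = sum-mono-< (saturatedUsed-mono x S) {tail (edgeOf x)}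
        (saturatedUsed-< x S (tail (edgeOf x)) (tailIndex x) (tailRange adm) (hits-tail x) b≤)
      at-head : b (head (edgeOf x)) ℕ.≤ degree M (head (edgeOf x)) →
          sum (saturatedUsed S) ℕ.< sum (saturatedUsed (x ∷ S))
      at-head b≤ = sum-mono-< (saturatedUsed-mono x S) {head (edgeOf x)}
        (saturatedUsed-< x S (head (edgeOf x)) (headIndex x) (headRange adm) (hits-head x) b≤)

    size-bound : ∀ {S K} → Valid S → (∀ s → occupancy s S ℕ.≤ K) →
        length S ℕ.≤ ∣ M ∣ ℕ.+ ∣ M ∣ ℕ.* 2 ℕ.* K
    size-bound {S} {K} valid occ≤K =
        ℕ.≤-trans (length≤ valid) (ℕ.+-mono-≤ (p⊆q⇒∣p∣≤∣q∣ (p∩q⊆q (edges S) M))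
      (ℕ.≤-trans (sum-mono per-vertex)
        (ℕ.≤-reflexive (trans (sum-*ʳ (degree M) K) (cong (ℕ._* K) (handshake M))))))
      where
      per-vertex : ∀ v → saturatedUsed S v ℕ.≤ degree M v ℕ.* K
      per-vertex v with b v ℕ.≤? degree M v
      ... | yes b≤ = ℕ.≤-trans (sum-mono {b v} (λ q → occ≤K (v , toℕ q)))
        (ℕ.≤-trans (ℕ.≤-reflexive (sum-const (b v) K)) (ℕ.*-monoˡ-≤ K b≤))
      ... | no _ = ℕ.z≤n

-- Arithmetic of the memory bound

module MemoryBound (𝓡 : RealNumbers) where
  open RealNumbers 𝓡
  open OrderedField 𝓡

  -- A floor of `B` cut off at `N` and found by descending search: counting needs a natural number
  -- where `capacity` is real. The number of entries serves as `N`, since it bounds every occupancy.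
  integer-bound : ∀ B N → 0# ≤ B → ∃[ K ] fromℕ K ≤ B × (∀ n → n ℕ.≤ N → fromℕ n ≤ B → n ℕ.≤ K)
  integer-bound B zero    0≤B = 0 , 0≤B , λ n n≤0 _ → n≤0
  integer-bound B (suc N) 0≤B with fromℕ (suc N) ≤? B
  ... | yes N≤B = suc N , N≤B , λ n n≤N _ → n≤N
  ... | no  N≰B with integer-bound B N 0≤B
  ...   | K , K≤B , largest = K , K≤B , λ n n≤1+N n≤B → largest n (below n n≤1+N n≤B) n≤B
    where
    below : ∀ n → n ℕ.≤ suc N → fromℕ n ≤ B → n ℕ.≤ N
    below n n≤1+N n≤B with n ℕ.≟ suc N
    ... | yes refl = contradiction n≤B N≰B
    ... | no  n≢   = ℕ.≤-pred (ℕ.≤∧≢⇒< n≤1+N n≢)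

  total-memory : ∀ {k s m K c L} → k ℕ.≤ 5 ℕ.* s ℕ.+ c → s ℕ.≤ m ℕ.+ m ℕ.* 2 ℕ.* K → 1 ℕ.≤ m →
                 0# ≤ L → fromℕ K ≤ L + L + fromℕ 4 →
                     fromℕ k ≤ fromℕ (45 ℕ.+ c) * (1# + L) * fromℕ m
  total-memory {k} {s} {m} {K} {c} {L} k≤ s≤ 1≤m 0≤L K≤ = ≤-trans (fromℕ-mono k≤cells) (≤-trans
    (≤-reflexive (trans (fromℕ-* m _) (cong (fromℕ m *_) (trans (fromℕ-+ (5 ℕ.+ c) _)
      (cong₂ _+_ (fromℕ-+ 5 c) (fromℕ-* 10 K))))))
    (≤-by
      (*-nonneg (0≤fromℕ m) (*-nonneg (0≤fromℕ 10) (x≤y⇒0≤y-x K≤)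
        +⁺ *-nonneg (0≤fromℕ 25 +⁺ 0≤fromℕ c) 0≤L))
      (trans (cong (λ x → x * (1# + L) * fromℕ m) (fromℕ-+ 45 c))
        (solve 4 (λ m c K L → (num 45 :+ c) :* (:1 :+ L) :* m :=
            m :* (num 5 :+ c :+ num 10 :* K) :+
            m :* (num 10 :* (L :+ L :+ num 4 :- K) :+ (num 25 :+ c) :* L))
          refl (fromℕ m) (fromℕ c) (fromℕ K) L))))
    where
    open ℕ.≤-Reasoning
    rearrange : ∀ m K c → 5 ℕ.* (m ℕ.+ m ℕ.* 2 ℕ.* K) ℕ.+ m ℕ.* c ≡ m ℕ.* (5 ℕ.+ c ℕ.+ 10 ℕ.* K)
    rearrange = solve-∀
    k≤cells : k ℕ.≤ m ℕ.* (5 ℕ.+ c ℕ.+ 10 ℕ.* K)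
    k≤cells = begin
      k                                               ≤⟨ k≤ ⟩
      5 ℕ.* s ℕ.+ c
          ≤⟨ ℕ.+-mono-≤ (ℕ.*-monoʳ-≤ 5 s≤)
          (ℕ.≤-trans (ℕ.≤-reflexive (sym (ℕ.*-identityˡ c))) (ℕ.*-monoˡ-≤ c 1≤m)) ⟩
      5 ℕ.* (m ℕ.+ m ℕ.* 2 ℕ.* K) ℕ.+ m ℕ.* c         ≡⟨ rearrange m K c ⟩
      m ℕ.* (5 ℕ.+ c ℕ.+ 10 ℕ.* K)                    ∎

≤-sum-tabulate : ∀ {n} (b : Fin n → ℕ) v → b v ℕ.≤ sumˡ (tabulate b)
≤-sum-tabulate b zero    = ℕ.m≤m+n _ _
≤-sum-tabulate b (suc v) = ℕ.≤-trans (≤-sum-tabulate (b ∘ suc) v) (ℕ.m≤n+m _ _)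

-- The streaming programs

module Programs (𝓡 : RealNumbers) {μ : Streaming.Mode 𝓡} (params : Parameters 𝓡 μ) where
  open RealNumbers 𝓡
  open Streaming 𝓡
  open Parameters params
  open Coins 𝓡 using (Coin)

  -- Newest first, an entry is stored as its head slot, tail slot, head level,
  -- tail level and edge.
  data Layout : List Kind → Set where
    []    : Layout []
    block : ∀ {Γ} → Layout Γ → Layout (index ∷ index ∷ real ∷ real ∷ edge ∷ Γ)

  -- A step is given only the kinds in memory and recovers the division into entries from them.
  -- Lists of another form do not arise in a run.
  layout? : (Γ : List Kind) → Maybe (Layout Γ)
  layout? [] = just []
  layout? (index ∷ index ∷ real ∷ real ∷ edge ∷ Γ) = Maybe.map block (layout? Γ)
  layout? _ = nothing

  Inclusion : List Kind → List Kind → Set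
  Inclusion Γ Δ = ∀ {k} → k ∈ˡ Γ → k ∈ˡ Δ

  pattern #0 = here refl
  pattern #1 = there #0
  pattern #2 = there #1
  pattern #3 = there #2
  pattern #4 = there #3

  shift₅ : ∀ {k₁ k₂ k₃ k₄ k₅ Γ} → Inclusion Γ (k₁ ∷ k₂ ∷ k₃ ∷ k₄ ∷ k₅ ∷ Γ)
  shift₅ x = there (there (there (there (there x))))

  Cells : ℕ → List Kind → Set
  Cells n Δ = List (Cell n (edge ∈ˡ Δ) (real ∈ˡ Δ))

  handles : ∀ {n Δ} → Cells n Δ → List (edge ∈ˡ Δ)
  handles = map Cell.handle

  module _ {n : ℕ} {b : Fin n → ℕ} {Result : List Kind → Set} where

    Prog : List Kind → Set
    Prog = Program n b μ Result

    -- Slots become known only by branching on what is read, hence the continuation. It receives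
    -- slots as data, but edges and levels as references, and nothing new is stored.
    readAll : ∀ {Γ Δ} → Layout Γ → Inclusion Γ Δ → (Cells n Δ → Prog Δ) → Prog Δ
    readAll []        ρ K = K []
    readAll (block l) ρ K =
      read (ρ #0) λ headIndex → read (ρ #1) λ tailIndex → endsOf (ρ #4) λ (u , v) →
      readAll l (ρ ∘ shift₅) λ cs →
      K (cell (ρ #4) (u , tailIndex) (v , headIndex) (ρ #3) (ρ #2) ∷ cs)

    leastRef : ∀ {A : Set} {Δ} → (A → real ∈ˡ Δ) → List A → A → (A → Prog Δ) → Prog Δ
    leastRef ref []       c K = K c
    leastRef ref (q ∷ qs) c K =
      compare (ref q) (ref c) λ t → leastRef ref qs (if t then q else c) K

    -- The program cannot see that capacities are positive, so it needs a fallback for a vertex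
    -- without slots.
    select : ∀ {Δ} m → (Fin m → real ∈ˡ Δ) → Prog Δ → (Fin m → Prog Δ) → Prog Δ
    select zero    ref fallback K = fallback
    select (suc m) ref fallback K = leastRef ref (allFin (suc m)) zero K

    flipCoin : ∀ {p Δ} → Coin μ p → Prog Δ → Prog Δ → Prog Δ
    flipCoin (inj₁ _)               accept reject = accept
    flipCoin (inj₂ (r , 0≤p , p≤1)) accept reject =
      flip r _ 0≤p p≤1 λ c → if c then accept else reject

  indexBound : ∀ {n} (b : Fin n → ℕ) {v} (i : Fin (b v)) k → toℕ i ℕ.≤ n ℕ.+ sumˡ (tabulate b) ℕ.+ k
  indexBound {n} b {v} i k = ℕ.≤-trans (ℕ.<⇒≤ (toℕ<n i))
    (ℕ.≤-trans (≤-sum-tabulate b v) (ℕ.≤-trans (ℕ.m≤n+m _ n) (ℕ.m≤m+n _ k)))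

  module _ {n : ℕ} (b : Fin n → ℕ) where

    StepProgram : List Kind → Set
    StepProgram = Program n b μ (λ _ → ⊤)

    decide : ∀ {Γ u v} → Cells n (real ∷ edge ∷ Γ) → Fin (b u) → Fin (b v) →
        StepProgram (real ∷ edge ∷ Γ)
    decide {Γ} {u} {v} cs i j =
      operate add tailRef headRef $
      constant (1# + a) $
      operate mul #0 #1 $
      -- in memory, newest first: threshold, 1 + a, price, 0, e
      evaluate (map (there ∘ there ∘ there) (handles cs)) $
      evaluate (there #4 ∷ map (there ∘ there ∘ there ∘ there) (handles cs)) $
      operate sub #0 #1 $
      -- in memory: weight, f (S ∪ e), f (S), threshold, 1 + a, price, 0, e
      compare #0 #3 λ light →
      if light then discard else flipCoin coin accept discard
      where
      tailRef headRef : real ∈ˡ real ∷ edge ∷ Γ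
      tailRef = topLevel cs #0 (u , toℕ i)
      headRef = topLevel cs #0 (v , toℕ j)

      discard : StepProgram (real ∷ real ∷ real ∷ real ∷ real ∷ real ∷ real ∷ edge ∷ Γ)
      discard = keep (_ ∷ʳ _ ∷ʳ _ ∷ʳ _ ∷ʳ _ ∷ʳ _ ∷ʳ _ ∷ʳ _ ∷ʳ ⊆ˡ-refl) (return tt)

      accept : StepProgram (real ∷ real ∷ real ∷ real ∷ real ∷ real ∷ real ∷ edge ∷ Γ)
      accept =
        -- Weight minus price; the surplus is then added to both levels found.
        operate sub #0 (there #4) $
        operate add (there (there (shift₅ tailRef))) #0 $
        operate add (shift₅ (there (there (there headRef)))) #1 $
        write (toℕ i) (indexBound b i _) $
        write (toℕ j) (indexBound b j _) $
        keep (refl ∷ refl ∷ refl ∷ refl ∷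
              _ ∷ʳ _ ∷ʳ _ ∷ʳ _ ∷ʳ _ ∷ʳ _ ∷ʳ _ ∷ʳ _ ∷ʳ refl ∷ ⊆ˡ-refl) (return tt)

    arrive : ∀ {Γ} → Maybe (Layout Γ) → StepProgram (edge ∷ Γ)
    arrive nothing  = return tt
    arrive (just l) =
      endsOf #0 λ (u , v) →
      constant 0# $
      readAll l (there ∘ there) λ cs →
      select (b u) (λ q → topLevel cs #0 (u , toℕ q)) (return tt) λ i →
      select (b v) (λ q → topLevel cs #0 (v , toℕ q)) (return tt) λ j →
      decide cs i j

    conclude : ∀ {Γ} → Maybe (Layout Γ) → Program n b μ (λ Δ → List (edge ∈ˡ Δ)) Γ
    conclude nothing  = return []
    conclude (just l) = readAll l (λ x → x) λ cs → return (greedy cs [])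

  algorithm : Algorithm μ
  algorithm = record
    { step   = λ n b Γ → arrive b (layout? Γ)
    ; finish = λ n b Γ → conclude b (layout? Γ)
    }

-- The programs simulate the abstract process

module Simulation (𝓡 : RealNumbers) {μ : Streaming.Mode 𝓡} (params : Parameters 𝓡 μ)
                  (G : Multigraph) (b : Fin (#V G) → ℕ) (1≤b : ∀ v → 1 ℕ.≤ b v)
                  (f : Subset (#E G) → RealNumbers.ℝ 𝓡) where
  open RealNumbers 𝓡
  open RealSums 𝓡
  open Streaming 𝓡
  open Execution G b f
  open Parameters params
  open Coins 𝓡
  open Degrees G
  open States 𝓡 G
  open Process 𝓡 params G b 1≤b f
  open Programs 𝓡 params

  -- The same tree of tosses with related leaves. The leaves have different types, and the branches
  -- of a toss are functions, compared pointwise.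
  data Related {A B : Set} (R : A → B → Set) : Rand μ A → Rand μ B → Set where
    pure : ∀ {x y} → R x y → Related R (pure x) (pure y)
    toss : ∀ {r p 0≤p p≤1 k l} → (∀ c → Related R (k c) (l c)) →
           Related R (toss r p 0≤p p≤1 k) (toss r p 0≤p p≤1 l)

  Related-𝔼 : ∀ {A B : Set} {R : A → B → Set} {g h r s} → (∀ x y → R x y → g x ≡ h y) →
              Related R r s → 𝔼 g r ≡ 𝔼 h s
  Related-𝔼 eq (pure xy)            = eq _ _ xy
  Related-𝔼 eq (toss {p = p} kl) = cong₂ (λ x y → p * x + (1# - p) * y)
    (Related-𝔼 eq (kl true)) (Related-𝔼 eq (kl false))

  Related-Surely : ∀ {A B : Set} {R : A → B → Set} {P : A → Set} {Q : B → Set} {r s} →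
                   (∀ x y → R x y → Q y → P x) → Related R r s → Surely Q s → Surely P r
  Related-Surely imp (pure xy) q = imp _ _ xy q
  Related-Surely imp (toss kl) q = λ c → Related-Surely imp (kl c) (q c)

  Related-map : ∀ {A B : Set} {R R′ : A → B → Set} {r s} → (∀ x y → R x y → R′ x y) →
      Related R r s → Related R′ r s
  Related-map imp (pure xy) = pure (imp _ _ xy)
  Related-map imp (toss kl) = toss λ c → Related-map imp (kl c)

  shape : State → List Kind
  shape []      = []
  shape (x ∷ S) = index ∷ index ∷ real ∷ real ∷ edge ∷ shape S

  encode : (S : State) → Memory (shape S)
  encode []      = []
  encode (x ∷ S) = headIndex x ∷ tailIndex x ∷ headLevel x ∷ tailLevel x ∷ edgeOf x ∷ encode S

  layoutOf : (S : State) → Layout (shape S)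
  layoutOf []      = []
  layoutOf (x ∷ S) = block (layoutOf S)

  layout?-shape : ∀ S → layout? (shape S) ≡ just (layoutOf S)
  layout?-shape []      = refl
  layout?-shape (x ∷ S) = cong (Maybe.map block) (layout?-shape S)

  length-shape : ∀ S → length (shape S) ≡ length S ℕ.* 5
  length-shape []      = refl
  length-shape (x ∷ S) = cong (5 ℕ.+_) (length-shape S)

  describe : ∀ {Δ} (S : State) → Inclusion (shape S) Δ → Cells (#V G) Δ
  describe []      ι = []
  describe (x ∷ S) ι = cell (ι #4) (tailSlot x) (headSlot x) (ι #3) (ι #2) ∷ describe S (ι ∘ shift₅)

  Holds : ∀ {Δ} (S : State) → Inclusion (shape S) Δ → Memory Δ → Set
  Holds S ι mem = ∀ {k} (x : k ∈ˡ shape S) → All.lookup mem (ι x) ≡ All.lookup (encode S) x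

  topLevel-describe : ∀ {Δ} S (ι : Inclusion (shape S) Δ) mem → Holds S ι mem →
    ∀ {z} → All.lookup mem z ≡ 0# → ∀ s → All.lookup mem (topLevel (describe S ι) z s) ≡ level S s
  topLevel-describe []      ι mem holds z≡0 s = z≡0
  topLevel-describe (x ∷ S) ι mem holds z≡0 s with s ≟ˢ tailSlot x | s ≟ˢ headSlot x
  ... | yes _ | _     = holds #3
  ... | no  _ | yes _ = holds #2
  ... | no  _ | no  _ = topLevel-describe S (ι ∘ shift₅) mem (λ y → holds (shift₅ y)) z≡0 s

  edgeSet-describe : ∀ {Δ Δ′} S (ι : Inclusion (shape S) Δ) (σ : edge ∈ˡ Δ → edge ∈ˡ Δ′) mem mem′ →
      Holds S ι mem →
    (∀ x → All.lookup mem′ (σ x) ≡ All.lookup mem x) →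
    edgeSet mem′ (map σ (handles (describe S ι))) ≡ edges S
  edgeSet-describe []      ι σ mem mem′ holds eq = refl
  edgeSet-describe (x ∷ S) ι σ mem mem′ holds eq = cong₂ _∪_ (cong ⁅_⁆ (trans (eq _) (holds #4)))
    (edgeSet-describe S (ι ∘ shift₅) σ mem mem′ (λ y → holds (shift₅ y)) eq)

  greedy-describe : ∀ {Δ} S (ι : Inclusion (shape S) Δ) mem → Holds S ι mem → ∀ B →
    edgeSet mem (greedy (describe S ι) B) ≡ edgesOf (matching S B)
  greedy-describe []      ι mem holds B = refl
  greedy-describe (x ∷ S) ι mem holds B with tailSlot x ∈ˢ? B | headSlot x ∈ˢ? B
  ... | yes _ | _     = greedy-describe S (ι ∘ shift₅) mem (λ y → holds (shift₅ y)) B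
  ... | no  _ | yes _ = greedy-describe S (ι ∘ shift₅) mem (λ y → holds (shift₅ y)) B
  ... | no  _ | no  _ = cong₂ _∪_ (cong ⁅_⁆ (holds #4))
    (greedy-describe S (ι ∘ shift₅) mem (λ y → holds (shift₅ y)) _)

  module _ (N : ℕ) {Result : List Kind → Set} (Q : Rand μ (Final Result) → Set) where

    -- A weakest precondition under a memory budget `N`. Being a record, it lets program and memory
    -- be inferred from the goal.
    record Good {Γ : List Kind} (P : Program (#V G) b μ Result Γ) (mem : Memory Γ) : Set where
      constructor wp
      field
        reach : ∀ k → k ℕ.≤ N → Q (exec P mem k)

  open Good

  module _ {N : ℕ} {Result : List Kind → Set} {Q : Rand μ (Final Result) → Set}
           {Γ : List Kind} {mem : Memory Γ} (fits : length Γ ℕ.≤ N) where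

    good-read : ∀ {x P i} → All.lookup mem x ≡ i → Good N Q (P i) mem → Good N Q (read x P) mem
    good-read refl good = wp λ k k≤N → reach good _ (ℕ.⊔-lub k≤N fits)

    good-endsOf : ∀ {x P e} → All.lookup mem x ≡ e → Good N Q (P (Multigraph.ends G e)) mem →
        Good N Q (endsOf x P) mem
    good-endsOf refl good = wp λ k k≤N → reach good _ (ℕ.⊔-lub k≤N fits)

    good-constant : ∀ {c P} → Good N Q P (c ∷ mem) → Good N Q (constant c P) mem
    good-constant good = wp λ k k≤N → reach good _ (ℕ.⊔-lub k≤N fits)

    good-operate : ∀ {∙ x y P c} → apply ∙ (All.lookup mem x) (All.lookup mem y) ≡ c →
                   Good N Q P (c ∷ mem) → Good N Q (operate ∙ x y P) mem
    good-operate refl good = wp λ k k≤N → reach good _ (ℕ.⊔-lub k≤N fits)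

    good-evaluate : ∀ {xs P X} → edgeSet mem xs ≡ X → Good N Q P (f X ∷ mem) →
        Good N Q (evaluate xs P) mem
    good-evaluate refl good = wp λ k k≤N → reach good _ (ℕ.⊔-lub k≤N fits)

    good-compare : ∀ {x y P c d} → All.lookup mem x ≡ c → All.lookup mem y ≡ d →
                   Good N Q (P ⌊ c ≤? d ⌋) mem → Good N Q (compare x y P) mem
    good-compare refl refl good = wp λ k k≤N → reach good _ (ℕ.⊔-lub k≤N fits)

    good-write : ∀ {i i≤ P} → Good N Q P (i ∷ mem) → Good N Q (write i i≤ P) mem
    good-write good = wp λ k k≤N → reach good _ (ℕ.⊔-lub k≤N fits)

    good-keep : ∀ {Δ} {Δ⊆Γ : Δ ⊆ˡ Γ} {P mem′} → All-resp-⊆ Δ⊆Γ mem ≡ mem′ → Good N Q P mem′ →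
        Good N Q (keep Δ⊆Γ P) mem
    good-keep refl good = wp λ k k≤N → reach good _ (ℕ.⊔-lub k≤N fits)

    good-return : ∀ {r} → (∀ k → k ℕ.≤ N → Q (pure (final mem r k))) → Good N Q (return r) mem
    good-return good = wp λ k k≤N → good _ (ℕ.⊔-lub k≤N fits)

    good-readAll : ∀ S (ι : Inclusion (shape S) Γ) {K} → Holds S ι mem →
                   Good N Q (K (describe S ι)) mem → Good N Q (readAll (layoutOf S) ι K) mem
    good-readAll []      ι holds good = good
    good-readAll (x ∷ S) ι holds good =
      good-read (holds #0) (good-read (holds #1) (good-endsOf (holds #4)
        (good-readAll S (ι ∘ shift₅) (λ y → holds (shift₅ y)) good)))

    good-leastRef : ∀ {A : Set} {ref : A → real ∈ˡ Γ} {φ : A → ℝ} {K} →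
        (∀ q → All.lookup mem (ref q) ≡ φ q) → ∀ qs c →
                    Good N Q (K (least φ qs c)) mem → Good N Q (leastRef ref qs c K) mem
    good-leastRef refs []       c good = good
    good-leastRef refs (q ∷ qs) c good =
        good-compare (refs q) (refs c) (good-leastRef refs qs _ good)

    good-select : ∀ {m} {ref : Fin m → real ∈ˡ Γ} {φ : Fin m → ℝ} {fallback K} →
        (∀ q → All.lookup mem (ref q) ≡ φ q) →
                  (1≤m : 1 ℕ.≤ m) → Good N Q (K (least φ (allFin m) (first 1≤m))) mem →
                      Good N Q (select m ref fallback K) mem
    good-select {suc m} refs 1≤m good = good-leastRef refs (allFin (suc m)) zero good

  good-flipCoin : ∀ {N Result Γ A B p} {R : A → B → Set} {h : Final Result → Rand μ A}
      {accept reject accept′ reject′}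
    {mem : Memory Γ} → length Γ ℕ.≤ N → (c : Coin μ p) →
    Good N (λ r → Related R (r >>= h) accept′) accept mem →
        Good N (λ r → Related R (r >>= h) reject′) reject mem →
    Good N (λ r → Related R (r >>= h) (branch c accept′ reject′)) (flipCoin c accept reject) mem
  good-flipCoin fits (inj₁ _) goodA goodR = goodA
  good-flipCoin fits (inj₂ _) goodA goodR = wp λ k k≤N → toss λ
    { true → reach goodA _ (ℕ.⊔-lub k≤N fits) ; false → reach goodR _ (ℕ.⊔-lub k≤N fits) }

  good-if : ∀ {N Result Γ A B} {R : A → B → Set} {h : Final Result → Rand μ A} {P P′ r r′}
      {mem : Memory Γ} c →
    Good N (λ s → Related R (s >>= h) r) P mem → Good N (λ s → Related R (s >>= h) r′) P′ mem →
    Good N (λ s → Related R (s >>= h) (if c then r else r′)) (if c then P else P′) mem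
  good-if true  good good′ = good
  good-if false good good′ = good′

  room : State → ℕ
  room S = 13 ℕ.+ length (shape S)

  module _ {A B : Set} {R : A → B → Set} {h : Final (λ _ → ⊤) → Rand μ A} (S : State) (e : Fin (#E G)) where

    N = room S

    fits : ∀ m {m≤13 : T (m ℕ.≤ᵇ 13)} → m ℕ.+ length (shape S) ℕ.≤ N
    fits m {m≤13} = ℕ.+-monoˡ-≤ (length (shape S)) (ℕ.≤ᵇ⇒≤ m 13 m≤13)

    ι : Inclusion (shape S) (real ∷ edge ∷ shape S)
    ι x = there (there x)

    mem : Memory (real ∷ edge ∷ shape S)
    mem = 0# ∷ e ∷ encode S

    leaf : ∀ {Γ′} {mem′ : Memory Γ′} {T′ : Rand μ B} →
        (∀ k → k ℕ.≤ N → Related R (h (final mem′ tt k)) T′) →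
           length Γ′ ℕ.≤ N → Good N (λ r → Related R (r >>= h) T′) (return tt) mem′
    leaf good fits′ = good-return {Q = λ r → Related R (r >>= h) _} fits′ good

    -- The continuation `h` is the rest of the run; with it inside the relation, the two outcomes of
    -- a toss can continue differently.
    good-arrive : ∀ {rejected accepted : Rand μ B} →
      (∀ k → k ℕ.≤ N → Related R (h (final (encode S) tt k)) rejected) →
      (∀ k → k ℕ.≤ N → Related R (h (final (encode (newEntry S e ∷ S)) tt k)) accepted) →
      Good N (λ r → Related R (r >>= h)
               (if ⌊ weight S e ≤? (1# + a) * price S e ⌋ then rejected else branch coin accepted
                   rejected))
        (arrive b (just (layoutOf S))) (e ∷ encode S)
    good-arrive {rejected} {accepted} good-rejected good-accepted =
      good-endsOf (fits 1) refl $ good-constant (fits 1) $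
      good-readAll (fits 2) S ι (λ _ → refl) $
      good-select (fits 2) (λ q → levelRef _) (1≤b (tail e)) $
      good-select (fits 2) (λ q → levelRef _) (1≤b (head e)) $
      good-operate (fits 2) (cong₂ _+_ (levelRef _) (levelRef _)) $
      good-constant (fits 3) $ good-operate (fits 4) refl $
      good-evaluate (fits 5) (edgeSet-describe S ι _ mem tested (λ _ → refl) (λ _ → refl)) $
      good-evaluate (fits 6) (cong (⁅ e ⁆ ∪_)
          (edgeSet-describe S ι _ mem (f (edges S) ∷ tested) (λ _ → refl) (λ _ → refl))) $
      good-operate (fits 7) refl $
      good-compare (fits 8) refl refl $
      good-if ⌊ weight S e ≤? (1# + a) * price S e ⌋ discarded
        (good-flipCoin (fits 8) coin
          (good-operate (fits 8) refl $
           good-operate (fits 9) (cong (_+ surplus S e) (levelRef _)) $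
           good-operate (fits 10) (cong (_+ surplus S e) (levelRef _)) $
           good-write (fits 11) $ good-write (fits 12) $
           good-keep (fits 13) (cong (λ m → headIndex x ∷ tailIndex x ∷ headLevel x ∷ tailLevel x ∷
               e ∷ m) (All-resp-⊆-refl (encode S)))
             (leaf good-accepted (fits 5)))
          discarded)
      where
      x = newEntry S e
      tested : Memory (real ∷ real ∷ real ∷ real ∷ edge ∷ shape S)
      tested = (1# + a) * price S e ∷ 1# + a ∷ price S e ∷ mem
      levelRef : ∀ s → All.lookup mem (topLevel (describe S ι) #0 s) ≡ level S s
      levelRef = topLevel-describe S ι mem (λ _ → refl) refl
      discarded : ∀ {c₁ c₂ c₃ c₄ c₅ c₆ : ℝ} → Good N (λ r → Related R (r >>= h) rejected)
        (keep (_ ∷ʳ _ ∷ʳ _ ∷ʳ _ ∷ʳ _ ∷ʳ _ ∷ʳ _ ∷ʳ _ ∷ʳ ⊆ˡ-refl) (return tt))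
            (c₁ ∷ c₂ ∷ c₃ ∷ c₄ ∷ c₅ ∷ c₆ ∷ mem)
      discarded = good-keep (fits 8) (All-resp-⊆-refl (encode S)) (leaf good-rejected (fits 0))

  good-conclude : ∀ {N} S → length (shape S) ℕ.≤ N →
    Good N (λ r → Related (λ o S′ →
        S′ ≡ S × selected o ≡ edgesOf (matching S []) × Final.peak o ℕ.≤ N) r (pure S))
      (conclude b (just (layoutOf S))) (encode S)
  good-conclude {N} S fits =
    good-readAll fits S (λ x → x) (λ _ → refl)
      (good-return fits λ k k≤N → pure
          (refl , greedy-describe S (λ x → x) (encode S) (λ _ → refl) [] , k≤N))

  Simulates : Final (λ Γ → List (edge ∈ˡ Γ)) → State → Set
  Simulates o S = selected o ≡ edgesOf (matching S []) × Final.peak o ℕ.≤ room S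

  runFrom-simulates : ∀ es S k → k ℕ.≤ room S →
                      Related Simulates (runFrom algorithm (encode S) k es) (process es S)
  runFrom-simulates [] S k k≤ rewrite layout?-shape S =
    Related-map (λ { _ _ (refl , sel , peak≤) → sel , peak≤ })
      (Good.reach (good-conclude S (ℕ.m≤n+m _ 13)) k k≤)
  runFrom-simulates (e ∷ es) S k k≤ rewrite layout?-shape S =
    Good.reach (good-arrive {h = λ s → runFrom algorithm (Final.memory s) (Final.peak s) es} S e
      (λ k k≤ → runFrom-simulates es S k k≤)
      (λ k k≤ → runFrom-simulates es (newEntry S e ∷ S) k
          (ℕ.≤-trans k≤ (ℕ.+-monoʳ-≤ 13 (ℕ.m≤n+m _ 5))))) k k≤

-- The guarantees of the streaming algorithm

module Guarantees (𝓡 : RealNumbers) {μ : Streaming.Mode 𝓡} (params : Parameters 𝓡 μ)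
                  (G : Multigraph) (b : Fin (#V G) → ℕ) (1≤b : ∀ v → 1 ℕ.≤ b v)
                  (f : Subset (#E G) → RealNumbers.ℝ 𝓡)
                  (nonneg : SetFunctions.NonNegative 𝓡 f) (submodular : SetFunctions.Submodular 𝓡 f)
                  (es : List (Fin (#E G))) (stream : IsStream G es) where
  open RealNumbers 𝓡
  open OrderedField 𝓡
  open Streaming 𝓡
  open SetFunctions 𝓡 f using (Monotone)
  open Execution G b f
  open Parameters params
  open States 𝓡 G
  open ValidStates 𝓡 G b f submodular a 0≤a using (Valid; [])
  open Process 𝓡 params G b 1≤b f
  open Expectation 𝓡 params G b 1≤b f submodular using (process-valid)
  open Value 𝓡 params G b 1≤b f submodular nonneg
  open Programs 𝓡 params using (algorithm)
  open Simulation 𝓡 params G b 1≤b f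
  open Occupancy 𝓡 G

  unique : Unique es
  unique = SetoidPermutation.Unique-resp-↭ (setoid (Fin (#E G))) (↭⇒↭ₛ (↭-sym stream))
      (allFin⁺ (#E G))

  exhaustive : ∀ e → e ∈ˡ es
  exhaustive e = ∈-resp-↭ (↭-sym stream) (∈-allFin e)

  simulation : Related Simulates (run algorithm es) (process es [])
  simulation = runFrom-simulates es [] 0 ℕ.z≤n

  valid-outcome : Surely Valid (process es [])
  valid-outcome = process-valid unique (avoids-⊥ es) []

  state-memory : ∀ {S k} → Valid S → k ℕ.≤ room S → Fin (#E G) → UsesMemory 58 k
  state-memory {S} {k} valid k≤ e W L M isMax isLog isMaximum
    with MemoryBound.integer-bound 𝓡 (M.capacity L isLog) (length S)
        (M.0≤L L isLog +⁺ M.0≤L L isLog +⁺ 0≤fromℕ 4)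
    where module M = Memory 𝓡 G b f submodular a 0≤a growth W isMax
  ... | K , K≤capacity , largest = MemoryBound.total-memory 𝓡 {k} {length S} {∣ M ∣} {K} {13} {L}
    (ℕ.≤-trans k≤ (ℕ.≤-reflexive (trans (ℕ.+-comm 13 _)
        (cong (ℕ._+ 13) (trans (length-shape S) (ℕ.*-comm (length S) 5))))))
    (Size.size-bound 𝓡 G b f submodular a 0≤a {M = M} isMaximum valid
      λ s → largest _ (occupancy≤length s S) (M.occupancy≤capacity L isLog valid s))
    (Extension.maximum-nonempty G b 1≤b {M} isMaximum e) (M.0≤L L isLog) K≤capacity
    where module M = Memory 𝓡 G b f submodular a 0≤a growth W isMax

  -- Without edges the allowed memory is zero, so the bound by `room` is too weak and the run on the
  -- empty stream is examined separately.
  no-memory : ∀ {k} → k ℕ.≤ 0 → UsesMemory 58 k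
  no-memory ℕ.z≤n W L M isMax isLog isMaximum =
    *-nonneg (*-nonneg (0≤fromℕ 58) (0≤1 +⁺ M.0≤L L isLog)) (0≤fromℕ ∣ M ∣)
    where module M = Memory 𝓡 G b f submodular a 0≤a growth W isMax

  memory-used : Surely (λ t → UsesMemory 58 (Final.peak t)) (run algorithm es)
  memory-used = by-stream es simulation valid-outcome
    where
    by-stream : ∀ es → Related Simulates (run algorithm es) (process es []) →
        Surely Valid (process es []) →
                Surely (λ t → UsesMemory 58 (Final.peak t)) (run algorithm es)
    by-stream [] _ _ = Related-Surely {Q = λ _ → ⊤} (λ { _ _ (_ , _ , peak≤0) _ → no-memory peak≤0 })
      (Good.reach (good-conclude [] ℕ.z≤n) 0 ℕ.z≤n) tt
    by-stream (e ∷ _) sim valid = Related-Surely (λ _ _ (_ , peak≤) v → state-memory v peak≤ e) sim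
        valid

  output-valid : Surely (λ t → IsBMatching G b (selected t)) (run algorithm es)
  output-valid = Related-Surely
    (λ _ _ (sel , _) valid → subst (IsBMatching G b) (sym sel) (output-isBMatching valid))
        simulation valid-outcome

  𝔼-selected : 𝔼 (f ∘ selected) (run algorithm es) ≡ 𝔼 (f ∘ output) (process es [])
  𝔼-selected = Related-𝔼 (λ _ _ (sel , _) → cong f sel) simulation

  monotone-ratio : Monotone → ∀ {O} → IsBMatching G b O →
      f O ≤ κ * 𝔼 (f ∘ selected) (run algorithm es)
  monotone-ratio monotone {O} isB =
      subst (λ x → f O ≤ κ * x) (sym 𝔼-selected) (monotone-bound monotone isB unique exhaustive)

  general-ratio : ∀ {O} → IsBMatching G b O →
      (1# - p) * f O ≤ κ * 𝔼 (f ∘ selected) (run algorithm es)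
  general-ratio {O} isB = subst (λ x → (1# - p) * f O ≤ κ * x) (sym 𝔼-selected)
      (general-bound isB unique exhaustive)

module Deterministic (𝓡 : RealNumbers) where
  open RealNumbers 𝓡
  open Streaming 𝓡

  𝔼-outcome : ∀ {A : Set} (g : A → ℝ) (r : Rand deterministic A) → 𝔼 g r ≡ g (outcome r)
  𝔼-outcome g (pure _) = refl

  Surely-outcome : ∀ {A : Set} {P : A → Set} (r : Rand deterministic A) → Surely P r → P (outcome r)
  Surely-outcome (pure _) p = p

-- The parameters of the two algorithms

module Constants (𝓡 : RealNumbers) where
  open RealNumbers 𝓡
  open OrderedField 𝓡
  open Streaming 𝓡

  -- An equation is proved modulo the relations u ≡ u′ and v ≡ v′ by giving its
  -- cofactors.
  modulo : ∀ {x y u u′ v v′} c d → u ≡ u′ → v ≡ v′ → x ≡ y + (c * (u - u′) + d * (v - v′)) → x ≡ y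
  modulo {y = y} {u} {v = v} c d refl refl eq = trans eq
    (solve 5 (λ y u v c d → y :+ (c :* (u :- u) :+ d :* (v :- v)) := y) refl y u v c d)

  module _ (n : ℕ) where
    private
      1≤ : 1# ≤ fromℕ (suc n)
      1≤ = ≤-by (0≤fromℕ n) refl

    1/suc : ℝ
    1/suc = fromℕ (suc n) ⁻¹

    0≤1/suc : 0# ≤ 1/suc
    0≤1/suc = proj₁ (positive-⁻¹ 1≤)

    suc*1/suc : fromℕ (suc n) * 1/suc ≡ 1#
    suc*1/suc = proj₂ (positive-⁻¹ 1≤)

  1≤√ : ∀ {n s} → IsSqrt (fromℕ (suc (suc n))) s → 1# ≤ s
  1≤√ {n} {s} (0≤s , s²) with ≤-total 1# s
  ... | inj₁ 1≤s = 1≤s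
  ... | inj₂ s≤1 = ⊥-elim (1≰0 (≤-by
      (0≤fromℕ n +⁺ x≤y⇒0≤y-x (subst (_≤ 1# * 1#) s² (*-mono 0≤1 0≤s s≤1 s≤1)))
    (solve 1 (λ n → num 0 := :1 :+ (n :+ (:1 :* :1 :- (:1 :+ (:1 :+ n))))) refl (fromℕ n))))

  √3≤3 : ∀ {s} → IsSqrt (fromℕ 3) s → s ≤ fromℕ 3
  √3≤3 {s} (0≤s , s²) with ≤-total s (fromℕ 3)
  ... | inj₁ s≤3 = s≤3
  ... | inj₂ 3≤s = ⊥-elim (1≰0 (≤-by
      (0≤fromℕ 5 +⁺ x≤y⇒0≤y-x (subst (fromℕ 3 * fromℕ 3 ≤_) s² (*-mono 0≤s (0≤fromℕ 3) 3≤s 3≤s)))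
    (solve 0 (num 0 := :1 :+ (num 5 :+ (num 3 :- num 3 :* num 3))) refl)))

  module _ {s : ℝ} (√2 : IsSqrt (fromℕ 2) s) where
    private
      h = 1/suc 1
      0≤h = 0≤1/suc 1
      2h≡1 = suc*1/suc 1

    monotoneParameters : Parameters 𝓡 deterministic
    monotoneParameters = record
      -- With `h` = 1 / 2 this is √2 / 2, and `ρ` is its inverse √2.
      { a = h * s
      ; ρ = s
      ; p = 1#
      ; 0≤a = *-nonneg 0≤h (proj₁ √2)
      ; 0≤ρ = proj₁ √2
      ; aρ≡1 = modulo 1# h 2h≡1 (proj₂ √2)
          (solve 2 (λ h s → h :* s :* s := :1 :+
              (:1 :* (num 2 :* h :- :1) :+ h :* (s :* s :- num 2))) refl h s)
      ; growth = ≤-by (*-nonneg 0≤h (x≤y⇒0≤y-x (1≤√ {0} √2)))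
          (modulo (h + 1#) (h * h) 2h≡1 (proj₂ √2)
            (solve 2 (λ h s → (:1 :+ h :* s) :* (h :* s) := :1 :+ h :* (s :- :1) :+
                ((h :+ :1) :* (num 2 :* h :- :1) :+ h :* h :* (s :* s :- num 2))) refl h s))
      ; coin = inj₁ (refl , refl)
      ; pays = ≤-by (*-nonneg (0≤1 +⁺ *-nonneg 0≤h (proj₁ √2)) (0≤1 +⁺ 0≤1))
          (solve 1 (λ x → (:1 :+ x) :* (:1 :+ :1) := :1 :- :1 :+ (:1 :+ x) :* (:1 :+ :1)) refl
              (h * s))
      }

    monotone-κ : 1# + s + (1# + h * s + (1# + h * s)) ≡ fromℕ 3 + fromℕ 2 * s
    monotone-κ = modulo s 0# 2h≡1 (proj₂ √2)
      (solve 2 (λ h s → :1 :+ s :+ (:1 :+ h :* s :+ (:1 :+ h :* s)) :=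
          num 3 :+ num 2 :* s :+ (s :* (num 2 :* h :- :1) :+ num 0 :* (s :* s :- num 2))) refl h s)

  module _ {s : ℝ} (√3 : IsSqrt (fromℕ 3) s) where
    private
      h = 1/suc 5
      0≤h = 0≤1/suc 5
      6h≡1 = suc*1/suc 5
      0≤s = proj₁ √3
      s²≡3 = proj₂ √3

    generalParameters : Parameters 𝓡 randomized
    generalParameters = record
      -- With `h` = 1 / 6 this is √3 / 2, `ρ` is 2 / √3, and `p` is 1 / (3 + √3) = 1 / (1 + 2 α)
      -- with the denominator made rational.
      { a = fromℕ 3 * h * s
      ; ρ = fromℕ 4 * h * s
      ; p = h * (fromℕ 3 - s)
      ; 0≤a = *-nonneg (*-nonneg (0≤fromℕ 3) 0≤h) 0≤s
      ; 0≤ρ = *-nonneg (*-nonneg (0≤fromℕ 4) 0≤h) 0≤s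
      ; aρ≡1 = modulo (fromℕ 6 * h + 1#) (fromℕ 12 * h * h) 6h≡1 s²≡3
          (solve 2 (λ h s → num 3 :* h :* s :* (num 4 :* h :* s) := :1 :+
              ((num 6 :* h :+ :1) :* (num 6 :* h :- :1) :+ num 12 :* h :* h :* (s :* s :- num 3)))
                  refl h s)
      ; growth = ≤-by (*-nonneg 0≤h (*-nonneg (0≤fromℕ 3) (x≤y⇒0≤y-x (1≤√ {1} √3)) +⁺ *-nonneg
          (0≤fromℕ 9) 0≤h))
          (modulo (fromℕ 3 * h + 1#) (fromℕ 9 * h * h) 6h≡1 s²≡3
            (solve 2 (λ h s → (:1 :+ num 3 :* h :* s) :* (num 3 :* h :* s) :=
                :1 :+ h :* (num 3 :* (s :- :1) :+ num 9 :* h) :+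
                ((num 3 :* h :+ :1) :* (num 6 :* h :- :1) :+ num 9 :* h :* h :* (s :* s :- num 3)))
                    refl h s))
      ; coin = inj₂ (refl , *-nonneg 0≤h (x≤y⇒0≤y-x (√3≤3 √3)) , ≤-by
          (*-nonneg 0≤h (0≤fromℕ 3 +⁺ 0≤s))
          (modulo (0# - 1#) 0# 6h≡1 s²≡3
            (solve 2 (λ h s → :1 := h :* (num 3 :- s) :+ h :* (num 3 :+ s) :+
                ((num 0 :- :1) :* (num 6 :* h :- :1) :+ num 0 :* (s :* s :- num 3))) refl h s)))
      -- Equality holds: `p` is the smallest probability that pays.
      ; pays = ≤-reflexive (sym (modulo (fromℕ 3 * h * s - fromℕ 3 * h + 1#) (0# - fromℕ 6 * h * h)
          6h≡1 s²≡3
          (solve 2 (λ h s → (:1 :+ num 3 :* h :* s) :* (h :* (num 3 :- s) :+ h :* (num 3 :- s)) :=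
              :1 :- h :* (num 3 :- s) :+
              ((num 3 :* h :* s :- num 3 :* h :+ :1) :* (num 6 :* h :- :1) :+
               (num 0 :- num 6 :* h :* h) :* (s :* s :- num 3))) refl h s)))
      }

    -- Multiplication by 3 - √3 inverts 1 - p and turns κ into 4 + 2 √3.
    general-ratio⇒ : ∀ {x y} →
      (1# - h * (fromℕ 3 - s)) * x ≤
        (1# + fromℕ 4 * h * s + (1# + fromℕ 3 * h * s + (1# + fromℕ 3 * h * s))) * y →
      x ≤ (fromℕ 4 + fromℕ 2 * s) * y
    general-ratio⇒ {x} {y} le = subst₂ _≤_
      (modulo ((s - fromℕ 2) * x) ((0# - h) * x) 6h≡1 s²≡3
        (solve 3 (λ h s x → (num 3 :- s) :* ((:1 :- h :* (num 3 :- s)) :* x) := x :+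
            ((s :- num 2) :* x :* (num 6 :* h :- :1) :+ (num 0 :- h) :* x :* (s :* s :- num 3)))
                refl h s x))
      (modulo ((fromℕ 5 * s - fromℕ 5) * y) ((0# - fromℕ 10 * h) * y) 6h≡1 s²≡3
        (solve 3 (λ h s y → (num 3 :- s) :*
            ((:1 :+ num 4 :* h :* s :+ (:1 :+ num 3 :* h :* s :+ (:1 :+ num 3 :* h :* s))) :* y) :=
            (num 4 :+ num 2 :* s) :* y :+
            ((num 5 :* s :- num 5) :* y :* (num 6 :* h :- :1) :+ (num 0 :- num 10 :* h) :* y :*
                (s :* s :- num 3))) refl h s y))
      (*-monoʳ (x≤y⇒0≤y-x (√3≤3 √3)) le)

theorem2 :
  (𝓡 : RealNumbers) →
  let open RealNumbers 𝓡
      open Streaming 𝓡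
      open SetFunctions 𝓡
  in
  (√2 √3 : ℝ) → IsSqrt (fromℕ 2) √2 → IsSqrt (fromℕ 3) √3 →
  (Σ[ A ∈ Algorithm deterministic ] Σ[ C ∈ ℕ ]
    ((G : Multigraph) (b : Fin (#V G) → ℕ) → (∀ v → 1 ℕ.≤ b v) →
     (f : Subset (#E G) → ℝ) → NonNegative f → Submodular f → Monotone f →
     (es : List (Fin (#E G))) → IsStream G es →
     let open Execution G b f
         s = outcome (run A es)
         M = selected s
     in
     UsesMemory C (Final.peak s) ×
     IsBMatching G b M ×
     (∀ Mopt → IsMaximizerAmong f (IsBMatching G b) Mopt →
      f Mopt ≤ (fromℕ 3 + fromℕ 2 * √2) * f M)))
  ×
  (Σ[ A ∈ Algorithm randomized ] Σ[ C ∈ ℕ ]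
    ((G : Multigraph) (b : Fin (#V G) → ℕ) → (∀ v → 1 ℕ.≤ b v) →
     (f : Subset (#E G) → ℝ) → NonNegative f → Submodular f →
     (es : List (Fin (#E G))) → IsStream G es →
     let open Execution G b f
         s = run A es
     in
     Surely (λ t → UsesMemory C (Final.peak t)) s ×
     Surely (λ t → IsBMatching G b (selected t)) s ×
     (∀ Mopt → IsMaximizerAmong f (IsBMatching G b) Mopt →
      f Mopt ≤ (fromℕ 4 + fromℕ 2 * √3) * 𝔼 (λ t → f (selected t)) s)))
theorem2 𝓡 √2 √3 isSqrt2 isSqrt3 =
    ( algorithm (monotoneParameters isSqrt2) , 58
    , λ G b 1≤b f nonneg submodular monotone es stream →
        let open Guarantees 𝓡 (monotoneParameters isSqrt2) G b 1≤b f nonneg submodular es stream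
            open Execution G b f
            r = run (algorithm (monotoneParameters isSqrt2)) es
        in Surely-outcome r memory-used , Surely-outcome r output-valid
         , λ O (isB , _) → subst₂ (λ c x → f O ≤ c * x) (monotone-κ isSqrt2) (𝔼-outcome (λ t → f (selected t)) r)
                             (monotone-ratio monotone isB) )
  , ( algorithm (generalParameters isSqrt3) , 58
    , λ G b 1≤b f nonneg submodular es stream →
        let open Guarantees 𝓡 (generalParameters isSqrt3) G b 1≤b f nonneg submodular es stream
        in memory-used , output-valid , λ O (isB , _) → general-ratio⇒ isSqrt3 (general-ratio isB) )
  where
  open RealNumbers 𝓡
  open Streaming 𝓡
  open Constants 𝓡
  open Deterministic 𝓡
  open Programs 𝓡
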